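{- Let $F$ be a non-Archimedean local field and $E=F\times E'$ with $E'/F$ an unramified quadratic field extension. Let $R$ be an order of $E$ with conductor $(\pi^{f_1})\times(\pi^{f_2})\subset\mathfrak o\times\mathcal O_{E'}=\mathcal O_E$, and write $S=S(R)$. Then, with all summation indices $a',b'$ ranging over integers, $$\begin{aligned} \#\overline{\mathrm{Cl}}(R)={}&2\sum_{0\le b'\le S-f_1}\Biggl(\ \sum_{\substack{0\le a'\le f_1\\ a'\le 2b'\\ a'\le S-f_2}}q^{\min(\lfloor a'/2\rfloor,\,S-f_1-b')}+\sum_{\substack{S-f_2<a'\le f_1\\ a'\le 2b'\\ \lceil a'/2\rceil-b'\le f_1-f_2}}q^{S-f_1-b'}\Biggr)-(S-f_1+1)\\ &-\sum_{\substack{0<a'\le f_1\\ a'\le S-f_2\\ 2\mid a'}}q^{\min\left(\frac{a'}2,\,S-f_1-\frac{a'}2\right)}-\sum_{\substack{S-f_2<a'\le f_1\\ 2\mid a'\\ S-f_1\le S-f_2}}q^{S-f_1-\frac{a'}2}\\ &-\sum_{0<b'\le S-f_1}\ \sum_{\substack{0<a'\le f_1\\ a'<2b',\ 2\mid a'\\ a'\le S-f_2\\ \frac{a'}2\le S-f_1-b'}}\left(q^{\frac{a'}2}-q^{\frac{a'}2-1}\right)-\sum_{\substack{S-f_2<a'\le f_1\\ 2\mid a'\\ S-f_2<S-f_1}}q^{S-f_2-\frac{a'}2}. \end{aligned}$$ (A condition not involving the summation index means that the sum is empty unless the condition holds.)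
   Context: $F$ has any characteristic, ring of integers $\mathfrak o$, uniformizer $\pi$, residue field of cardinality $q$; $\mathcal O_{E'}$ is the ring of integers of $E'$. The maximal order of $E$ is $\mathcal O_E=\mathfrak o\times\mathcal O_{E'}$. An order of $E$ is a subring $\mathcal O\subset E$ containing $\mathfrak o$ (embedded diagonally), finitely generated as an $\mathfrak o$-module, with $F\mathcal O=E$. The conductor of $R$ is $\{a\in\mathcal O_E: a\mathcal O_E\subset R\}$, and $S(R)$ is the length of $\mathcal O_E/R$ as an $\mathfrak o$-module. A fractional $R$-ideal is a finitely generated $R$-submodule $I\subset E$ with $FI=E$; $\overline{\mathrm{Cl}}(R)$ is the set (monoid) of fractional $R$-ideals modulo multiplication by $E^\times$. -}

module Defs where

open import Algebra.Bundles using (CommutativeRing)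
open import Algebra.Construct.DirectProduct using () renaming (commutativeRing to _×ᵣ_)
open import Algebra.Morphism.Structures using (IsRingHomomorphism)
import Algebra.Properties.AbelianGroup as AbelianGroupProperties
import Algebra.Properties.CommutativeSemigroup as CommutativeSemigroupProperties
import Algebra.Properties.Ring as RingProperties
import Algebra.Properties.Semiring.Exp as Exp
import Algebra.Properties.Semiring.Sum as Sum
open import Data.Fin.Base using (Fin)
open import Data.Integer.Base as ℤ using (ℤ; +_; -[1+_]; 0ℤ; 1ℤ; _/ℕ_)
import Data.Integer.Properties as ℤ
import Data.Integer.Divisibility as ℤ using (_∣_)
open import Data.List.Base using (List; map; filter; foldr; upTo)
open import Data.Nat.Base as ℕ using (ℕ; zero; suc)
import Data.Nat.Divisibility as ℕ using (_∣?_)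
open import Data.Product.Base using (Σ; ∃-syntax; _×_; _,_)
open import Data.Sum.Base using (_⊎_; inj₁; inj₂; [_,_]′)
open import Function.Base using (_∘_)
open import Function.Bundles using (Bijection; _⇔_; Equivalence)
open import Level using (Level; _⊔_; 0ℓ) renaming (suc to lsuc)
open import Relation.Binary.Bundles using (Setoid)
open import Relation.Binary.Construct.Add.Supremum.NonStrict ℤ._≤_ using (_≤⊤⁺; ≤⁺-trans)
  renaming (_≤⁺_ to _≤∞_; [_] to ≤[_])
import Relation.Binary.PropositionalEquality as ≡
open import Relation.Binary.PropositionalEquality using (_≡_)
import Relation.Binary.Reasoning.Setoid as SetoidReasoning
open import Relation.Nullary using (¬_; contradiction)
open import Relation.Nullary.Construct.Add.Supremum using (_⁺; [_]; ⊤⁺; []-injective)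
open import Relation.Nullary.Decidable using (_×-dec_)
open import Relation.Unary using (Pred; Decidable; _∈_; _⊂_; _≐_)

HasCardinality : ∀ {a ℓ} → Setoid a ℓ → ℕ → Set (a ⊔ ℓ)
HasCardinality A n = Bijection (≡.setoid (Fin n)) A

------------------------------------------------------------------------
-- Discretely valued fields

ℤ∞ : Set
ℤ∞ = ℤ ⁺

infixl 6 _+∞_
_+∞_ : ℤ∞ → ℤ∞ → ℤ∞
[ i ] +∞ [ j ] = [ i ℤ.+ j ]
[ _ ] +∞ ⊤⁺    = ⊤⁺
⊤⁺    +∞ _     = ⊤⁺

record DiscretelyValuedField (ℓ : Level) : Set (lsuc ℓ) where
  field
    commutativeRing : CommutativeRing ℓ ℓ

  open CommutativeRing commutativeRing public
  open Exp semiring public using (_^_)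

  field
    1≉0        : ¬ (1# ≈ 0#)
    invertible : ∀ {x} → ¬ (x ≈ 0#) → ∃[ y ] x * y ≈ 1#

    v      : Carrier → ℤ∞
    v-cong : ∀ {x y} → x ≈ y → v x ≡ v y
    v-∞    : ∀ {x} → v x ≡ ⊤⁺ ⇔ x ≈ 0#
    v-*    : ∀ x y → v (x * y) ≡ v x +∞ v y
    -- min (v x) (v y) ≤ v (x + y)
    v-+    : ∀ x y → v x ≤∞ v (x + y) ⊎ v y ≤∞ v (x + y)
    -- v is nontrivial and normalised: its value group is all of ℤ
    v-normalised : ∃[ ϖ ] v ϖ ≡ [ 1ℤ ]

  IsUniformizer : Pred Carrier 0ℓ
  IsUniformizer ϖ = v ϖ ≡ [ 1ℤ ]

  v≥ : ℤ → Pred Carrier 0ℓ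
  v≥ n x = [ n ] ≤∞ v x

  -- the ring of integers and its maximal ideal
  𝒪 𝔪 : Pred Carrier 0ℓ
  𝒪 = v≥ 0ℤ
  𝔪 = v≥ 1ℤ

  Cauchy : (ℕ → Carrier) → Set
  Cauchy s = ∀ (n : ℕ) → ∃[ N ] ∀ {i j} → N ℕ.≤ i → N ℕ.≤ j → v≥ (+ n) (s i - s j)

  _⟶_ : (ℕ → Carrier) → Carrier → Set
  s ⟶ x = ∀ (n : ℕ) → ∃[ N ] ∀ {i} → N ℕ.≤ i → v≥ (+ n) (s i - x)

  Complete : Set ℓ
  Complete = ∀ s → Cauchy s → ∃[ x ] s ⟶ x

  private
    open RingProperties ring using (-1*x≈-x; -‿+-comm; -‿distribʳ-*; -‿distribˡ-*)
    open AbelianGroupProperties +-abelianGroup using (⁻¹-involutive)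
    open CommutativeSemigroupProperties +-commutativeSemigroup using (interchange)
    open SetoidReasoning setoid

    trans∞ : ∀ {i j k} → i ≤∞ j → j ≤∞ k → i ≤∞ k
    trans∞ = ≤⁺-trans ℤ.≤-trans

    v≥-resp : ∀ {n x y} → x ≈ y → v≥ n x → v≥ n y
    v≥-resp x≈y = ≡.subst (_ ≤∞_) (v-cong x≈y)

    v≥-+ : ∀ {n x y} → v≥ n x → v≥ n y → v≥ n (x + y)
    v≥-+ {x = x} {y} p q = [ trans∞ p , trans∞ q ]′ (v-+ x y)

    v≥-0 : ∀ {n x} → x ≈ 0# → v≥ n x
    v≥-0 x≈0 = ≡.subst (_ ≤∞_) (≡.sym (Equivalence.from v-∞ x≈0)) (_ ≤⊤⁺)

    +∞-mono : ∀ {n i j} → [ 0ℤ ] ≤∞ i → [ n ] ≤∞ j → [ n ] ≤∞ i +∞ j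
    +∞-mono {n} ≤[ p ]   ≤[ q ]   = ≤[ ≡.subst (ℤ._≤ _) (ℤ.+-identityˡ n) (ℤ.+-mono-≤ p q) ]
    +∞-mono     ≤[ _ ]   (_ ≤⊤⁺)  = _ ≤⊤⁺
    +∞-mono     (_ ≤⊤⁺)  _        = _ ≤⊤⁺

    v≥-* : ∀ {n x y} → 𝒪 x → v≥ n y → v≥ n (x * y)
    v≥-* {x = x} {y} p q = ≡.subst (_ ≤∞_) (≡.sym (v-* x y)) (+∞-mono p q)

    idempotent⇒0 : ∀ i → ¬ (i ≡ ⊤⁺) → i ≡ i +∞ i → i ≡ [ 0ℤ ]
    idempotent⇒0 ⊤⁺    i≢∞ _  = contradiction ≡.refl i≢∞
    idempotent⇒0 [ i ] _   eq = ≡.cong [_] (identityˡ-unique i i (≡.sym ([]-injective eq)))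
      where open AbelianGroupProperties ℤ.+-0-abelianGroup using (identityˡ-unique)

    v1 : v 1# ≡ [ 0ℤ ]
    v1 = idempotent⇒0 (v 1#) (1≉0 ∘ Equivalence.to v-∞)
           (≡.trans (v-cong (sym (*-identityˡ 1#))) (v-* 1# 1#))

    double≡0 : ∀ i → i +∞ i ≡ [ 0ℤ ] → i ≡ [ 0ℤ ]
    double≡0 [ + zero ] _ = ≡.refl

    v-1 : v (- 1#) ≡ [ 0ℤ ]
    v-1 = double≡0 (v (- 1#)) (≡.trans (≡.sym (v-* (- 1#) (- 1#)))
            (≡.trans (v-cong (trans (-1*x≈-x (- 1#)) (⁻¹-involutive 1#))) v1))

    ≡0⇒𝒪 : ∀ {x} → v x ≡ [ 0ℤ ] → 𝒪 x
    ≡0⇒𝒪 eq = ≡.subst (_ ≤∞_) (≡.sym eq) ≤[ ℤ.≤-refl ]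

    v≥-neg : ∀ {n x} → v≥ n x → v≥ n (- x)
    v≥-neg {x = x} p = v≥-resp (-1*x≈-x x) (v≥-* (≡0⇒𝒪 v-1) p)

    Ō : Set ℓ
    Ō = Σ Carrier 𝒪

    x≈y⇒x-y≈0 : ∀ {x y} → x ≈ y → x - y ≈ 0#
    x≈y⇒x-y≈0 {y = y} x≈y = trans (+-congʳ x≈y) (-‿inverseʳ y)

    infix 4 _∼_
    _∼_ : Ō → Ō → Set
    (x , _) ∼ (y , _) = 𝔪 (x - y)

    ≈⇒∼ : ∀ {x y} → x ≈ y → 𝔪 (x - y)
    ≈⇒∼ x≈y = v≥-0 (x≈y⇒x-y≈0 x≈y)

    neg-minus : ∀ x y → - (x - y) ≈ y - x
    neg-minus x y = begin
      - (x - y)     ≈⟨ -‿+-comm x (- y) ⟨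
      - x - - y     ≈⟨ +-congˡ (⁻¹-involutive y) ⟩
      - x + y       ≈⟨ +-comm (- x) y ⟩
      y - x         ∎

    telescope : ∀ x y z → (x - y) + (y - z) ≈ x - z
    telescope x y z = begin
      (x - y) + (y - z)     ≈⟨ +-assoc x (- y) (y - z) ⟩
      x + (- y + (y - z))   ≈⟨ +-congˡ (+-assoc (- y) y (- z)) ⟨
      x + ((- y + y) - z)   ≈⟨ +-congˡ (+-congʳ (-‿inverseˡ y)) ⟩
      x + (0# - z)          ≈⟨ +-congˡ (+-identityˡ (- z)) ⟩
      x - z                 ∎

    +-minus : ∀ x y u w → (x - y) + (u - w) ≈ (x + u) - (y + w)
    +-minus x y u w = trans (interchange x (- y) u (- w)) (+-congˡ (-‿+-comm y w))

    *-minus : ∀ x y u w → w * (x - y) + x * (u - w) ≈ x * u - y * w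
    *-minus x y u w = begin
      w * (x - y) + x * (u - w)                  ≈⟨ +-cong (*-comm w (x - y)) (distribˡ x u (- w)) ⟩
      (x - y) * w + (x * u + x * - w)            ≈⟨ +-cong (distribʳ w x (- y)) (+-congˡ (sym (-‿distribʳ-* x w))) ⟩
      (x * w + - y * w) + (x * u - x * w)        ≈⟨ +-congʳ (+-congˡ (sym (-‿distribˡ-* y w))) ⟩
      (x * w - y * w) + (x * u - x * w)          ≈⟨ +-comm (x * w - y * w) (x * u - x * w) ⟩
      (x * u - x * w) + (x * w - y * w)          ≈⟨ telescope (x * u) (x * w) (y * w) ⟩
      x * u - y * w                              ∎

  residueField : CommutativeRing ℓ 0ℓ
  residueField = record
    { Carrier = Ō
    ; _≈_     = _∼_
    ; _+_     = λ (x , p) (y , q) → x + y , v≥-+ p q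
    ; _*_     = λ (x , p) (y , q) → x * y , v≥-* p q
    ; -_      = λ (x , p) → - x , v≥-neg p
    ; 0#      = 0# , v≥-0 refl
    ; 1#      = 1# , ≡0⇒𝒪 v1
    ; isCommutativeRing = record
      { isRing = record
        { +-isAbelianGroup = record
          { isGroup = record
            { isMonoid = record
              { isSemigroup = record
                { isMagma = record
                  { isEquivalence = record
                    { refl  = ≈⇒∼ refl
                    ; sym   = λ {(x , _)} {(y , _)} x∼y → v≥-resp (neg-minus x y) (v≥-neg x∼y)
                    ; trans = λ {(x , _)} {(y , _)} {(z , _)} x∼y y∼z →
                        v≥-resp (telescope x y z) (v≥-+ x∼y y∼z)
                    }
                  ; ∙-cong = λ {(x , _)} {(y , _)} {(u , _)} {(w , _)} x∼y u∼w →
                      v≥-resp (+-minus x y u w) (v≥-+ x∼y u∼w)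
                  }
                ; assoc = λ (x , _) (y , _) (z , _) → ≈⇒∼ (+-assoc x y z)
                }
              ; identity = (λ (x , _) → ≈⇒∼ (+-identityˡ x))
                         , (λ (x , _) → ≈⇒∼ (+-identityʳ x))
              }
            ; inverse = (λ (x , _) → ≈⇒∼ (-‿inverseˡ x))
                      , (λ (x , _) → ≈⇒∼ (-‿inverseʳ x))
            ; ⁻¹-cong = λ {(x , _)} {(y , _)} x∼y →
                v≥-resp (sym (-‿+-comm x (- y))) (v≥-neg x∼y)
            }
          ; comm = λ (x , _) (y , _) → ≈⇒∼ (+-comm x y)
          }
        ; *-cong = λ {(x , p)} {(y , _)} {(u , _)} {(w , q)} x∼y u∼w →
            v≥-resp (*-minus x y u w) (v≥-+ (v≥-* q x∼y) (v≥-* p u∼w))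
        ; *-assoc = λ (x , _) (y , _) (z , _) → ≈⇒∼ (*-assoc x y z)
        ; *-identity = (λ (x , _) → ≈⇒∼ (*-identityˡ x))
                     , (λ (x , _) → ≈⇒∼ (*-identityʳ x))
        ; distrib = (λ (x , _) (y , _) (z , _) → ≈⇒∼ (distribˡ x y z))
                  , (λ (x , _) (y , _) (z , _) → ≈⇒∼ (distribʳ x y z))
        }
      ; *-comm = λ (x , _) (y , _) → ≈⇒∼ (*-comm x y)
      }
    }

record NonArchimedeanLocalField (ℓ : Level) : Set (lsuc ℓ) where
  field
    valuedField : DiscretelyValuedField ℓ

  open DiscretelyValuedField valuedField public

  field
    complete : Complete
    q        : ℕ
    residueField-finite : HasCardinality (CommutativeRing.setoid residueField) q

------------------------------------------------------------------------
-- Unramified quadratic extensions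

HasDegree : ∀ {a b ℓ₁ ℓ₂} (K : CommutativeRing a ℓ₁) (L : CommutativeRing b ℓ₂) →
            (CommutativeRing.Carrier K → CommutativeRing.Carrier L) → ℕ → Set (a ⊔ b ⊔ ℓ₁ ⊔ ℓ₂)
HasDegree K L f n = ∃[ e ]
    (∀ y → ∃[ a ] y L.≈ combination a e)
  × (∀ a → combination a e L.≈ L.0# → ∀ i → a i K.≈ K.0#)
  where
  module K = CommutativeRing K
  module L = CommutativeRing L
  combination : (Fin n → K.Carrier) → (Fin n → L.Carrier) → L.Carrier
  combination a e = Sum.sum L.semiring (λ i → f (a i) L.* e i)

-- Unramified means that the degree equals the residue degree; the
-- residue extension is separable because the residue field of F is
-- finite.  Completeness of E′ and finiteness of its residue field
-- follow from the degree conditions, so they are not required.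
record UnramifiedQuadraticExtension {ℓ} (F : NonArchimedeanLocalField ℓ) : Set (lsuc ℓ) where
  private module F = NonArchimedeanLocalField F

  field
    valuedField : DiscretelyValuedField ℓ

  open DiscretelyValuedField valuedField public

  field
    ι              : F.Carrier → Carrier
    ι-homomorphism : IsRingHomomorphism F.rawRing rawRing ι
    -- the valuation of E′ prolongs that of F (up to normalisation)
    ι-𝒪            : ∀ {x} → x ∈ F.𝒪 ⇔ ι x ∈ 𝒪

  ῑ : CommutativeRing.Carrier F.residueField → CommutativeRing.Carrier residueField
  ῑ (x , x∈𝒪) = ι x , Equivalence.to ι-𝒪 x∈𝒪

  field
    degree        : HasDegree F.commutativeRing commutativeRing ι 2
    residueDegree : HasDegree F.residueField residueField ῑ 2

------------------------------------------------------------------------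
-- Submodules of a commutative ring over a subset K of scalars

module Submodules {c ℓ} (A : CommutativeRing c ℓ) where
  open CommutativeRing A
  open Sum semiring using (sum)

  record IsSubmodule {k m} (K : Pred Carrier k) (M : Pred Carrier m) : Set (c ⊔ ℓ ⊔ k ⊔ m) where
    field
      resp     : ∀ {x y} → x ≈ y → x ∈ M → y ∈ M
      0∈       : 0# ∈ M
      +-closed : ∀ {x y} → x ∈ M → y ∈ M → x + y ∈ M
      *-closed : ∀ {a x} → a ∈ K → x ∈ M → a * x ∈ M

  Span : ∀ {k n} → Pred Carrier k → (Fin n → Carrier) → Pred Carrier (c ⊔ ℓ ⊔ k)
  Span {n = n} K g x = Σ (Fin n → Carrier) λ a → (∀ i → a i ∈ K) × x ≈ sum (λ i → a i * g i)

  FinitelyGenerated : ∀ {k m} → Pred Carrier k → Pred Carrier m → Set (c ⊔ ℓ ⊔ k ⊔ m)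
  FinitelyGenerated K M = ∃[ n ] Σ (Fin n → Carrier) λ g → M ≐ Span K g

  infixl 7 _·_
  _·_ : ∀ {k m} → Pred Carrier k → Pred Carrier m → Pred Carrier (c ⊔ ℓ ⊔ k ⊔ m)
  (K · M) x = ∃[ n ] Σ (Fin n → Carrier) λ g → (∀ i → g i ∈ M) × x ∈ Span K g

  infixr 7 _•_
  _•_ : ∀ {m} → Carrier → Pred Carrier m → Pred Carrier (c ⊔ ℓ ⊔ m)
  (e • M) x = ∃[ y ] y ∈ M × x ≈ e * y

  IsUnit : Pred Carrier (c ⊔ ℓ)
  IsUnit e = ∃[ e⁻¹ ] e * e⁻¹ ≈ 1#

  module _ {k} (K : Pred Carrier k) where

    -- For K-submodules M: N is a K-submodule with N / M simple.
    SimpleQuotient : Pred Carrier (c ⊔ ℓ) → Pred Carrier (c ⊔ ℓ) → Set (lsuc (c ⊔ ℓ) ⊔ k)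
    SimpleQuotient N M = IsSubmodule K N × M ⊂ N ×
      ¬ (Σ (Pred Carrier (c ⊔ ℓ)) λ P → IsSubmodule K P × M ⊂ P × P ⊂ N)

    -- The length of N / M is n, as witnessed by a composition series
    -- M = M₀ ⊂ M₁ ⊂ … ⊂ Mₙ = N.
    data QuotientHasLength {m} (N : Pred Carrier m) :
           Pred Carrier (c ⊔ ℓ) → ℕ → Set (lsuc (c ⊔ ℓ) ⊔ k ⊔ m) where
      done : ∀ {M} → M ≐ N → QuotientHasLength N M 0
      step : ∀ {M M₁ n} → SimpleQuotient M₁ M → QuotientHasLength N M₁ n →
             QuotientHasLength N M (suc n)

------------------------------------------------------------------------
-- Orders of E = F × E′

module Orders {ℓ} (F : NonArchimedeanLocalField ℓ) (E′ : UnramifiedQuadraticExtension F) where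

  private
    module F  = NonArchimedeanLocalField F
    module E′ = UnramifiedQuadraticExtension E′

  E : CommutativeRing ℓ ℓ
  E = F.commutativeRing ×ᵣ E′.commutativeRing

  open CommutativeRing E
  open Submodules E

  diagonal : F.Carrier → Carrier
  diagonal a = a , E′.ι a

  -- F and 𝔬, embedded diagonally in E
  ΔF Δ𝔬 : Pred Carrier ℓ
  ΔF z = ∃[ a ] z ≈ diagonal a
  Δ𝔬 z = ∃[ a ] a ∈ F.𝒪 × z ≈ diagonal a

  𝒪ᴱ : Pred Carrier 0ℓ
  𝒪ᴱ (x , y) = x ∈ F.𝒪 × y ∈ E′.𝒪

  record Order : Set (lsuc ℓ) where
    field
      R        : Pred Carrier ℓ
      resp     : ∀ {x y} → x ≈ y → x ∈ R → y ∈ R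
      +-closed : ∀ {x y} → x ∈ R → y ∈ R → x + y ∈ R
      *-closed : ∀ {x y} → x ∈ R → y ∈ R → x * y ∈ R
      neg-closed : ∀ {x} → x ∈ R → - x ∈ R
      1∈       : 1# ∈ R
      𝔬⊆       : ∀ {x} → x ∈ Δ𝔬 → x ∈ R
      finitelyGenerated : FinitelyGenerated Δ𝔬 R
      full     : ∀ x → x ∈ ΔF · R

  conductor : Order → Pred Carrier ℓ
  conductor O a = a ∈ 𝒪ᴱ × (∀ {b} → b ∈ 𝒪ᴱ → a * b ∈ Order.R O)

  -- (π ^ f₁) × (π ^ f₂) ⊂ 𝔬 × 𝒪_E′
  PowerIdeal : F.Carrier → ℕ → ℕ → Pred Carrier ℓ
  PowerIdeal π f₁ f₂ (x , y) =
      (∃[ a ] a ∈ F.𝒪  × x F.≈ (π F.^ f₁) F.* a)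
    × (∃[ b ] b ∈ E′.𝒪 × y E′.≈ (E′.ι π E′.^ f₂) E′.* b)

  -- S(R) = n
  HasColength : Order → ℕ → Set (lsuc ℓ)
  HasColength O n = QuotientHasLength Δ𝔬 𝒪ᴱ (Order.R O) n

  record FractionalIdeal (O : Order) : Set (lsuc ℓ) where
    open Order O using (R)
    field
      I                 : Pred Carrier ℓ
      isSubmodule       : IsSubmodule R I
      finitelyGenerated : FinitelyGenerated R I
      full              : ∀ x → x ∈ ΔF · I

  open FractionalIdeal using (I)

  -- Fractional ideals modulo multiplication by E^×
  Cl : Order → Setoid (lsuc ℓ) ℓ
  Cl O = record
    { Carrier = FractionalIdeal O
    ; _≈_     = _≃_
    ; isEquivalence = record
      { refl  = λ {J} → ≃-refl J
      ; sym   = λ {J₁} {J₂} → ≃-sym J₁ J₂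
      ; trans = λ {J₁} {J₂} {J₃} → ≃-trans J₁ J₂ J₃
      }
    }
    where
    _≃_ : FractionalIdeal O → FractionalIdeal O → Set ℓ
    J₁ ≃ J₂ = ∃[ e ] IsUnit e × I J₂ ≐ e • I J₁

    ideal-resp : ∀ (J : FractionalIdeal O) {x y} → x ≈ y → x ∈ I J → y ∈ I J
    ideal-resp J = IsSubmodule.resp (FractionalIdeal.isSubmodule J)

    cancel : ∀ {e e⁻¹} → e * e⁻¹ ≈ 1# → ∀ x → e⁻¹ * (e * x) ≈ x
    cancel {e} {e⁻¹} ee⁻¹≈1 x =
      trans (sym (*-assoc e⁻¹ e x))
        (trans (*-congʳ (trans (*-comm e⁻¹ e) ee⁻¹≈1)) (*-identityˡ x))

    ≃-refl : ∀ J → J ≃ J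
    ≃-refl J = 1# , (1# , *-identityˡ 1#)
      , (λ {x} x∈J → x , x∈J , sym (*-identityˡ x))
      , (λ (y , y∈J , x≈1y) → ideal-resp J (sym (trans x≈1y (*-identityˡ y))) y∈J)

    ≃-sym : ∀ J₁ J₂ → J₁ ≃ J₂ → J₂ ≃ J₁
    ≃-sym J₁ J₂ (e , (e⁻¹ , ee⁻¹≈1) , J₂⊆ , ⊆J₂) = e⁻¹ , (e , trans (*-comm e⁻¹ e) ee⁻¹≈1)
      , (λ {x} x∈J₁ → e * x , ⊆J₂ (x , x∈J₁ , refl) , sym (cancel ee⁻¹≈1 x))
      , (λ (y , y∈J₂ , x≈e⁻¹y) → let (z , z∈J₁ , y≈ez) = J₂⊆ y∈J₂ in
          ideal-resp J₁ (sym (trans x≈e⁻¹y (trans (*-congˡ y≈ez) (cancel ee⁻¹≈1 z)))) z∈J₁)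

    ≃-trans : ∀ J₁ J₂ J₃ → J₁ ≃ J₂ → J₂ ≃ J₃ → J₁ ≃ J₃
    ≃-trans J₁ J₂ J₃ (d , (d⁻¹ , dd⁻¹≈1) , J₂⊆ , ⊆J₂) (e , (e⁻¹ , ee⁻¹≈1) , J₃⊆ , ⊆J₃) =
      e * d
      , (d⁻¹ * e⁻¹ , trans (*-assoc e d (d⁻¹ * e⁻¹))
          (trans (*-congˡ (trans (sym (*-assoc d d⁻¹ e⁻¹)) (trans (*-congʳ dd⁻¹≈1) (*-identityˡ e⁻¹))))
                 ee⁻¹≈1))
      , (λ x∈J₃ → let (y , y∈J₂ , x≈ey) = J₃⊆ x∈J₃
                      (z , z∈J₁ , y≈dz) = J₂⊆ y∈J₂ in
          z , z∈J₁ , trans x≈ey (trans (*-congˡ y≈dz) (sym (*-assoc e d z))))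
      , (λ (z , z∈J₁ , x≈edz) →
          ⊆J₃ (d * z , ⊆J₂ (z , z∈J₁ , refl) , trans x≈edz (*-assoc e d z)))

------------------------------------------------------------------------
-- The counting formula

infix 5 _⋯_
_⋯_ : ℤ → ℤ → List ℤ
lo ⋯ hi = map (λ k → lo ℤ.+ + k) (upTo (size (1ℤ ℤ.+ hi ℤ.- lo)))
  where
  size : ℤ → ℕ
  size (+ n)    = n
  size -[1+ _ ] = 0

∑-syntax : List ℤ → (ℤ → ℤ) → ℤ
∑-syntax is f = foldr ℤ._+_ 0ℤ (map f is)

∑-filter-syntax : ∀ {p} {P : Pred ℤ p} → List ℤ → Decidable P → (ℤ → ℤ) → ℤ
∑-filter-syntax is P? f = ∑-syntax (filter P? is) f

infixr 4 ∑-syntax ∑-filter-syntax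
syntax ∑-syntax is (λ i → t) = ∑[ i ∈ is ] t
syntax ∑-filter-syntax is P? (λ i → t) = ∑[ i ∈ is ∣ P? ] t

⌊_/2⌋ ⌈_/2⌉ : ℤ → ℤ
⌊ i /2⌋ = i /ℕ 2
⌈ i /2⌉ = ℤ.- ((ℤ.- i) /ℕ 2)

infixr 8 _^ᶻ_
-- Only used for nonnegative exponents: every exponent in the formula is
-- nonnegative when f₁, f₂ and S come from an order.
_^ᶻ_ : ℕ → ℤ → ℤ
q ^ᶻ (+ n)    = + (q ℕ.^ n)
q ^ᶻ -[1+ _ ] = 1ℤ

module _ (q f₁ f₂ S : ℕ) where
  open import Data.Integer.Base using (_+_; _-_; _*_; _⊓_)
  open import Data.Integer.Properties using (_≤?_; _<?_)

  private
    F₁ F₂ S′ : ℤ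
    F₁ = + f₁
    F₂ = + f₂
    S′ = + S

    even? : Decidable (λ i → + 2 ℤ.∣ i)
    even? i = 2 ℕ.∣? ℤ.∣ i ∣

  classNumberFormula : ℤ
  classNumberFormula =
      + 2 * (∑[ b ∈ 0ℤ ⋯ S′ - F₁ ]
          ( (∑[ a ∈ 0ℤ ⋯ F₁ ∣ (λ a → (a ≤? + 2 * b) ×-dec (a ≤? S′ - F₂)) ]
              q ^ᶻ (⌊ a /2⌋ ⊓ (S′ - F₁ - b)))
          + (∑[ a ∈ (1ℤ + (S′ - F₂)) ⋯ F₁ ∣ (λ a → (a ≤? + 2 * b) ×-dec (⌈ a /2⌉ - b ≤? F₁ - F₂)) ]
              q ^ᶻ (S′ - F₁ - b))))
    - (S′ - F₁ + 1ℤ)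
    - (∑[ a ∈ 1ℤ ⋯ F₁ ∣ (λ a → (a ≤? S′ - F₂) ×-dec even? a) ]
        q ^ᶻ (⌊ a /2⌋ ⊓ (S′ - F₁ - ⌊ a /2⌋)))
    - (∑[ a ∈ (1ℤ + (S′ - F₂)) ⋯ F₁ ∣ (λ a → even? a ×-dec (S′ - F₁ ≤? S′ - F₂)) ]
        q ^ᶻ (S′ - F₁ - ⌊ a /2⌋))
    - (∑[ b ∈ 1ℤ ⋯ S′ - F₁ ]
        (∑[ a ∈ 1ℤ ⋯ F₁ ∣ (λ a → (a <? + 2 * b) ×-dec even? a ×-dec (a ≤? S′ - F₂)
                                 ×-dec (⌊ a /2⌋ ≤? S′ - F₁ - b)) ]
          (q ^ᶻ ⌊ a /2⌋ - q ^ᶻ (⌊ a /2⌋ - 1ℤ))))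
    - (∑[ a ∈ (1ℤ + (S′ - F₂)) ⋯ F₁ ∣ (λ a → even? a ×-dec (S′ - F₂ <? S′ - F₁)) ]
        q ^ᶻ (S′ - F₂ - ⌊ a /2⌋))

{-# OPTIONS --safe #-}
-- Write 𝒪_E′ = 𝔬[ω].  Every 𝔬-lattice of E contains an element of minimal
-- valuation in both components; dividing by it gives a lattice that
-- contains 1 and lies in 𝒪_E, and the lattices with these two properties are the
--   L a b β = {(x , y + s πᵇω) : x ≡ y + β s mod πᵃ}.
-- In particular R = L f₁ c r; then S = f₁ + c, and S - f₂ is the valuation of
-- r truncated at c and f₁.  Stability of L a b β under R is a pair of
-- congruences on β.  Homothetic lattices have the same a and b, and L a b β
-- is homothetic to L a b β′ if and only if β and β′ have the same valuation
-- truncated at b and ⌈a/2⌉, and are congruent modulo π to twice that, or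
-- modulo πᵃ.  So for fixed a and b the classes are counted by residue classes,
-- and the formula holds for the terms belonging to each value of a separately.
module Submission where

open import Data.Integer.Base using (+_)
open import Data.Nat.Base using (ℕ)
open import Data.Product.Base using (∃-syntax; _×_)
open import Relation.Binary.PropositionalEquality using (_≡_)
open import Relation.Unary using (_≐_)
open import Defs

-- One quadratic form controls both stability and homothety: N(β), the norm of β - πᵇω. Let `R` be
-- generated over 𝔬 by 1, ρ = (r , πᶜω) and (π^f₁ , 0), and put θ = (β , πᵇω). The first congruence
-- says that ρ·1 lies in the lattice: π^(c-b) β ≡ r mod πᵃ. The second says the same of ρ·θ and
-- becomes π^(c-b) N(β) ≡ 0 mod πᵃ. A homothety by (u , y + sπᵇω) from β to β′ changes the parameter
-- modulo πᵃ by s N(β′)/u up to sign. As E′ is unramified, the norm is anisotropic modulo π, so N(β)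
-- has valuation exactly twice min(v β, b); once this reaches a, only congruence modulo πᵃ is left,
-- whence the truncation at ⌈a/2⌉. For the lattice `R` itself the second congruence gives f₁ ≤ 2(S -
-- f₂), which keeps the exponents of the correction terms nonnegative. For a ≤ S - f₂ the number r
-- vanishes modulo πᵃ and the stable β form a ball around 0, to be cut into spheres; for larger a
-- they form at most one coset, that of r / π^(c-b).

module ClassNumberFormula where
  open import Data.Bool.Base using (if_then_else_)
  open import Data.Integer.Base as ℤ using (ℤ; +_; -[1+_]; 0ℤ; 1ℤ)
  import Data.Integer.Divisibility as ℤ using (_∣_)
  import Data.Integer.Properties as ℤ
  import Data.Integer.Tactic.RingSolver as ℤ
  open import Data.List.Base as List using (List; _∷_; []; _++_; map; filter; upTo)
  import Data.List.Properties as List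
  open import Data.Nat.Base as ℕ hiding (⌊_/2⌋; ⌈_/2⌉)
  open import Data.Nat.DivMod using (m/n≡1+[m∸n]/n; _/_; _%_; [m+n]%n≡m%n)
  open import Data.Nat.Divisibility as ℕ using (_∣?_; divides)
  open import Data.Nat.Properties as ℕ
  open import Data.Nat.Tactic.RingSolver using (solve)
  open import Data.Product.Base using (_×_; _,_; proj₁; proj₂)
  open import Data.Sum.Base using (inj₁; inj₂)
  open import Function.Base using (_∘_; id)
  open import Function.Bundles using (_⇔_; mk⇔; Equivalence)
  open import Relation.Binary.PropositionalEquality
  open import Relation.Nullary using (¬_; Dec; yes; no; does; contradiction)
  open import Relation.Nullary.Decidable using (_×-dec_)
  open import Relation.Unary using (Pred; Decidable)

  open ≡-Reasoning

  -- Finite sums over initial segments of ℕ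

  ∑[_] : (n : ℕ) → (ℕ → ℕ) → ℕ
  ∑[ zero  ] f = 0
  ∑[ suc n ] f = ∑[ n ] f + f n

  ≤-from : ∀ {m n} k → m + k ≡ n → m ≤ n
  ≤-from {m} k refl = m≤m+n m k

  -- Turns linear arithmetic into a polynomial identity for the ring solver: the hypotheses are
  -- added up to one inequality `x ≤ y`, and `k` is the slack. With `m = 1` and `n = 0` it derives
  -- contradictions.
  ≤-by : ∀ {x y m n} → x ≤ y → ∀ k → m + y + k ≡ n + x → m ≤ n
  ≤-by {x} {y} {m} {n} x≤y k eq = +-cancelʳ-≤ y m n
    (≤-trans (m≤m+n (m + y) k) (≤-trans (≤-reflexive eq) (+-monoʳ-≤ n x≤y)))

  ∑-cong : ∀ n {f g : ℕ → ℕ} → (∀ i → i < n → f i ≡ g i) → ∑[ n ] f ≡ ∑[ n ] g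
  ∑-cong zero    eq = refl
  ∑-cong (suc n) eq = cong₂ _+_ (∑-cong n (λ i i<n → eq i (m<n⇒m<1+n i<n))) (eq n ≤-refl)

  ∑-+ : ∀ n (f g : ℕ → ℕ) → ∑[ n ] (λ i → f i + g i) ≡ ∑[ n ] f + ∑[ n ] g
  ∑-+ zero    f g = refl
  ∑-+ (suc n) f g = trans (cong (_+ (f n + g n)) (∑-+ n f g)) (lemma (∑[ n ] f) (∑[ n ] g) (f n) (g n))
    where
    lemma : ∀ a b c d → a + b + (c + d) ≡ a + c + (b + d)
    lemma a b c d = solve (a ∷ b ∷ c ∷ d ∷ [])

  ∑-const : ∀ n x → ∑[ n ] (λ _ → x) ≡ n * x
  ∑-const zero    x = refl
  ∑-const (suc n) x = trans (cong (_+ x) (∑-const n x)) (+-comm (n * x) x)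

  ∑-zero : ∀ n {f} → (∀ i → i < n → f i ≡ 0) → ∑[ n ] f ≡ 0
  ∑-zero n eq = trans (∑-cong n eq) (trans (∑-const n 0) (*-zeroʳ n))

  ∑-*ˡ : ∀ n x f → ∑[ n ] (λ i → x * f i) ≡ x * ∑[ n ] f
  ∑-*ˡ zero    x f = sym (*-zeroʳ x)
  ∑-*ˡ (suc n) x f = trans (cong (_+ x * f n) (∑-*ˡ n x f)) (sym (*-distribˡ-+ x (∑[ n ] f) (f n)))

  ∑-split : ∀ m n f → ∑[ m + n ] f ≡ ∑[ m ] f + ∑[ n ] (λ k → f (m + k))
  ∑-split m zero    f = trans (cong (λ k → ∑[ k ] f) (+-identityʳ m)) (sym (+-identityʳ _))
  ∑-split m (suc n) f = trans (cong (λ k → ∑[ k ] f) (+-suc m n))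
    (trans (cong (_+ f (m + n)) (∑-split m n f)) (+-assoc (∑[ m ] f) _ _))

  ∑-swap : ∀ m n (f : ℕ → ℕ → ℕ) → ∑[ m ] (λ i → ∑[ n ] (f i)) ≡ ∑[ n ] (λ j → ∑[ m ] (λ i → f i j))
  ∑-swap zero    n f = sym (∑-zero n (λ _ _ → refl))
  ∑-swap (suc m) n f = trans (cong (_+ ∑[ n ] (f m)) (∑-swap m n f)) (sym (∑-+ n (λ j → ∑[ m ] (λ i → f i j)) (f m)))

  ∑-reverse : ∀ n f → ∑[ n ] (λ i → f (n ∸ suc i)) ≡ ∑[ n ] f
  ∑-reverse zero    f = refl
  ∑-reverse (suc n) f = begin
    ∑[ 1 + n ] (λ i → f (n ∸ i))            ≡⟨ ∑-split 1 n (λ i → f (n ∸ i)) ⟩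
    f n + ∑[ n ] (λ i → f (n ∸ suc i))      ≡⟨ +-comm (f n) _ ⟩
    ∑[ n ] (λ i → f (n ∸ suc i)) + f n      ≡⟨ cong (_+ f n) (∑-reverse n f) ⟩
    ∑[ suc n ] f                            ∎

  infix 6 [_]·_
  -- The Iverson bracket. It keeps the range of a conditional sum independent of the condition, so
  -- that double sums can be swapped.
  [_]·_ : ∀ {p} {P : Set p} → Dec P → ℕ → ℕ
  [ d ]· x = if does d then x else 0

  []-yes : ∀ {p} {P : Set p} (d : Dec P) {x} → P → [ d ]· x ≡ x
  []-yes (yes _) p = refl
  []-yes (no ¬p) p = contradiction p ¬p

  []-no : ∀ {p} {P : Set p} (d : Dec P) {x} → ¬ P → [ d ]· x ≡ 0
  []-no (yes p) ¬p = contradiction p ¬p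
  []-no (no _)  ¬p = refl

  -- `l`, `w` and `r` count the indices below, inside and above the interval where the condition
  -- holds. The conditions on `b` in the formula cut out such intervals.
  ∑-interval : ∀ {n} l w r {p} {P : ℕ → Set p} (P? : ∀ k → Dec (P k)) (f : ℕ → ℕ) → l + w + r ≡ n →
               (∀ k → k < l → ¬ P k) → (∀ k → k < w → P (l + k)) → (∀ k → k < r → ¬ P (l + w + k)) →
               ∑[ n ] (λ k → [ P? k ]· f k) ≡ ∑[ w ] (λ k → f (l + k))
  ∑-interval l w r P? f refl below inside above = begin
    ∑[ l + w + r ] F                                          ≡⟨ ∑-split (l + w) r F ⟩
    ∑[ l + w ] F + ∑[ r ] (λ k → F (l + w + k))                  ≡⟨ cong₂ _+_ (∑-split l w F) (∑-zero r (λ k k<r → []-no (P? _) (above k k<r))) ⟩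
    ∑[ l ] F + ∑[ w ] (λ k → F (l + k)) + 0                        ≡⟨ +-identityʳ _ ⟩
    ∑[ l ] F + ∑[ w ] (λ k → F (l + k))                            ≡⟨ cong₂ _+_ (∑-zero l (λ k k<l → []-no (P? _) (below k k<l)))
                                                                           (∑-cong w (λ k k<w → []-yes (P? _) (inside k k<w))) ⟩
    ∑[ w ] (λ k → f (l + k))                                       ∎
    where
    F : ℕ → ℕ
    F k = [ P? k ]· f k

  -- Class counts and main terms summed over b

  module Count (q : ℕ) (q≥1 : 1 ≤ q) where

    -- the number of residues of valuation k modulo π^(2k), except that all units are identified
    level : ℕ → ℕ
    level zero    = 1
    level (suc k) = (q ∸ 1) * q ^ k

    -- the number of classes with parameters b and a = h + g, for a ≤ m
    count≤ : ℕ → ℕ → ℕ → ℕ → ℕ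
    count≤ c h g b = ∑[ g ] (λ k → [ (k <? b) ×-dec (h + g + b ≤? k + c) ]· level k) + q ^ (b ⊓ h ⊓ (c ∸ b))

    -- Put `d = c ∸ b`. For `a` above `m` the stable `β` form a single coset modulo `π ^ (a ∸ d)`,
    -- or none unless `a + d ≤ 2m`, and homothety on it is congruence modulo π to the minimum of
    -- `2(m ∸ d)` and `a`. The exponent of `q` is the gap between the two moduli.
    count> : ℕ → ℕ → ℕ → ℕ → ℕ
    count> c m a b = [ a + (c ∸ b) ≤? m + m ]· q ^ ((m + m ∸ a ∸ (c ∸ b)) ⊓ (c ∸ b))

    private
      G : ℕ → ℕ
      G h = ∑[ h ] (q ^_)

    [q-1]*x+x : ∀ x → (q ∸ 1) * x + x ≡ q * x
    [q-1]*x+x x = trans (+-comm ((q ∸ 1) * x) x) (cong (_* x) (m+[n∸m]≡n q≥1))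

    ∑-level : ∀ g → ∑[ suc g ] level ≡ q ^ g
    ∑-level zero    = refl
    ∑-level (suc g) = trans (cong (_+ level (suc g)) (∑-level g)) (trans (+-comm (q ^ g) _) ([q-1]*x+x (q ^ g)))

    -- The exponent climbs from 0 to `h - 1`, stays at `h` for `r + 1` values of `b` and descends
    -- again. The equal slopes give the `2 * G h` that the doubled main term of the formula has to
    -- match.
    ∑-trapezium : ∀ {c} h r → h + r + h ≡ c →
                  ∑[ suc c ] (λ b → q ^ (b ⊓ h ⊓ (c ∸ b))) ≡ 2 * G h + suc r * q ^ h
    ∑-trapezium h r refl = begin
      ∑[ suc (h + r + h) ] F                                   ≡⟨ cong (λ k → ∑[ k ] F) (eq₁ h r) ⟩
      ∑[ h + suc r + h ] F                                     ≡⟨ ∑-split (h + suc r) h F ⟩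
      ∑[ h + suc r ] F + ∑[ h ] (λ i → F (h + suc r + i))      ≡⟨ cong₂ _+_ (∑-split h (suc r) F) (∑-cong h descending) ⟩
      ∑[ h ] F + ∑[ suc r ] (λ i → F (h + i)) + ∑[ h ] (λ i → q ^ (h ∸ suc i))
        ≡⟨ cong₂ _+_ (cong₂ _+_ (∑-cong h ascending) (trans (∑-cong (suc r) constant) (∑-const (suc r) (q ^ h)))) (∑-reverse h (q ^_)) ⟩
      G h + suc r * q ^ h + G h                                ≡⟨ eq₂ (G h) (suc r * q ^ h) ⟩
      2 * G h + suc r * q ^ h                                  ∎
      where
      c = h + r + h
      F : ℕ → ℕ
      F b = q ^ (b ⊓ h ⊓ (c ∸ b))
      eq₁ : ∀ h r → suc (h + r + h) ≡ h + suc r + h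
      eq₁ h r = solve (h ∷ r ∷ [])
      eq₂ : ∀ x y → x + y + x ≡ 2 * x + y
      eq₂ x y = solve (x ∷ y ∷ [])
      ascending : ∀ b → b < h → F b ≡ q ^ b
      ascending b b<h = cong (q ^_) (trans (cong (_⊓ (c ∸ b)) (m≤n⇒m⊓n≡m (<⇒≤ b<h)))
        (m≤n⇒m⊓n≡m (m+n≤o⇒m≤o∸n b (≤-trans (+-mono-≤ (≤-trans (<⇒≤ b<h) (m≤m+n h r)) (<⇒≤ b<h)) ≤-refl))))
      constant : ∀ i → i < suc r → F (h + i) ≡ q ^ h
      constant i i≤r = cong (q ^_) (trans (cong (_⊓ (c ∸ (h + i))) (m≥n⇒m⊓n≡n (m≤m+n h i)))
        (m≤n⇒m⊓n≡m (m+n≤o⇒m≤o∸n h (≤-trans (≤-reflexive (+-comm h (h + i))) (+-monoˡ-≤ h (+-monoʳ-≤ h (s≤s⁻¹ i≤r)))))))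
      descending : ∀ i → i < h → F (h + suc r + i) ≡ q ^ (h ∸ suc i)
      descending i i<h = cong (q ^_) (trans (cong₂ _⊓_ (m≥n⇒m⊓n≡n (≤-trans (m≤m+n h (suc r)) (m≤m+n _ i)))
          (trans (cong (c ∸_) (eq₃ h r i)) ([m+n]∸[m+o]≡n∸o (h + r) h (suc i))))
        (m≥n⇒m⊓n≡n (m∸n≤m h (suc i))))
        where
        eq₃ : ∀ h r i → h + suc r + i ≡ h + r + suc i
        eq₃ h r i = solve (h ∷ r ∷ i ∷ [])

    -- For fixed `k` the two conditions confine `b` to the values from `k + 1` to `k + w`. Their
    -- number does not depend on `k`, so summing over `b` first leaves a multiple of the sum of the
    -- levels.
    ∑-count≤ : ∀ {c} h g w r → h + g + w ≡ c → h + r + h ≡ c →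
               ∑[ suc c ] (count≤ c h g) ≡ w * ∑[ g ] level + (2 * G h + suc r * q ^ h)
    ∑-count≤ {c} h g w r refl eq = begin
      ∑[ suc c ] (count≤ c h g)                          ≡⟨ ∑-+ (suc c) (λ b → ∑[ g ] (L b)) (λ b → q ^ (b ⊓ h ⊓ (c ∸ b))) ⟩
      ∑[ suc c ] (λ b → ∑[ g ] (L b)) + _                ≡⟨ cong₂ _+_ (∑-swap (suc c) g L) (∑-trapezium h r eq) ⟩
      ∑[ g ] (λ k → ∑[ suc c ] (λ b → L b k)) + T        ≡⟨ cong (_+ T) (∑-cong g fixed-k) ⟩
      ∑[ g ] (λ k → w * level k) + T                     ≡⟨ cong (_+ T) (∑-*ˡ g w level) ⟩
      w * ∑[ g ] level + T                               ∎
      where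
      T = 2 * G h + suc r * q ^ h
      L : ℕ → ℕ → ℕ
      L b k = [ (k <? b) ×-dec (h + g + b ≤? k + c) ]· level k
      fixed-k : ∀ k → k < g → ∑[ suc c ] (λ b → L b k) ≡ w * level k
      fixed-k k k<g = trans (∑-interval (suc k) w (h + g ∸ k) (λ b → (k <? b) ×-dec (h + g + b ≤? k + c)) (λ _ → level k)
          (cong suc (begin
            k + w + (h + g ∸ k)     ≡⟨ cong (_+ (h + g ∸ k)) (+-comm k w) ⟩
            w + k + (h + g ∸ k)     ≡⟨ +-assoc w k _ ⟩
            w + (k + (h + g ∸ k))   ≡⟨ cong (λ z → w + z) (m+[n∸m]≡n (≤-trans (<⇒≤ k<g) (m≤n+m g h))) ⟩
            w + (h + g)             ≡⟨ +-comm w (h + g) ⟩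
            h + g + w               ∎))
          (λ b b≤k (k<b , _) → <-irrefl refl (≤-trans k<b (s≤s⁻¹ b≤k))) inside above)
        (∑-const w (level k))
        where
        inside : ∀ i → i < w → k < suc k + i × h + g + (suc k + i) ≤ k + (h + g + w)
        inside i i<w = s≤s (m≤m+n k i) , ≤-by i<w 0 (solve (k ∷ i ∷ w ∷ h ∷ g ∷ []))
        above : ∀ i → i < h + g ∸ k → ¬ (k < suc k + w + i × h + g + (suc k + w + i) ≤ k + (h + g + w))
        above i _ (_ , le) = <-irrefl {0} refl (≤-by le i (solve (k ∷ i ∷ w ∷ h ∷ g ∷ [])))

    -- the sums over b of the first two terms of the formula
    major≤ : ℕ → ℕ → ℕ → ℕ → ℕ
    major≤ c h g b = [ h + g ≤? 2 * b ]· q ^ (h ⊓ (c ∸ b))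

    major> : ℕ → ℕ → ℕ → ℕ → ℕ → ℕ
    major> c m h g b = [ (h + g ≤? 2 * b) ×-dec (g + c ≤? m + b) ]· q ^ (c ∸ b)

    -- As `h` and `g` are the two halves of `a`, the condition `a ≤ 2b` says `g ≤ b`. Read in terms
    -- of `c ∸ b`, the surviving part is one slope and a plateau.
    ∑-major≤ : ∀ {c} h g w → h ≤ g → g ≤ suc h → h + g + w ≡ c → ∑[ suc c ] (major≤ c h g) ≡ G h + suc w * q ^ h
    ∑-major≤ {c} h g w h≤g g≤1+h refl = begin
      ∑[ suc c ] (major≤ c h g)
        ≡⟨ ∑-interval {suc (h + g + w)} g (suc (h + w)) 0 (λ b → h + g ≤? 2 * b) (λ b → q ^ (h ⊓ (c ∸ b))) (solve (g ∷ h ∷ w ∷ []))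
             below inside (λ _ ()) ⟩
      ∑[ suc (h + w) ] (λ i → q ^ (h ⊓ (c ∸ (g + i))))
        ≡⟨ ∑-cong (suc (h + w)) (λ i _ → cong (λ k → q ^ (h ⊓ k)) (trans (cong (_∸ (g + i)) (eq g h w)) ([m+n]∸[m+o]≡n∸o g (h + w) i))) ⟩
      ∑[ suc (h + w) ] (λ i → q ^ (h ⊓ (h + w ∸ i)))     ≡⟨ ∑-reverse (suc (h + w)) (λ i → q ^ (h ⊓ i)) ⟩
      ∑[ suc (h + w) ] (λ i → q ^ (h ⊓ i))               ≡⟨ cong (λ k → ∑[ k ] (λ i → q ^ (h ⊓ i))) (sym (+-suc h w)) ⟩
      ∑[ h + suc w ] (λ i → q ^ (h ⊓ i))                 ≡⟨ ∑-split h (suc w) _ ⟩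
      _ ≡⟨ cong₂ _+_ (∑-cong h (λ i i<h → cong (q ^_) (m≥n⇒m⊓n≡n (<⇒≤ i<h))))
             (trans (∑-cong (suc w) (λ i _ → cong (q ^_) (m≤n⇒m⊓n≡m (m≤m+n h i)))) (∑-const (suc w) (q ^ h))) ⟩
      G h + suc w * q ^ h ∎
      where
      eq : ∀ g h w → h + g + w ≡ g + (h + w)
      eq g h w = solve (g ∷ h ∷ w ∷ [])
      inside : ∀ k → k < suc (h + w) → h + g ≤ 2 * (g + k)
      inside k _ = ≤-trans (+-monoˡ-≤ g h≤g) (≤-from {g + g} {2 * (g + k)} (k + k) (solve (g ∷ k ∷ [])))
      below : ∀ b → b < g → ¬ h + g ≤ 2 * b
      below b b<g le = <-irrefl refl (≤-trans (≤-by {m = suc (2 * b)} {h + g} (+-mono-≤ (+-mono-≤ b<g b<g) g≤1+h) 0 (solve (b ∷ g ∷ h ∷ []))) le)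

    -- The second condition of `major>` says `g + w ≤ b`, which implies the first because `h ≤ g`.
    ∑-major> : ∀ {c m} h g w x → h ≤ g → m + w ≡ c → g + x ≡ m → ∑[ suc c ] (major> c m h g) ≡ G (suc x)
    ∑-major> h g w x h≤g refl refl = begin
      ∑[ suc (g + x + w) ] (major> (g + x + w) (g + x) h g)
        ≡⟨ ∑-interval {suc (g + x + w)} (g + w) (suc x) 0 (λ b → (h + g ≤? 2 * b) ×-dec (g + (g + x + w) ≤? g + x + b)) (λ b → q ^ (g + x + w ∸ b)) (solve (g ∷ x ∷ w ∷ []))
             below inside (λ _ ()) ⟩
      ∑[ suc x ] (λ i → q ^ (g + x + w ∸ (g + w + i)))
        ≡⟨ ∑-cong (suc x) (λ i _ → cong (q ^_) (trans (cong (_∸ (g + w + i)) (eq g x w)) ([m+n]∸[m+o]≡n∸o (g + w) x i))) ⟩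
      ∑[ suc x ] (λ i → q ^ (x ∸ i))                         ≡⟨ ∑-reverse (suc x) (q ^_) ⟩
      G (suc x) ∎
      where
      below : ∀ b → b < g + w → ¬ (h + g ≤ 2 * b × g + (g + x + w) ≤ g + x + b)
      below b b<g+w (_ , le) = <-irrefl {b} refl (≤-by (+-mono-≤ b<g+w le) 0 (solve (g ∷ x ∷ w ∷ b ∷ [])))
      inside : ∀ k → k < suc x → h + g ≤ 2 * (g + w + k) × g + (g + x + w) ≤ g + x + (g + w + k)
      inside k _ = ≤-by h≤g (w + w + k + k) (solve (g ∷ h ∷ w ∷ k ∷ [])) , ≤-from k (solve (g ∷ x ∷ w ∷ k ∷ []))
      eq : ∀ g x w → g + x + w ≡ g + w + x
      eq g x w = solve (g ∷ x ∷ w ∷ [])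

    -- In terms of `d = c ∸ b` the bracket cuts the sum off after `d = y`. Since `h` is half of `y`,
    -- the minimum of `d` and `y ∸ d` never exceeds `h`: this is the trapezium for `y`, with a
    -- plateau of one or two points according to `r`.
    ∑-count> : ∀ {c m} a y h r → r ≤ 1 → a + y ≡ m + m → y ≤ c → h + r + h ≡ y → ∑[ suc c ] (count> c m a) ≡ 2 * G h + suc r * q ^ h
    ∑-count> {c} {m} a y h r r≤1 eq y≤c eqy = begin
      ∑[ suc c ] (count> c m a)                            ≡⟨ ∑-reverse (suc c) F ⟩
      ∑[ suc c ] F                                         ≡⟨ ∑-interval 0 (suc y) (c ∸ y) {P = λ d → a + d ≤ m + m} (λ d → a + d ≤? m + m) (λ d → q ^ ((m + m ∸ a ∸ d) ⊓ d)) (cong suc (m+[n∸m]≡n y≤c))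
                                                                (λ _ ()) (λ d d≤y → ≤-trans (+-monoʳ-≤ a (s≤s⁻¹ d≤y)) (≤-reflexive eq)) above ⟩
      ∑[ suc y ] (λ d → q ^ ((m + m ∸ a ∸ d) ⊓ d))          ≡⟨ ∑-cong (suc y) (λ d d≤y → cong (q ^_) (trans (cong (λ k → (k ∸ d) ⊓ d) (trans (cong (_∸ a) (sym eq)) (m+n∸m≡n a y))) (half d (s≤s⁻¹ d≤y)))) ⟩
      ∑[ suc y ] (λ d → q ^ (d ⊓ h ⊓ (y ∸ d)))             ≡⟨ ∑-trapezium h r eqy ⟩
      2 * G h + suc r * q ^ h                              ∎
      where
      above : ∀ i → i < c ∸ y → ¬ a + (suc y + i) ≤ m + m
      above i _ le = <-irrefl {0} refl (≤-by (≤-trans le (≤-reflexive (sym eq))) i (solve (a ∷ y ∷ i ∷ [])))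
      F : ℕ → ℕ
      F d = [ a + d ≤? m + m ]· q ^ ((m + m ∸ a ∸ d) ⊓ d)
      half : ∀ d → d ≤ y → (y ∸ d) ⊓ d ≡ d ⊓ h ⊓ (y ∸ d)
      half d d≤y with ≤-<-connex d h
      ... | inj₁ d≤h = trans (⊓-comm (y ∸ d) d) (cong (_⊓ (y ∸ d)) (sym (m≤n⇒m⊓n≡m d≤h)))
      ... | inj₂ h<d = begin
        (y ∸ d) ⊓ d         ≡⟨ m≤n⇒m⊓n≡m (≤-trans y∸d≤h (<⇒≤ h<d)) ⟩
        y ∸ d               ≡⟨ m≥n⇒m⊓n≡n y∸d≤h ⟨
        h ⊓ (y ∸ d)         ≡⟨ cong (_⊓ (y ∸ d)) (m≥n⇒m⊓n≡n (<⇒≤ h<d)) ⟨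
        d ⊓ h ⊓ (y ∸ d)     ∎
        where
        y∸d≤h : y ∸ d ≤ h
        y∸d≤h = m≤n+o⇒m∸n≤o y d (≤-trans (≤-reflexive (sym eqy)) (≤-by (+-mono-≤ h<d r≤1) 0 (solve (h ∷ r ∷ d ∷ []))))

  -- From filtered lists of integers to sums of natural numbers

  []-cong : ∀ {p q} {P : Set p} {Q : Set q} (d : Dec P) (e : Dec Q) {x y} → P ⇔ Q → (Q → x ≡ y) → [ d ]· x ≡ [ e ]· y
  []-cong d (yes q) P⇔Q eq = trans ([]-yes d (Equivalence.from P⇔Q q)) (eq q)
  []-cong d (no ¬q) P⇔Q eq = []-no d (¬q ∘ Equivalence.to P⇔Q)

  private
    +[] : ∀ {p q} {P : Set p} {Q : Set q} (d : Dec P) (e : Dec Q) {x y} → P ⇔ Q → (Q → x ≡ + y) →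
          ∑-filter-syntax (0ℤ ∷ []) (λ _ → d) (λ _ → x) ≡ + ([ e ]· y)
    +[] (yes p) e P⇔Q eq = trans (ℤ.+-identityʳ _) (trans (eq q) (cong +_ (sym ([]-yes e q))))
      where q = Equivalence.to P⇔Q p
    +[] (no ¬p) e P⇔Q eq = cong +_ (sym ([]-no e (¬p ∘ Equivalence.from P⇔Q)))

    ∑-++ : ∀ is js f → ∑-syntax (is ++ js) f ≡ ∑-syntax is f ℤ.+ ∑-syntax js f
    ∑-++ []       js f = sym (ℤ.+-identityˡ _)
    ∑-++ (i ∷ is) js f = trans (cong (λ k → f i ℤ.+ k) (∑-++ is js f)) (sym (ℤ.+-assoc (f i) (∑-syntax is f) (∑-syntax js f)))

    singleton-filter : ∀ {p} {P : Pred ℤ p} (P? : Decidable P) f i →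
                       ∑-filter-syntax (i ∷ []) P? f ≡ ∑-filter-syntax (0ℤ ∷ []) (λ _ → P? i) (λ _ → f i)
    singleton-filter P? f i with P? i
    ... | yes _ = refl
    ... | no _  = refl

    range : ∀ {l h} → l ≤ suc h → (+ l ⋯ + h) ≡ map (λ k → + l ℤ.+ + k) (upTo (suc h ∸ l))
    range {l} {h} l≤ rewrite trans (ℤ.m-n≡m⊖n (suc h) l) (ℤ.⊖-≥ l≤) = refl

    range-bound : ∀ {l h} → l ≤ suc h → ∀ {k} → k < suc h ∸ l → l + k ≤ h
    range-bound {l} l≤ {k} k< = s≤s⁻¹ (≤-trans (≤-reflexive (trans (sym (+-suc l k)) (+-comm l (suc k)))) (m≤o∸n⇒m+n≤o (suc k) l≤ k<))

  -- Agreement is asked for only inside the range, since the bounds on `a` are what makes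
  -- subtraction in ℤ agree with truncated subtraction.
  ∑-⋯-filter : ∀ {l h p q} {P : Pred ℤ p} (P? : Decidable P) {f : ℤ → ℤ} {Q : ℕ → Set q} (Q? : ∀ a → Dec (Q a)) {g : ℕ → ℕ} → l ≤ suc h →
    (∀ {a} → l ≤ a → a ≤ h → P (+ a) ⇔ Q a) → (∀ {a} → l ≤ a → a ≤ h → Q a → f (+ a) ≡ + g a) →
    ∑-filter-syntax (+ l ⋯ + h) P? f ≡ + ∑[ suc h ∸ l ] (λ k → [ Q? (l + k) ]· g (l + k))
  ∑-⋯-filter {l} {h} P? {f} Q? {g} l≤ P⇔Q f≡g = trans (cong (λ is → ∑-filter-syntax is P? f) (range l≤)) (go (suc h ∸ l) (range-bound l≤))
    where
    t : ℕ → ℤ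
    t k = + l ℤ.+ + k
    go : ∀ n → (∀ {k} → k < n → l + k ≤ h) → ∑-filter-syntax (map t (upTo n)) P? f ≡ + ∑[ n ] (λ k → [ Q? (l + k) ]· g (l + k))
    go zero    bound = refl
    go (suc n) bound = begin
      ∑-filter-syntax (map t (upTo (suc n))) P? f                         ≡⟨ cong (λ is → ∑-filter-syntax (map t is) P? f) (List.upTo-∷ʳ n) ⟨
      ∑-filter-syntax (map t (upTo n ++ n ∷ [])) P? f                     ≡⟨ cong (λ is → ∑-filter-syntax is P? f) (List.map-++ t (upTo n) _) ⟩
      ∑-filter-syntax (map t (upTo n) ++ t n ∷ []) P? f                   ≡⟨ cong (λ is → ∑-syntax is f) (List.filter-++ P? (map t (upTo n)) _) ⟩
      ∑-syntax (filter P? (map t (upTo n)) ++ filter P? (t n ∷ [])) f     ≡⟨ ∑-++ (filter P? (map t (upTo n))) _ f ⟩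
      ∑-filter-syntax (map t (upTo n)) P? f ℤ.+ ∑-filter-syntax (t n ∷ []) P? f
        ≡⟨ cong₂ ℤ._+_ (go n (λ k<n → bound (m<n⇒m<1+n k<n)))
             (trans (singleton-filter P? f (t n)) (+[] (P? (t n)) (Q? (l + n)) (P⇔Q (m≤m+n l n) (bound ≤-refl)) (f≡g (m≤m+n l n) (bound ≤-refl)))) ⟩
      + ∑[ suc n ] (λ k → [ Q? (l + k) ]· g (l + k)) ∎

  ∑-⋯ : ∀ {l h} {f : ℤ → ℤ} {g : ℕ → ℕ} → l ≤ suc h → (∀ {a} → l ≤ a → a ≤ h → f (+ a) ≡ + g a) →
        ∑-syntax (+ l ⋯ + h) f ≡ + ∑[ suc h ∸ l ] (λ k → g (l + k))
  ∑-⋯ {l} {h} {f} {g} l≤ f≡g = trans (cong (λ is → ∑-syntax is f) (range l≤)) (go (suc h ∸ l) (range-bound l≤))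
    where
    t : ℕ → ℤ
    t k = + l ℤ.+ + k
    go : ∀ n → (∀ {k} → k < n → l + k ≤ h) → ∑-syntax (map t (upTo n)) f ≡ + ∑[ n ] (λ k → g (l + k))
    go zero    bound = refl
    go (suc n) bound = begin
      ∑-syntax (map t (upTo (suc n))) f                         ≡⟨ cong (λ is → ∑-syntax (map t is) f) (List.upTo-∷ʳ n) ⟨
      ∑-syntax (map t (upTo n ++ n ∷ [])) f                     ≡⟨ cong (λ is → ∑-syntax is f) (List.map-++ t (upTo n) _) ⟩
      ∑-syntax (map t (upTo n) ++ t n ∷ []) f                   ≡⟨ ∑-++ (map t (upTo n)) _ f ⟩
      ∑-syntax (map t (upTo n)) f ℤ.+ ∑-syntax (t n ∷ []) f
        ≡⟨ cong₂ ℤ._+_ (go n (λ k<n → bound (m<n⇒m<1+n k<n))) (trans (ℤ.+-identityʳ _) (f≡g (m≤m+n l n) (bound ≤-refl))) ⟩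
      + ∑[ suc n ] (λ k → g (l + k)) ∎

  -- Halves and parity

  n/2≡⌊n/2⌋ : ∀ n → n / 2 ≡ ℕ.⌊ n /2⌋
  n/2≡⌊n/2⌋ zero          = refl
  n/2≡⌊n/2⌋ (suc zero)    = refl
  n/2≡⌊n/2⌋ (suc (suc n)) = trans (m/n≡1+[m∸n]/n {suc (suc n)} {2} (s≤s (s≤s z≤n))) (cong suc (n/2≡⌊n/2⌋ n))

  ⌊+/2⌋ : ∀ n → ⌊ + n /2⌋ ≡ + ℕ.⌊ n /2⌋
  ⌊+/2⌋ n = cong +_ (n/2≡⌊n/2⌋ n)

  data Parity : ℕ → Set where
    even : ∀ h → Parity (h + h)
    odd  : ∀ h → Parity (suc (h + h))

  parityView : ∀ n → Parity n
  parityView zero    = even 0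
  parityView (suc n) with parityView n
  ... | even h = odd h
  ... | odd h  = subst Parity (cong suc (+-suc h h)) (even (suc h))

  ⌊even/2⌋ : ∀ h → ℕ.⌊ h + h /2⌋ ≡ h
  ⌊even/2⌋ h = sym (n≡⌊n+n/2⌋ h)

  ⌈even/2⌉ : ∀ h → ℕ.⌈ h + h /2⌉ ≡ h
  ⌈even/2⌉ h = sym (n≡⌈n+n/2⌉ h)

  2∣even : ∀ h → 2 ℕ.∣ h + h
  2∣even h = divides h (solve (h ∷ []))

  2∤odd : ∀ h → ¬ 2 ℕ.∣ suc (h + h)
  2∤odd h (divides k eq) = even≢odd k h (trans (*-comm 2 k) (trans (sym eq) (cong suc (solve (h ∷ [])))))

  -- Division of `-[1+ n ]` is defined by cases on the remainder of `suc n`, so the remainder is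
  -- abstracted together with the parity of `n`; two of the four combinations are impossible.
  ⌈+/2⌉ : ∀ n → ⌈ + n /2⌉ ≡ + ℕ.⌈ n /2⌉
  ⌈+/2⌉ zero    = refl
  ⌈+/2⌉ (suc n) with suc n % 2 in eq | parityView n
  ... | zero  | odd h  = trans (ℤ.neg-involutive _) (cong +_ (trans (n/2≡⌊n/2⌋ (suc (suc (h + h)))) (cong suc (trans (⌊even/2⌋ h) (sym (⌈even/2⌉ h))))))
  ... | suc r | even h = cong (λ k → + suc k) (trans (n/2≡⌊n/2⌋ (suc (h + h))) (trans (⌈even/2⌉ h) (sym (⌊even/2⌋ h))))
  ... | zero  | even h = contradiction (trans (sym eq) (odd%2 h)) λ ()
    where
    odd%2 : ∀ h → suc (h + h) % 2 ≡ 1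
    odd%2 zero    = refl
    odd%2 (suc h) = trans (cong (λ k → suc (suc k) % 2) (+-suc h h)) (trans (cong (_% 2) (+-comm 2 (suc (h + h)))) (trans ([m+n]%n≡m%n (suc (h + h)) 2) (odd%2 h)))
  ... | suc r | odd h = contradiction (trans (sym eq) (even%2 h)) λ ()
    where
    even%2 : ∀ h → suc (suc (h + h)) % 2 ≡ 0
    even%2 zero    = refl
    even%2 (suc h) = trans (cong (λ k → suc (suc (suc k)) % 2) (+-suc h h)) (trans (cong (_% 2) (+-comm 2 (suc (suc (h + h))))) (trans ([m+n]%n≡m%n (suc (suc (h + h))) 2) (even%2 h)))

  private
    ≤⇔ : ∀ {m n} → + m ℤ.≤ + n ⇔ m ≤ n
    ≤⇔ = mk⇔ ℤ.drop‿+≤+ ℤ.+≤+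

    <⇔ : ∀ {m n} → + m ℤ.< + n ⇔ m < n
    <⇔ = mk⇔ ℤ.drop‿+<+ ℤ.+<+

    ≤2*⇔ : ∀ {m} n → + m ℤ.≤ + 2 ℤ.* + n ⇔ m ≤ 2 * n
    ≤2*⇔ {m} n = subst (λ k → + m ℤ.≤ k ⇔ m ≤ 2 * n) (ℤ.pos-* 2 n) ≤⇔

    <2*⇔ : ∀ {m} n → + m ℤ.< + 2 ℤ.* + n ⇔ m < 2 * n
    <2*⇔ {m} n = subst (λ k → + m ℤ.< k ⇔ m < 2 * n) (ℤ.pos-* 2 n) <⇔

    _×⇔_ : ∀ {A B C D : Set} → A ⇔ B → C ⇔ D → (A × C) ⇔ (B × D)
    p ×⇔ q = mk⇔ (λ (a , c) → Equivalence.to p a , Equivalence.to q c) (λ (b , d) → Equivalence.from p b , Equivalence.from q d)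

    if-yes : ∀ {A P : Set} {x y : A} (d : Dec P) → P → (if does d then x else y) ≡ x
    if-yes (yes _) p = refl
    if-yes (no ¬p) p = contradiction p ¬p

    if-no : ∀ {A P : Set} {x y : A} (d : Dec P) → ¬ P → (if does d then x else y) ≡ y
    if-no (yes p) ¬p = contradiction p ¬p
    if-no (no _)  ¬p = refl

    ⇔-refl : ∀ {A : Set} → A ⇔ A
    ⇔-refl = mk⇔ id id

    +-minus-+ : ∀ {m n} → n ≤ m → + m ℤ.- + n ≡ + (m ∸ n)
    +-minus-+ {m} {n} n≤m = trans (ℤ.m-n≡m⊖n m n) (ℤ.⊖-≥ n≤m)

    difference⇔ : ∀ i j k l → i ℤ.- j ℤ.≤ k ℤ.- l ⇔ i ℤ.+ l ℤ.≤ k ℤ.+ j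
    difference⇔ i j k l = mk⇔
      (λ h → subst₂ ℤ._≤_ (e₁ i j l) (e₂ k j l) (ℤ.+-monoˡ-≤ (j ℤ.+ l) h))
      (λ h → subst₂ ℤ._≤_ (e₃ i j l) (e₄ k j l) (ℤ.+-monoˡ-≤ (ℤ.- (j ℤ.+ l)) h))
      where
      e₁ : ∀ i j l → i ℤ.- j ℤ.+ (j ℤ.+ l) ≡ i ℤ.+ l
      e₁ i j l = ℤ.solve (i ∷ j ∷ l ∷ [])
      e₂ : ∀ k j l → k ℤ.- l ℤ.+ (j ℤ.+ l) ≡ k ℤ.+ j
      e₂ k j l = ℤ.solve (k ∷ j ∷ l ∷ [])
      e₃ : ∀ i j l → i ℤ.+ l ℤ.+ ℤ.- (j ℤ.+ l) ≡ i ℤ.- j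
      e₃ i j l = ℤ.solve (i ∷ j ∷ l ∷ [])
      e₄ : ∀ k j l → k ℤ.+ j ℤ.+ ℤ.- (j ℤ.+ l) ≡ k ℤ.- l
      e₄ k j l = ℤ.solve (k ∷ j ∷ l ∷ [])

  -- The formula, separated by the value of a

  module Formula (q : ℕ) (q≥1 : 1 ≤ q) where
    open Count q q≥1

    -- The number of classes with parameters a and b, for an order with
    -- S - f₁ = c and S - f₂ = m.
    count : ℕ → ℕ → ℕ → ℕ → ℕ
    count c m a b = if does (a ≤? m) then count≤ c ℕ.⌊ a /2⌋ ℕ.⌈ a /2⌉ b else count> c m a b

    count-≤ : ∀ {c m a} → a ≤ m → ∀ b → count c m a b ≡ count≤ c ℕ.⌊ a /2⌋ ℕ.⌈ a /2⌉ b
    count-≤ {m = m} {a} a≤m b = if-yes (a ≤? m) a≤m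

    count-> : ∀ {c m a} → m < a → ∀ b → count c m a b ≡ count> c m a b
    count-> {m = m} {a} m<a b = if-no (a ≤? m) (<⇒≱ m<a)

    -- These parameters make every subtraction exact: `f₁ = m + p`, `S - f₁ = m + w`,
    -- `f₂ = m + p + w` and `S - f₂ = m`. The hypothesis `p ≤ m` is `f₁ ≤ 2m`.
    module _ (m p w : ℕ) (p≤m : p ≤ m) where
      private
        f₁ c : ℕ
        f₁ = m + p
        c  = m + w

        ev? : ∀ i → Dec (+ 2 ℤ.∣ i)
        ev? i = 2 ∣? ℤ.∣ i ∣

        A₁ A₂ : ℕ → ℕ → ℕ
        A₁ b a = [ (a ≤? 2 * b) ×-dec (a ≤? m) ]· q ^ (ℕ.⌊ a /2⌋ ⊓ (c ∸ b))
        A₂ b a = [ (a ≤? 2 * b) ×-dec (ℕ.⌈ a /2⌉ + c ≤? m + b) ]· q ^ (c ∸ b)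

        B₁ B₂ B₄ : ℕ → ℕ
        B₁ a = [ (a ≤? m) ×-dec (2 ∣? a) ]· q ^ ℕ.⌊ a /2⌋
        B₂ a = [ (2 ∣? a) ×-dec (c ≤? m) ]· q ^ (c ∸ ℕ.⌊ a /2⌋)
        B₄ a = [ (2 ∣? a) ×-dec (m <? c) ]· q ^ (m ∸ ℕ.⌊ a /2⌋)
        B₃ : ℕ → ℕ → ℕ
        B₃ b a = [ (a <? 2 * b) ×-dec (2 ∣? a) ×-dec (a ≤? m) ×-dec (ℕ.⌊ a /2⌋ ≤? c ∸ b) ]· level ℕ.⌊ a /2⌋

        ∑A ∑B₁ ∑B₂ ∑B₃ ∑B₄ : ℕ
        ∑A  = ∑[ suc c ] (λ b → ∑[ suc f₁ ] (A₁ b) + ∑[ p ] (λ i → A₂ b (suc m + i)))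
        ∑B₁ = ∑[ f₁ ] (λ k → B₁ (suc k))
        ∑B₂ = ∑[ p ] (λ i → B₂ (suc m + i))
        ∑B₃ = ∑[ c ] (λ b → ∑[ f₁ ] (λ k → B₃ (suc b) (suc k)))
        ∑B₄ = ∑[ p ] (λ i → B₄ (suc m + i))

        pow : ∀ {n b} → b ≤ n → q ^ᶻ (+ n ℤ.- + b) ≡ + (q ^ (n ∸ b))
        pow b≤n = cong (q ^ᶻ_) (+-minus-+ b≤n)

        1≤f : suc m ≤ suc f₁
        1≤f = s≤s (m≤m+n m p)

        trim : ∀ {x f} → x ≡ + ∑[ f₁ ∸ m ] f → x ≡ + ∑[ p ] f
        trim {f = f} eq = trans eq (cong (λ n → + ∑[ n ] f) (m+n∸m≡n m p))

        -- Here `f₁ ≤ 2m` is used: it keeps the exponents `S - f₁ - a/2` and `S - f₂ - a/2` of the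
        -- corrections for `a > m` nonnegative.
        ⌊/2⌋≤ : ∀ {a} → a ≤ f₁ → ℕ.⌊ a /2⌋ ≤ m
        ⌊/2⌋≤ {a} a≤f₁ = ≤-trans (⌊n/2⌋-mono (≤-trans a≤f₁ (+-monoʳ-≤ m p≤m))) (≤-reflexive (⌊even/2⌋ m))

        -- C, Z and D stand for S - f₁, S - f₂ and f₁ - f₂
        summand-A₁ : ℤ → ℤ → ℤ → ℤ
        summand-A₁ C Z b = ∑[ a ∈ 0ℤ ⋯ + f₁ ∣ (λ a → (a ℤ.≤? + 2 ℤ.* b) ×-dec (a ℤ.≤? Z)) ] q ^ᶻ (⌊ a /2⌋ ℤ.⊓ (C ℤ.- b))

        summand-A₂ : ℤ → ℤ → ℤ → ℤ → ℤ
        summand-A₂ C Z D b = ∑[ a ∈ (1ℤ ℤ.+ Z) ⋯ + f₁ ∣ (λ a → (a ℤ.≤? + 2 ℤ.* b) ×-dec (⌈ a /2⌉ ℤ.- b ℤ.≤? D)) ] q ^ᶻ (C ℤ.- b)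

        term-A : ∀ {C Z D} → C ≡ + c → Z ≡ + m → D ≡ + m ℤ.- + c →
          (∑[ b ∈ 0ℤ ⋯ C ] (summand-A₁ C Z b ℤ.+ summand-A₂ C Z D b)) ≡ + ∑A
        term-A refl refl refl = ∑-⋯ {0} {c} {λ b → summand-A₁ (+ c) (+ m) b ℤ.+ summand-A₂ (+ c) (+ m) (+ m ℤ.- + c) b} z≤n λ {b} _ b≤c → cong₂ ℤ._+_
          (∑-⋯-filter {0} {f₁} (λ a → (a ℤ.≤? + 2 ℤ.* + b) ×-dec (a ℤ.≤? + m)) {λ a → q ^ᶻ (⌊ a /2⌋ ℤ.⊓ (+ c ℤ.- + b))}
            (λ a → (a ≤? 2 * b) ×-dec (a ≤? m)) z≤n (λ _ _ → ≤2*⇔ b ×⇔ ≤⇔)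
            (λ {a} _ _ _ → cong (q ^ᶻ_) (cong₂ ℤ._⊓_ (⌊+/2⌋ a) (+-minus-+ b≤c))))
          (trim (∑-⋯-filter {suc m} {f₁} (λ a → (a ℤ.≤? + 2 ℤ.* + b) ×-dec (⌈ a /2⌉ ℤ.- + b ℤ.≤? + m ℤ.- + c)) {λ _ → q ^ᶻ (+ c ℤ.- + b)}
            (λ a → (a ≤? 2 * b) ×-dec (ℕ.⌈ a /2⌉ + c ≤? m + b)) 1≤f
            (λ {a} _ _ → ≤2*⇔ b ×⇔ mk⇔
              (λ h → ℤ.drop‿+≤+ (Equivalence.to (difference⇔ (+ ℕ.⌈ a /2⌉) (+ b) (+ m) (+ c)) (subst (λ g → g ℤ.- + b ℤ.≤ + m ℤ.- + c) (⌈+/2⌉ a) h)))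
              (λ h → subst (λ g → g ℤ.- + b ℤ.≤ + m ℤ.- + c) (sym (⌈+/2⌉ a)) (Equivalence.from (difference⇔ (+ ℕ.⌈ a /2⌉) (+ b) (+ m) (+ c)) (ℤ.+≤+ h))))
            (λ _ _ _ → pow b≤c)))

        term-B₁ : ∀ {C Z} → C ≡ + c → Z ≡ + m →
          (∑[ a ∈ 1ℤ ⋯ + f₁ ∣ (λ a → (a ℤ.≤? Z) ×-dec ev? a) ] q ^ᶻ (⌊ a /2⌋ ℤ.⊓ (C ℤ.- ⌊ a /2⌋))) ≡ + ∑B₁
        term-B₁ refl refl = ∑-⋯-filter {1} {f₁} _ (λ a → (a ≤? m) ×-dec (2 ∣? a)) (s≤s z≤n) (λ _ _ → ≤⇔ ×⇔ ⇔-refl)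
          -- For `a ≤ m ≤ c` the minimum is always `⌊ a /2⌋`, which is why `B₁` carries no minimum.
          (λ {a} _ a≤f₁ (a≤m , _) → cong (q ^ᶻ_) (begin
            ⌊ + a /2⌋ ℤ.⊓ (+ c ℤ.- ⌊ + a /2⌋)    ≡⟨ cong (λ h → h ℤ.⊓ (+ c ℤ.- h)) (⌊+/2⌋ a) ⟩
            + h a ℤ.⊓ (+ c ℤ.- + h a)            ≡⟨ cong (+ h a ℤ.⊓_) (+-minus-+ (≤-trans (⌊n/2⌋≤n a) (≤-trans a≤m (m≤m+n m w)))) ⟩
            + (h a ⊓ (c ∸ h a))                  ≡⟨ cong +_ (m≤n⇒m⊓n≡m (m+n≤o⇒m≤o∸n (h a) (≤-trans (+-monoʳ-≤ (h a) (⌊n/2⌋≤⌈n/2⌉ a))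
                                                      (≤-trans (≤-reflexive (⌊n/2⌋+⌈n/2⌉≡n a)) (≤-trans a≤m (m≤m+n m w)))))) ⟩
            + h a                                ∎))
          where
          h : ℕ → ℕ
          h a = ℕ.⌊ a /2⌋

        term-B₂ : ∀ {C Z} → C ≡ + c → Z ≡ + m →
          (∑[ a ∈ (1ℤ ℤ.+ Z) ⋯ + f₁ ∣ (λ a → ev? a ×-dec (C ℤ.≤? Z)) ] q ^ᶻ (C ℤ.- ⌊ a /2⌋)) ≡ + ∑B₂
        term-B₂ refl refl = trim (∑-⋯-filter {suc m} {f₁} _ (λ a → (2 ∣? a) ×-dec (c ≤? m)) 1≤f (λ _ _ → ⇔-refl ×⇔ ≤⇔)
          (λ {a} _ a≤f₁ _ → trans (cong (λ h → q ^ᶻ (+ c ℤ.- h)) (⌊+/2⌋ a)) (pow (≤-trans (⌊/2⌋≤ a≤f₁) (m≤m+n m w)))))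

        term-B₃ : ∀ {C Z} → C ≡ + c → Z ≡ + m →
          (∑[ b ∈ 1ℤ ⋯ C ]
            (∑[ a ∈ 1ℤ ⋯ + f₁ ∣ (λ a → (a ℤ.<? + 2 ℤ.* b) ×-dec ev? a ×-dec (a ℤ.≤? Z) ×-dec (⌊ a /2⌋ ℤ.≤? C ℤ.- b)) ]
              (q ^ᶻ ⌊ a /2⌋ ℤ.- q ^ᶻ (⌊ a /2⌋ ℤ.- 1ℤ)))) ≡ + ∑B₃
        term-B₃ refl refl = ∑-⋯ {1} {c} (s≤s z≤n) λ {b} _ b≤c →
          ∑-⋯-filter {1} {f₁} _ (λ a → (a <? 2 * b) ×-dec (2 ∣? a) ×-dec (a ≤? m) ×-dec (ℕ.⌊ a /2⌋ ≤? c ∸ b)) (s≤s z≤n)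
            (λ {a} _ _ → <2*⇔ b ×⇔ (⇔-refl ×⇔ (≤⇔ ×⇔ subst₂ (λ h k → h ℤ.≤ k ⇔ ℕ.⌊ a /2⌋ ≤ c ∸ b) (sym (⌊+/2⌋ a)) (sym (+-minus-+ b≤c)) ≤⇔)))
            (λ {a} 1≤a _ (_ , 2∣a , _) → difference 1≤a 2∣a (parityView a))
          where
          step : ∀ k → + (q ^ suc k) ℤ.- + (q ^ k) ≡ + level (suc k)
          step k = trans (cong (λ x → + x ℤ.- + (q ^ k)) (sym ([q-1]*x+x (q ^ k))))
                     (trans (+-minus-+ {level (suc k) + q ^ k} (m≤n+m (q ^ k) (level (suc k)))) (cong +_ (m+n∸n≡m (level (suc k)) (q ^ k))))
          difference : ∀ {a} → 1 ≤ a → 2 ℕ.∣ a → Parity a → q ^ᶻ ⌊ + a /2⌋ ℤ.- q ^ᶻ (⌊ + a /2⌋ ℤ.- 1ℤ) ≡ + level ℕ.⌊ a /2⌋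
          difference _ 2∣a (odd h) = contradiction 2∣a (2∤odd h)
          -- `1 ≤ a` removes `even 0`, the only even case in which the exponent `a/2 - 1` would be
          -- negative.
          difference _ _ (even (suc h)) = trans (cong (λ k → q ^ᶻ k ℤ.- q ^ᶻ (k ℤ.- 1ℤ)) (trans (⌊+/2⌋ (suc h + suc h)) (cong +_ (⌊even/2⌋ (suc h)))))
            (trans (step h) (cong (λ k → + level k) (sym (⌊even/2⌋ (suc h)))))

        term-B₄ : ∀ {C Z} → C ≡ + c → Z ≡ + m →
          (∑[ a ∈ (1ℤ ℤ.+ Z) ⋯ + f₁ ∣ (λ a → ev? a ×-dec (Z ℤ.<? C)) ] q ^ᶻ (Z ℤ.- ⌊ a /2⌋)) ≡ + ∑B₄
        term-B₄ refl refl = trim (∑-⋯-filter {suc m} {f₁} _ (λ a → (2 ∣? a) ×-dec (m <? c)) 1≤f (λ _ _ → ⇔-refl ×⇔ <⇔)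
          (λ {a} _ a≤f₁ _ → trans (cong (λ h → q ^ᶻ (+ m ℤ.- h)) (⌊+/2⌋ a)) (pow (⌊/2⌋≤ a≤f₁))))

      formula-terms : classNumberFormula q f₁ (m + p + w) (f₁ + c) ≡
                      + 2 ℤ.* + ∑A ℤ.- (+ c ℤ.+ 1ℤ) ℤ.- + ∑B₁ ℤ.- + ∑B₂ ℤ.- + ∑B₃ ℤ.- + ∑B₄
      formula-terms = cong₂ ℤ._-_ (cong₂ ℤ._-_ (cong₂ ℤ._-_ (cong₂ ℤ._-_ (cong₂ ℤ._-_
          (cong (+ 2 ℤ.*_) (term-A C≡ Z≡ D≡)) (cong (ℤ._+ 1ℤ) C≡)) (term-B₁ C≡ Z≡)) (term-B₂ C≡ Z≡)) (term-B₃ C≡ Z≡)) (term-B₄ C≡ Z≡)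
        where
        C≡ : + (f₁ + c) ℤ.- + f₁ ≡ + c
        C≡ = trans (+-minus-+ (m≤m+n f₁ c)) (cong +_ (m+n∸m≡n f₁ c))
        Z≡ : + (f₁ + c) ℤ.- + (m + p + w) ≡ + m
        Z≡ = trans (cong (λ k → + k ℤ.- + (m + p + w)) {m + p + (m + w)} {m + p + w + m} (solve (m ∷ p ∷ w ∷ [])))
               (trans (+-minus-+ (m≤m+n (m + p + w) m)) (cong +_ (m+n∸m≡n (m + p + w) m)))
        D≡ : + f₁ ℤ.- + (m + p + w) ≡ + m ℤ.- + c
        D≡ = trans (cong (λ k → + f₁ ℤ.- + k) {m + p + w} {m + w + p} (solve (m ∷ p ∷ w ∷ []))) (lemma (+ m) (+ p) (+ w))
          where
          lemma : ∀ m p w → (m ℤ.+ p) ℤ.- (m ℤ.+ w ℤ.+ p) ≡ m ℤ.- (m ℤ.+ w)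
          lemma m p w = ℤ.solve (m ∷ p ∷ w ∷ [])

      private
        total : ℕ → ℕ
        total a = ∑[ suc c ] (count c m a)

        major : ℕ → ℕ
        major a = ∑[ suc c ] (λ b → A₁ b a)

        split₀ : ∀ F → ∑[ suc f₁ ] F ≡ F 0 + ∑[ m ] (λ k → F (suc k)) + ∑[ p ] (λ i → F (suc m + i))
        split₀ F = trans (∑-split (suc m) p F) (cong (_+ ∑[ p ] (λ i → F (suc m + i))) (∑-split 1 m F))

        ∑A-split : ∑A ≡ suc c + ∑[ m ] (λ k → major (suc k)) + ∑[ p ] (λ i → ∑[ suc c ] (λ b → A₂ b (suc m + i)))
        ∑A-split = begin
          ∑A                                                            ≡⟨ ∑-+ (suc c) (λ b → ∑[ suc f₁ ] (A₁ b)) (λ b → ∑[ p ] (λ i → A₂ b (suc m + i))) ⟩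
          ∑[ suc c ] (λ b → ∑[ suc f₁ ] (A₁ b)) + _                     ≡⟨ cong₂ _+_ (∑-swap (suc c) (suc f₁) A₁) (∑-swap (suc c) p (λ b i → A₂ b (suc m + i))) ⟩
          ∑[ suc f₁ ] major + R                                         ≡⟨ cong (_+ R) (split₀ major) ⟩
          major 0 + ∑[ m ] (λ k → major (suc k)) + ∑[ p ] (λ i → major (suc m + i)) + R
            ≡⟨ cong (_+ R) (cong₂ (λ x y → x + ∑[ m ] (λ k → major (suc k)) + y) major-0 (∑-zero p (λ i _ → ∑-zero (suc c) (λ b _ → []-no ((suc m + i ≤? 2 * b) ×-dec (suc m + i ≤? m)) (λ (_ , le) → m+1+n≰m m (≤-trans (≤-reflexive (+-suc m i)) le)))))) ⟩
          suc c + ∑[ m ] (λ k → major (suc k)) + 0 + R                  ≡⟨ cong (_+ R) (+-identityʳ _) ⟩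
          suc c + ∑[ m ] (λ k → major (suc k)) + R                      ∎
          where
          R = ∑[ p ] (λ i → ∑[ suc c ] (λ b → A₂ b (suc m + i)))
          major-0 : major 0 ≡ suc c
          major-0 = trans (∑-cong (suc c) (λ b _ → []-yes ((0 ≤? 2 * b) ×-dec (0 ≤? m)) (z≤n , z≤n))) (trans (∑-const (suc c) 1) (*-identityʳ (suc c)))

        total-0 : total 0 ≡ suc c
        total-0 = trans (∑-cong (suc c) (λ b _ → trans (count-≤ {c} {m} z≤n b) (cong (λ k → q ^ (k ⊓ (c ∸ b))) (⊓-zeroʳ b))))
                    (trans (∑-const (suc c) 1) (*-identityʳ (suc c)))

        ∑B₁-split : ∑B₁ ≡ ∑[ m ] (λ k → B₁ (suc k))
        ∑B₁-split = trans (∑-split m p (λ k → B₁ (suc k))) (trans (cong (λ z → ∑[ m ] (λ k → B₁ (suc k)) + z)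
          (∑-zero p (λ i _ → []-no ((suc m + i ≤? m) ×-dec (2 ∣? (suc m + i))) (λ (le , _) → m+n≮m m i le)))) (+-identityʳ _))

        ∑B₃-split : ∑B₃ ≡ ∑[ m ] (λ k → ∑[ c ] (λ b → B₃ (suc b) (suc k)))
        ∑B₃-split = trans (∑-swap c f₁ (λ b k → B₃ (suc b) (suc k))) (trans (∑-split m p (λ k → ∑[ c ] (λ b → B₃ (suc b) (suc k))))
          (trans (cong (λ z → ∑[ m ] (λ k → ∑[ c ] (λ b → B₃ (suc b) (suc k))) + z)
            (∑-zero p (λ i _ → ∑-zero c (λ b _ → []-no ((suc m + i <? 2 * suc b) ×-dec (2 ∣? (suc m + i)) ×-dec (suc m + i ≤? m) ×-dec (ℕ.⌊ suc m + i /2⌋ ≤? c ∸ suc b)) (λ (_ , _ , le , _) → m+n≮m m i le))))) (+-identityʳ _)))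

        G : ℕ → ℕ
        G h = ∑[ h ] (q ^_)

        major-≤ : ∀ {a} h g x → ℕ.⌊ a /2⌋ ≡ h → h + g ≡ a → h ≤ g → g ≤ suc h → a ≤ m → h + g + x ≡ c → major a ≡ G h + suc x * q ^ h
        major-≤ {a} h g x ⌊a/2⌋≡h h+g≡a h≤g g≤ a≤m eq = trans
          (∑-cong (suc c) (λ b _ → []-cong ((a ≤? 2 * b) ×-dec (a ≤? m)) (h + g ≤? 2 * b)
            (mk⇔ (λ (le , _) → ≤-trans (≤-reflexive h+g≡a) le) (λ le → ≤-trans (≤-reflexive (sym h+g≡a)) le , a≤m))
            (λ _ → cong (λ k → q ^ (k ⊓ (c ∸ b))) ⌊a/2⌋≡h)))
          (∑-major≤ h g x h≤g g≤ eq)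

        total-≤ : ∀ {a} h g x r → ℕ.⌊ a /2⌋ ≡ h → ℕ.⌈ a /2⌉ ≡ g → a ≤ m → h + g + x ≡ c → h + r + h ≡ c →
                  total a ≡ x * ∑[ g ] level + (2 * G h + suc r * q ^ h)
        total-≤ h g x r refl refl a≤m eq eq′ = trans (∑-cong (suc c) (λ b _ → count-≤ a≤m b)) (∑-count≤ h g x r eq eq′)

        -- The conditions put `suc b` strictly above `a/2` and at most at `c - a/2`, which leaves
        -- `x = c - a` values.
        B₃-≤ : ∀ {h x} → suc h + suc h ≤ m → suc h + suc h + x ≡ c → ∑[ c ] (λ b → B₃ (suc b) (suc h + suc h)) ≡ x * level (suc h)
        B₃-≤ {h} {x} a≤m eq = trans (∑-interval (suc h) x (suc h) (λ b → (a <? 2 * suc b) ×-dec (2 ∣? a) ×-dec (a ≤? m) ×-dec (ℕ.⌊ a /2⌋ ≤? c ∸ suc b)) (λ _ → level ℕ.⌊ a /2⌋)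
            (trans (shape h x) eq) below inside above)
            (trans (∑-const x (level ℕ.⌊ a /2⌋)) (cong (λ k → x * level k) (⌊even/2⌋ (suc h))))
          where
          a = suc h + suc h
          shape : ∀ h x → suc h + x + suc h ≡ suc h + suc h + x
          shape h x = solve (h ∷ x ∷ [])
          below : ∀ b → b < suc h → ¬ (a < 2 * suc b × 2 ℕ.∣ a × a ≤ m × ℕ.⌊ a /2⌋ ≤ c ∸ suc b)
          below b b≤h (lt , _) = <-irrefl {0} refl (≤-by {suc (suc h + suc h) + (suc b + suc b)} {2 * suc b + (suc h + suc h)} {1} {0} (+-mono-≤ lt (+-mono-≤ b≤h b≤h)) 0 (solve (b ∷ h ∷ [])))
          inside : ∀ i → i < x → a < 2 * suc (suc h + i) × 2 ℕ.∣ a × a ≤ m × ℕ.⌊ a /2⌋ ≤ c ∸ suc (suc h + i)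
          inside i i<x = ≤-from {suc (suc h + suc h)} {2 * suc (suc h + i)} (suc (i + i)) (solve (h ∷ i ∷ [])) , 2∣even (suc h) , a≤m ,
            ≤-trans (≤-reflexive (⌊even/2⌋ (suc h))) (m+n≤o⇒m≤o∸n (suc h) (≤-trans (≤-by {m = suc h + suc (suc h + i)} {suc h + suc h + x} i<x 0 (solve (h ∷ i ∷ x ∷ []))) (≤-reflexive eq)))
          above : ∀ i → i < suc h → ¬ (a < 2 * suc (suc h + x + i) × 2 ℕ.∣ a × a ≤ m × ℕ.⌊ a /2⌋ ≤ c ∸ suc (suc h + x + i))
          above i i≤h (_ , _ , _ , le) = <-irrefl {0} refl (≤-by {suc h + suc (suc h + x + i)} {suc h + suc h + x} {1} {0}
            (≤-trans (≤-trans (+-monoˡ-≤ (suc (suc h + x + i)) (≤-trans (≤-reflexive (sym (⌊even/2⌋ (suc h)))) le)) (≤-reflexive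
               (m∸n+n≡m (≤-trans (≤-by {m = suc (suc h + x + i)} {suc h + suc h + x} i≤h 0 (solve (h ∷ x ∷ i ∷ []))) (≤-reflexive eq))))) (≤-reflexive (sym eq)))
            i (solve (h ∷ x ∷ i ∷ [])))

        -- For odd `a` the levels below `⌈ a /2⌉` add up to `q ^ h` and nothing is missing. For even
        -- `a` the top level and one point of the plateau are missing on the left: `B₃` supplies the
        -- former for each of the `x` values of `b`, and `B₁` the latter.
        identity-≤ : ∀ k → k < m → total (suc k) + B₁ (suc k) + ∑[ c ] (λ b → B₃ (suc b) (suc k)) ≡ 2 * major (suc k)
        identity-≤ k k<m = go (suc k) (s≤s z≤n) k<m (parityView (suc k))
          where
          go : ∀ a → 1 ≤ a → a ≤ m → Parity a → total a + B₁ a + ∑[ c ] (λ b → B₃ (suc b) a) ≡ 2 * major a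
          go _ _ k<m (odd h) = let
            a = suc (h + h)
            x = c ∸ a
            eq : suc (h + h) + (c ∸ suc (h + h)) ≡ c
            eq = m+[n∸m]≡n (≤-trans k<m (m≤m+n m w))
            eq′ : h + suc h + (c ∸ suc (h + h)) ≡ c
            eq′ = trans (cong (_+ (c ∸ suc (h + h))) (+-suc h h)) eq in begin
            total a + B₁ a + ∑[ c ] (λ b → B₃ (suc b) a)
              ≡⟨ cong₂ _+_ (cong (λ z → total a + z) ([]-no ((a ≤? m) ×-dec (2 ∣? a)) (2∤odd h ∘ proj₂))) (∑-zero c (λ b _ → []-no ((a <? 2 * suc b) ×-dec (2 ∣? a) ×-dec (a ≤? m) ×-dec (ℕ.⌊ a /2⌋ ≤? c ∸ suc b)) (λ (_ , ev , _) → 2∤odd h ev))) ⟩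
            total a + 0 + 0
              ≡⟨ cong (λ k → k + 0 + 0) (total-≤ h (suc h) x (suc x) (⌈even/2⌉ h) (cong suc (⌊even/2⌋ h)) k<m eq′ (trans (lemma₁ h x) eq)) ⟩
            x * ∑[ suc h ] level + (2 * G h + suc (suc x) * q ^ h) + 0 + 0    ≡⟨ cong (λ k → x * k + (2 * G h + suc (suc x) * q ^ h) + 0 + 0) (∑-level h) ⟩
            x * q ^ h + (2 * G h + suc (suc x) * q ^ h) + 0 + 0               ≡⟨ lemma₂ x (q ^ h) (G h) ⟩
            2 * (G h + suc x * q ^ h)
              ≡⟨ cong (2 *_) (major-≤ {a} h (suc h) x (⌈even/2⌉ h) (+-suc h h) (n≤1+n h) ≤-refl k<m eq′) ⟨
            2 * major a ∎
            where
            lemma₁ : ∀ h x → h + suc x + h ≡ suc (h + h) + x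
            lemma₁ h x = solve (h ∷ x ∷ [])
            lemma₂ : ∀ x y g → x * y + (2 * g + suc (suc x) * y) + 0 + 0 ≡ 2 * (g + suc x * y)
            lemma₂ x y g = solve (x ∷ y ∷ g ∷ [])
          go _ _ k<m (even (suc h)) = let
            a = suc h + suc h
            x = c ∸ a
            eq : suc h + suc h + (c ∸ (suc h + suc h)) ≡ c
            eq = m+[n∸m]≡n (≤-trans k<m (m≤m+n m w)) in begin
            total a + B₁ a + ∑[ c ] (λ b → B₃ (suc b) a)
              ≡⟨ cong₂ _+_ (cong₂ _+_ (total-≤ (suc h) (suc h) x x (⌊even/2⌋ (suc h)) (⌈even/2⌉ (suc h)) k<m eq (trans (lemma₁ h x) eq))
                   (trans ([]-yes ((a ≤? m) ×-dec (2 ∣? a)) (k<m , 2∣even (suc h))) (cong (q ^_) (⌊even/2⌋ (suc h))))) (B₃-≤ {h} {x} k<m eq) ⟩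
            x * ∑[ suc h ] level + (2 * G (suc h) + suc x * q ^ suc h) + q ^ suc h + x * level (suc h)
              ≡⟨ lemma₂ x (∑[ suc h ] level) (G (suc h)) (q ^ suc h) (level (suc h)) ⟩
            x * (∑[ suc h ] level + level (suc h)) + (2 * G (suc h) + suc (suc x) * q ^ suc h)
              ≡⟨ cong (λ k → x * k + (2 * G (suc h) + suc (suc x) * q ^ suc h)) (∑-level (suc h)) ⟩
            x * q ^ suc h + (2 * G (suc h) + suc (suc x) * q ^ suc h)               ≡⟨ lemma₃ x (q ^ suc h) (G (suc h)) ⟩
            2 * (G (suc h) + suc x * q ^ suc h)
              ≡⟨ cong (2 *_) (major-≤ (suc h) (suc h) x (⌊even/2⌋ (suc h)) refl ≤-refl (n≤1+n (suc h)) k<m eq) ⟨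
            2 * major a ∎
            where
            lemma₁ : ∀ h x → suc h + x + suc h ≡ suc h + suc h + x
            lemma₁ h x = solve (h ∷ x ∷ [])
            lemma₂ : ∀ x l g y l′ → x * l + (2 * g + suc x * y) + y + x * l′ ≡ x * (l + l′) + (2 * g + suc (suc x) * y)
            lemma₂ x l g y l′ = solve (x ∷ l ∷ g ∷ y ∷ l′ ∷ [])
            lemma₃ : ∀ x y g → x * y + (2 * g + suc (suc x) * y) ≡ 2 * (g + suc x * y)
            lemma₃ x y g = solve (x ∷ y ∷ g ∷ [])

        A₂-sum : ∀ {a} h g x → ℕ.⌈ a /2⌉ ≡ g → h + g ≡ a → h ≤ g → g + x ≡ m → ∑[ suc c ] (λ b → A₂ b a) ≡ G (suc x)
        A₂-sum {a} h g x ⌈a/2⌉≡g h+g≡a h≤g eq = trans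
          (∑-cong (suc c) (λ b _ → []-cong ((a ≤? 2 * b) ×-dec (ℕ.⌈ a /2⌉ + c ≤? m + b)) ((h + g ≤? 2 * b) ×-dec (g + c ≤? m + b))
            (mk⇔ (λ (le , le′) → ≤-trans (≤-reflexive h+g≡a) le , ≤-trans (≤-reflexive (cong (_+ c) (sym ⌈a/2⌉≡g))) le′)
                 (λ (le , le′) → ≤-trans (≤-reflexive (sym h+g≡a)) le , ≤-trans (≤-reflexive (cong (_+ c) ⌈a/2⌉≡g)) le′)) (λ _ → refl)))
          (∑-major> h g w x h≤g refl eq)

        -- Since `m ≤ c`, the condition `c ≤ m` means `c = m`; so the two corrections are the same
        -- power of `q` under complementary conditions.
        B₂+B₄ : ∀ {h} → B₂ (h + h) + B₄ (h + h) ≡ q ^ (m ∸ h)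
        B₂+B₄ {h} with c ≤? m
        ... | yes c≤m = trans (cong₂ _+_ (trans ([]-yes ((2 ∣? (h + h)) ×-dec (c ≤? m)) (2∣even h , c≤m)) (cong (λ k → q ^ (k ∸ ℕ.⌊ h + h /2⌋)) (≤-antisym c≤m (m≤m+n m w))))
                            ([]-no ((2 ∣? (h + h)) ×-dec (m <? c)) (λ (_ , lt) → <⇒≱ lt c≤m))) (trans (+-identityʳ _) (cong (λ k → q ^ (m ∸ k)) (⌊even/2⌋ h)))
        ... | no c≰m = trans (cong₂ _+_ ([]-no ((2 ∣? (h + h)) ×-dec (c ≤? m)) (c≰m ∘ proj₂))
                            ([]-yes ((2 ∣? (h + h)) ×-dec (m <? c)) (2∣even h , ≰⇒> c≰m))) (cong (λ k → q ^ (m ∸ k)) (⌊even/2⌋ h))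

        -- The trapezium belongs to `y = 2m - a`. For odd `a` its plateau has two points and no
        -- correction is due; for even `a` it has one point and `B₂ + B₄` supplies the second.
        identity-> : ∀ i → i < p → total (suc m + i) + (B₂ (suc m + i) + B₄ (suc m + i)) ≡ 2 * ∑[ suc c ] (λ b → A₂ b (suc m + i))
        identity-> i i<p = go (suc m + i) (m≤m+n (suc m) i) (≤-trans (≤-reflexive (sym (+-suc m i))) (+-monoʳ-≤ m (≤-trans i<p p≤m))) (parityView (suc m + i))
          where
          go : ∀ a → m < a → a ≤ m + m → Parity a → total a + (B₂ a + B₄ a) ≡ 2 * ∑[ suc c ] (λ b → A₂ b a)
          go _ m<a a≤2m (even h) = let x = m ∸ h ; eq = m+[n∸m]≡n h≤m in begin
            total (h + h) + (B₂ (h + h) + B₄ (h + h))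
              ≡⟨ cong₂ _+_ (trans (∑-cong (suc c) (λ b _ → count-> m<a b)) (∑-count> {c} {m} (h + h) (x + x) x 0 z≤n (trans (lemma₁ h x) (cong₂ _+_ eq eq))
                   (≤-trans (≤-trans (≤-by {m = x + x} {h + x} m<a′ 1 (lemma₂ x h)) (≤-reflexive eq)) (m≤m+n m w)) (cong (_+ x) (+-identityʳ x)))) (B₂+B₄ {h}) ⟩
            2 * G x + 1 * q ^ x + q ^ x                ≡⟨ lemma₃ (G x) (q ^ x) ⟩
            2 * G (suc x)                              ≡⟨ cong (2 *_) (A₂-sum h h x (⌈even/2⌉ h) refl ≤-refl eq) ⟨
            _                                          ∎
            where
            h≤m : h ≤ m
            h≤m = ≤-trans (≤-reflexive (sym (⌊even/2⌋ h))) (≤-trans (⌊n/2⌋-mono a≤2m) (≤-reflexive (⌊even/2⌋ m)))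
            m<a′ : suc (h + (m ∸ h)) ≤ h + h
            m<a′ = ≤-trans (s≤s (≤-reflexive (m+[n∸m]≡n h≤m))) m<a
            lemma₁ : ∀ h x → h + h + (x + x) ≡ h + x + (h + x)
            lemma₁ h x = solve (h ∷ x ∷ [])
            lemma₂ : ∀ x h → x + x + (h + h) + 1 ≡ h + x + suc (h + x)
            lemma₂ x h = solve (x ∷ h ∷ [])
            lemma₃ : ∀ g y → 2 * g + 1 * y + y ≡ 2 * (g + y)
            lemma₃ g y = solve (g ∷ y ∷ [])
          go _ m<a a≤2m (odd h) = let x = m ∸ suc h ; eq = m+[n∸m]≡n h<m ; a = suc (h + h) in begin
            total a + (B₂ a + B₄ a)
              ≡⟨ cong₂ _+_ (trans (∑-cong (suc c) (λ b _ → count-> m<a b)) (∑-count> {c} {m} a (suc (x + x)) x 1 ≤-refl (trans (lemma₁ h x) (cong₂ _+_ eq eq))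
                   (≤-trans (≤-trans (≤-by {m = suc (x + x)} {suc h + x} m<a′ 1 (lemma₂ x h)) (≤-reflexive eq)) (m≤m+n m w)) (lemma₄ x)))
                 (cong₂ _+_ ([]-no ((2 ∣? a) ×-dec (c ≤? m)) (2∤odd h ∘ proj₁)) ([]-no ((2 ∣? a) ×-dec (m <? c)) (2∤odd h ∘ proj₁))) ⟩
            2 * G x + 2 * q ^ x + 0                    ≡⟨ lemma₃ (G x) (q ^ x) ⟩
            2 * G (suc x)                              ≡⟨ cong (2 *_) (A₂-sum h (suc h) x (cong suc (⌊even/2⌋ h)) (+-suc h h) (n≤1+n h) eq) ⟨
            2 * ∑[ suc c ] (λ b → A₂ b a)              ∎
            where
            h<m : suc h ≤ m
            h<m = ≰⇒> (λ m≤h → <-irrefl refl (≤-trans a≤2m (+-mono-≤ m≤h m≤h)))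
            m<a′ : suc (suc h + (m ∸ suc h)) ≤ suc (h + h)
            m<a′ = ≤-trans (s≤s (≤-reflexive (m+[n∸m]≡n h<m))) m<a
            lemma₁ : ∀ h x → suc (h + h) + suc (x + x) ≡ suc h + x + (suc h + x)
            lemma₁ h x = solve (h ∷ x ∷ [])
            lemma₂ : ∀ x h → suc (x + x) + suc (h + h) + 1 ≡ suc h + x + suc (suc h + x)
            lemma₂ x h = solve (x ∷ h ∷ [])
            lemma₃ : ∀ g y → 2 * g + 2 * y + 0 ≡ 2 * (g + y)
            lemma₃ g y = solve (g ∷ y ∷ [])
            lemma₄ : ∀ x → x + 1 + x ≡ suc (x + x)
            lemma₄ x = solve (x ∷ [])

        -- The value `a = 0` stands apart: it has `c + 1` classes and main term `c + 1`, so doubling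
        -- overcounts by `c + 1`. This is the correction `S - f₁ + 1`.
        identity : ∑[ suc f₁ ] total + suc c + ∑B₁ + ∑B₂ + ∑B₃ + ∑B₄ ≡ 2 * ∑A
        identity = begin
          ∑[ suc f₁ ] total + suc c + ∑B₁ + ∑B₂ + ∑B₃ + ∑B₄
            ≡⟨ cong₂ (λ x y → x + suc c + y + ∑B₂ + ∑B₃ + ∑B₄) (split₀ total) ∑B₁-split ⟩
          total 0 + T≤ + T> + suc c + S₁ + ∑B₂ + ∑B₃ + ∑B₄
            ≡⟨ cong₂ (λ x y → x + T≤ + T> + suc c + S₁ + ∑B₂ + y + ∑B₄) total-0 ∑B₃-split ⟩
          suc c + T≤ + T> + suc c + S₁ + ∑B₂ + S₃ + ∑B₄         ≡⟨ rearrange (suc c) T≤ T> S₁ ∑B₂ S₃ ∑B₄ ⟩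
          2 * suc c + (T≤ + S₁ + S₃) + (T> + (∑B₂ + ∑B₄))
            ≡⟨ cong₂ (λ x y → 2 * suc c + x + y)
                 (trans (cong (_+ S₃) (sym (∑-+ m (λ k → total (suc k)) (λ k → B₁ (suc k)))))
                   (trans (sym (∑-+ m (λ k → total (suc k) + B₁ (suc k)) _)) (trans (∑-cong m identity-≤) (∑-*ˡ m 2 _))))
                 (trans (cong (λ z → T> + z) (sym (∑-+ p (λ i → B₂ (suc m + i)) _)))
                   (trans (sym (∑-+ p (λ i → total (suc m + i)) _)) (trans (∑-cong p identity->) (∑-*ˡ p 2 _)))) ⟩
          2 * suc c + 2 * M≤ + 2 * M>                           ≡⟨ factor (suc c) M≤ M> ⟩
          2 * (suc c + M≤ + M>)                                 ≡⟨ cong (2 *_) ∑A-split ⟨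
          2 * ∑A                                                ∎
          where
          T≤ = ∑[ m ] (λ k → total (suc k))
          T> = ∑[ p ] (λ i → total (suc m + i))
          S₁ = ∑[ m ] (λ k → B₁ (suc k))
          S₃ = ∑[ m ] (λ k → ∑[ c ] (λ b → B₃ (suc b) (suc k)))
          M≤ = ∑[ m ] (λ k → major (suc k))
          M> = ∑[ p ] (λ i → ∑[ suc c ] (λ b → A₂ b (suc m + i)))
          rearrange : ∀ s t u s₁ s₂ s₃ s₄ → s + t + u + s + s₁ + s₂ + s₃ + s₄ ≡ 2 * s + (t + s₁ + s₃) + (u + (s₂ + s₄))
          rearrange s t u s₁ s₂ s₃ s₄ = solve (s ∷ t ∷ u ∷ s₁ ∷ s₂ ∷ s₃ ∷ s₄ ∷ [])
          factor : ∀ x y z → 2 * x + 2 * y + 2 * z ≡ 2 * (x + y + z)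
          factor x y z = solve (x ∷ y ∷ z ∷ [])

      count-formula : + ∑[ suc c ] (λ b → ∑[ suc f₁ ] (λ a → count c m a b)) ≡ classNumberFormula q f₁ (m + p + w) (f₁ + c)
      count-formula = trans (cong +_ (∑-swap (suc c) (suc f₁) (λ b a → count c m a b))) (trans
        (solve-for (+ ∑[ suc f₁ ] total) (+ c) (+ ∑B₁) (+ ∑B₂) (+ ∑B₃) (+ ∑B₄) (+ 2 ℤ.* + ∑A)
          (trans (cong (λ k → + ∑[ suc f₁ ] total ℤ.+ + k ℤ.+ + ∑B₁ ℤ.+ + ∑B₂ ℤ.+ + ∑B₃ ℤ.+ + ∑B₄) (+-comm c 1)) (trans (cong +_ identity) (ℤ.pos-* 2 ∑A))))
        (sym formula-terms))
        where
        solve-for : ∀ n c b₁ b₂ b₃ b₄ a → n ℤ.+ (c ℤ.+ 1ℤ) ℤ.+ b₁ ℤ.+ b₂ ℤ.+ b₃ ℤ.+ b₄ ≡ a →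
                    n ≡ a ℤ.- (c ℤ.+ 1ℤ) ℤ.- b₁ ℤ.- b₂ ℤ.- b₃ ℤ.- b₄
        solve-for n c b₁ b₂ b₃ b₄ a refl = ℤ.solve (n ∷ c ∷ b₁ ∷ b₂ ∷ b₃ ∷ b₄ ∷ [])

open ClassNumberFormula using (∑[_]; [_]·_; []-yes; []-no; module Count; module Formula)

open import Algebra.Bundles using (CommutativeRing)
open import Algebra.Morphism.Structures using (IsRingHomomorphism)
import Algebra.Properties.AbelianGroup as AbelianGroupProperties
import Algebra.Properties.Ring as RingProperties
import Algebra.Properties.Semiring.Exp as Exp
import Algebra.Properties.Semiring.Mult.TCOptimised as Mult
import Algebra.Properties.Semiring.Sum as Sum
import Algebra.Solver.Ring
open import Algebra.Solver.Ring.AlmostCommutativeRing using (fromCommutativeRing; _-Raw-AlmostCommutative⟶_)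
open import Data.Fin.Base as Fin using (Fin; zero; suc; splitAt; join; combine; remQuot; punchIn; punchOut)
import Data.Fin.Properties as Fin
open import Data.Integer.Base as ℤ using (ℤ; -[1+_]; 0ℤ; 1ℤ)
import Data.Integer.Properties as ℤ
open import Data.List.Base as List using (List; []; _∷_; _++_)
open import Data.List.Relation.Unary.All as All using (All; []; _∷_)
import Data.List.Relation.Unary.All.Properties as All
open import Data.Maybe.Base using (Maybe; map)
open import Data.Nat.Base as ℕ using (zero; suc; z≤n; s≤s)
import Data.Nat.Properties as ℕ
open import Algebra.Properties.CommutativeSemigroup ℕ.+-commutativeSemigroup using () renaming (interchange to +-interchange)
open import Data.Product.Base using (_,_; proj₁; proj₂; uncurry)
open import Data.Sum.Base using (_⊎_; inj₁; inj₂; [_,_]′)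
open import Data.Unit.Base using (⊤; tt)
open import Data.Vec.Base as Vec using (Vec; []; _∷_)
import Data.Vec.Functional as V
open import Function.Base using (_∘_; id)
open import Function.Bundles using (Bijection; Equivalence)
open import Level using (_⊔_)
open import Relation.Binary.Bundles using (Setoid)
open import Relation.Binary.Construct.Add.Supremum.NonStrict ℤ._≤_
  using (_≤⊤⁺; ≤⁺-trans; ≤⁺-total; ≤⁺-dec; ≤⁺-reflexive-≡; [≤]-injective)
  renaming (_≤⁺_ to _≤∞_; [_] to ≤[_])
open import Relation.Binary.Core using (Rel)
open import Relation.Binary.Definitions using (Symmetric)
import Relation.Binary.PropositionalEquality as ≡
open import Relation.Binary.PropositionalEquality using (_≢_)
import Relation.Binary.Reasoning.Setoid as SetoidReasoning
open import Relation.Nullary using (¬_; Dec; yes; no; contradiction)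
open import Relation.Nullary.Construct.Add.Supremum using ([_]; ⊤⁺; []-injective)
open import Relation.Nullary.Decidable using (_×-dec_; dec⇒maybe; decidable-stable; map′)
open import Relation.Unary using (Pred; _∈_; _⊆_)

-- Polynomial identities with integer coefficients in a commutative ring

module IntegerRingSolver {a ℓ} (R : CommutativeRing a ℓ) where
  open CommutativeRing R
  open Mult semiring using (×1-homo-*; ×-homo-+; 1+×) renaming (_×_ to _×ᴿ_)
  open RingProperties ring
  open AbelianGroupProperties +-abelianGroup using () renaming (⁻¹-∙-comm to -‿∙; ⁻¹-involutive to -‿inv)
  open SetoidReasoning setoid

  -- Integer coefficients have decidable equality in every characteristic. With the optimised
  -- multiples `1 ×ᴿ 1#` reduces to `1#`, so `con (+ 1)` denotes `1#` itself in the goals.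
  fromℤ : ℤ → Carrier
  fromℤ (+ n)    = n ×ᴿ 1#
  fromℤ -[1+ n ] = - (suc n ×ᴿ 1#)

  private
    fromℤ-⊖ : ∀ m n → fromℤ (m ℤ.⊖ n) ≈ m ×ᴿ 1# - n ×ᴿ 1#
    fromℤ-⊖ zero    zero    = sym (-‿inverseʳ 0#)
    fromℤ-⊖ zero    (suc n) = sym (+-identityˡ _)
    fromℤ-⊖ (suc m) zero    = sym (trans (+-congˡ -0#≈0#) (+-identityʳ _))
    fromℤ-⊖ (suc m) (suc n) = begin
      fromℤ (suc m ℤ.⊖ suc n)           ≡⟨ ≡.cong fromℤ (ℤ.[1+m]⊖[1+n]≡m⊖n m n) ⟩
      fromℤ (m ℤ.⊖ n)                   ≈⟨ fromℤ-⊖ m n ⟩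
      M - N                             ≈⟨ +-congʳ (+-identityˡ M) ⟨
      0# + M - N                        ≈⟨ +-congʳ (+-congʳ (-‿inverseʳ 1#)) ⟨
      1# - 1# + M - N                   ≈⟨ +-congʳ (trans (+-assoc _ _ _) (trans (+-congˡ (+-comm _ _)) (sym (+-assoc _ _ _)))) ⟩
      1# + M - 1# - N                   ≈⟨ +-assoc _ _ _ ⟩
      1# + M + (- 1# - N)               ≈⟨ +-congˡ (-‿∙ 1# N) ⟩
      1# + M - (1# + N)                 ≈⟨ +-cong (1+× m 1#) (-‿cong (1+× n 1#)) ⟨
      suc m ×ᴿ 1# - suc n ×ᴿ 1#           ∎
      where
      M = m ×ᴿ 1#
      N = n ×ᴿ 1#

    fromℤ-neg : ∀ i → fromℤ (ℤ.- i) ≈ - fromℤ i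
    fromℤ-neg (+ zero)  = sym -0#≈0#
    fromℤ-neg (+ suc n) = refl
    fromℤ-neg -[1+ n ]  = sym (-‿inv _)

    fromℤ-+ : ∀ i j → fromℤ (i ℤ.+ j) ≈ fromℤ i + fromℤ j
    fromℤ-+ (+ m)    (+ n)    = ×-homo-+ 1# m n
    fromℤ-+ (+ m)    -[1+ n ] = fromℤ-⊖ m (suc n)
    fromℤ-+ -[1+ m ] (+ n)    = trans (fromℤ-⊖ n (suc m)) (+-comm _ _)
    fromℤ-+ -[1+ m ] -[1+ n ] = begin
      - (suc (suc (m ℕ.+ n)) ×ᴿ 1#)           ≡⟨ ≡.cong (λ k → - (k ×ᴿ 1#)) (≡.sym (≡.cong suc (ℕ.+-suc m n))) ⟩
      - ((suc m ℕ.+ suc n) ×ᴿ 1#)             ≈⟨ -‿cong (×-homo-+ 1# (suc m) (suc n)) ⟩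
      - (suc m ×ᴿ 1# + suc n ×ᴿ 1#)            ≈⟨ -‿∙ _ _ ⟨
      - (suc m ×ᴿ 1#) - (suc n ×ᴿ 1#)          ∎
      where import Data.Nat.Properties as ℕ

    fromℤ-pos-* : ∀ m j → fromℤ (+ m ℤ.* j) ≈ fromℤ (+ m) * fromℤ j
    fromℤ-pos-* m (+ n) = begin
      fromℤ (+ m ℤ.* + n)      ≡⟨ ≡.cong fromℤ (ℤ.pos-* m n) ⟨
      (m ℕ.* n) ×ᴿ 1#           ≈⟨ ×1-homo-* m n ⟩
      (m ×ᴿ 1#) * (n ×ᴿ 1#)      ∎
    fromℤ-pos-* m -[1+ n ] = begin
      fromℤ (+ m ℤ.* ℤ.- (+ suc n))   ≡⟨ ≡.cong fromℤ (ℤ.neg-distribʳ-* (+ m) (+ suc n)) ⟨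
      fromℤ (ℤ.- (+ m ℤ.* + suc n))   ≈⟨ fromℤ-neg (+ m ℤ.* + suc n) ⟩
      - fromℤ (+ m ℤ.* + suc n)       ≈⟨ -‿cong (fromℤ-pos-* m (+ suc n)) ⟩
      - ((m ×ᴿ 1#) * (suc n ×ᴿ 1#))     ≈⟨ -‿distribʳ-* _ _ ⟩
      (m ×ᴿ 1#) * - (suc n ×ᴿ 1#)       ∎

    fromℤ-* : ∀ i j → fromℤ (i ℤ.* j) ≈ fromℤ i * fromℤ j
    fromℤ-* (+ m)    j = fromℤ-pos-* m j
    fromℤ-* -[1+ m ] j = begin
      fromℤ (ℤ.- (+ suc m) ℤ.* j)     ≡⟨ ≡.cong fromℤ (ℤ.neg-distribˡ-* (+ suc m) j) ⟨
      fromℤ (ℤ.- (+ suc m ℤ.* j))     ≈⟨ fromℤ-neg (+ suc m ℤ.* j) ⟩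
      - fromℤ (+ suc m ℤ.* j)         ≈⟨ -‿cong (fromℤ-pos-* (suc m) j) ⟩
      - ((suc m ×ᴿ 1#) * fromℤ j)      ≈⟨ -‿distribˡ-* _ _ ⟩
      - (suc m ×ᴿ 1#) * fromℤ j        ∎

    morphism : ℤ.+-*-rawRing -Raw-AlmostCommutative⟶ fromCommutativeRing R
    morphism = record
      { ⟦_⟧    = fromℤ
      ; +-homo = fromℤ-+
      ; *-homo = fromℤ-*
      ; -‿homo = fromℤ-neg
      ; 0-homo = refl
      ; 1-homo = refl
      }

    fromℤ-≟ : ∀ i j → Maybe (fromℤ i ≈ fromℤ j)
    fromℤ-≟ i j = map (reflexive ∘ ≡.cong fromℤ) (dec⇒maybe (i ℤ.≟ j))

  open Algebra.Solver.Ring ℤ.+-*-rawRing (fromCommutativeRing R) morphism fromℤ-≟ public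

-- Discrete valuations

module Valuation {ℓ} (K : DiscretelyValuedField ℓ) where
  open DiscretelyValuedField K hiding (zero)
  open IntegerRingSolver commutativeRing using (solve; con; _:+_; _:*_; _:-_; :-_; _:=_)
  open RingProperties ring using (-1*x≈-x)
  open AbelianGroupProperties +-abelianGroup using () renaming (⁻¹-involutive to -‿involutive)

  ≤∞-trans : ∀ {i j k} → i ≤∞ j → j ≤∞ k → i ≤∞ k
  ≤∞-trans = ≤⁺-trans ℤ.≤-trans

  ≤∞-refl : ∀ {i} → i ≤∞ i
  ≤∞-refl = ≤⁺-reflexive-≡ ℤ.≤-reflexive ≡.refl

  ≤∞-total : ∀ i j → i ≤∞ j ⊎ j ≤∞ i
  ≤∞-total = ≤⁺-total ℤ.≤-total

  v≥? : ∀ n x → Dec (v≥ n x)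
  v≥? n x = ≤⁺-dec ℤ._≤?_ [ n ] (v x)

  v≥-resp : ∀ {n x y} → x ≈ y → v≥ n x → v≥ n y
  v≥-resp x≈y = ≡.subst (_ ≤∞_) (v-cong x≈y)

  v≥-mono : ∀ {m n x} → m ℤ.≤ n → v≥ n x → v≥ m x
  v≥-mono m≤n = ≤∞-trans ≤[ m≤n ]

  v≥-+ : ∀ {n x y} → v≥ n x → v≥ n y → v≥ n (x + y)
  v≥-+ {x = x} {y} p q = [ ≤∞-trans p , ≤∞-trans q ]′ (v-+ x y)

  v≥-≈0 : ∀ {n x} → x ≈ 0# → v≥ n x
  v≥-≈0 x≈0 = ≡.subst (_ ≤∞_) (≡.sym (Equivalence.from v-∞ x≈0)) (_ ≤⊤⁺)

  v≥-0 : ∀ {n} → v≥ n 0#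
  v≥-0 = v≥-≈0 refl

  +∞-mono : ∀ {m n i j} → [ m ] ≤∞ i → [ n ] ≤∞ j → [ m ℤ.+ n ] ≤∞ i +∞ j
  +∞-mono ≤[ p ]   ≤[ q ]   = ≤[ ℤ.+-mono-≤ p q ]
  +∞-mono ≤[ _ ]   (_ ≤⊤⁺)  = _ ≤⊤⁺
  +∞-mono (_ ≤⊤⁺)  _        = _ ≤⊤⁺

  v≥-* : ∀ {m n x y} → v≥ m x → v≥ n y → v≥ (m ℤ.+ n) (x * y)
  v≥-* {x = x} {y} p q = ≡.subst (_ ≤∞_) (≡.sym (v-* x y)) (+∞-mono p q)

  v≥-*ˡ : ∀ {n x y} → 𝒪 x → v≥ n y → v≥ n (x * y)
  v≥-*ˡ {n} {x} {y} p q = ≡.subst (λ k → v≥ k (x * y)) (ℤ.+-identityˡ n) (v≥-* p q)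

  v1 : v 1# ≡ [ 0ℤ ]
  v1 = idem (v 1#) (1≉0 ∘ Equivalence.to v-∞) (≡.trans (v-cong (sym (*-identityˡ 1#))) (v-* 1# 1#))
    where
    open AbelianGroupProperties ℤ.+-0-abelianGroup using (identityˡ-unique)
    idem : ∀ i → i ≢ ⊤⁺ → i ≡ i +∞ i → i ≡ [ 0ℤ ]
    idem ⊤⁺    i≢∞ _  = contradiction ≡.refl i≢∞
    idem [ i ] _   eq = ≡.cong [_] (identityˡ-unique i i (≡.sym ([]-injective eq)))

  v-1 : v (- 1#) ≡ [ 0ℤ ]
  v-1 = double (v (- 1#)) (≡.trans (≡.sym (v-* (- 1#) (- 1#)))
          (≡.trans (v-cong (trans (-1*x≈-x (- 1#)) (-‿involutive 1#))) v1))
    where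
    double : ∀ i → i +∞ i ≡ [ 0ℤ ] → i ≡ [ 0ℤ ]
    double [ + zero ] _ = ≡.refl

  ≡⇒v≥ : ∀ {n x} → v x ≡ [ n ] → v≥ n x
  ≡⇒v≥ eq = ≡.subst (_ ≤∞_) (≡.sym eq) ≤∞-refl

  v≥-neg : ∀ {n x} → v≥ n x → v≥ n (- x)
  v≥-neg {n} {x} p = v≥-resp (-1*x≈-x x) (≡.subst (λ k → v≥ k _) (ℤ.+-identityˡ n) (v≥-* (≡⇒v≥ v-1) p))

  v≥-- : ∀ {n x y} → v≥ n x → v≥ n y → v≥ n (x - y)
  v≥-- p q = v≥-+ p (v≥-neg q)

  vinv : ∀ {x y i} → v x ≡ [ i ] → x * y ≈ 1# → v y ≡ [ ℤ.- i ]
  vinv {x} {y} {i} eq xy≈1 = lemma (v y)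
      (≡.trans (≡.cong (_+∞ v y) (≡.sym eq)) (≡.trans (≡.sym (v-* x y)) (≡.trans (v-cong xy≈1) v1)))
    where
    open AbelianGroupProperties ℤ.+-0-abelianGroup using (inverseʳ-unique)
    lemma : ∀ j → [ i ] +∞ j ≡ [ 0ℤ ] → j ≡ [ ℤ.- i ]
    lemma [ j ] e = ≡.cong [_] (inverseʳ-unique i j ([]-injective e))

  v≢∞ : ∀ {x i} → v x ≡ [ i ] → ¬ (x ≈ 0#)
  v≢∞ eq x≈0 with () ← ≡.trans (≡.sym eq) (Equivalence.from v-∞ x≈0)

  zero? : ∀ x → (x ≈ 0#) ⊎ (∃[ i ] v x ≡ [ i ])
  zero? x = lemma (v x) ≡.refl
    where
    lemma : ∀ i → v x ≡ i → (x ≈ 0#) ⊎ (∃[ i ] v x ≡ [ i ])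
    lemma ⊤⁺    eq = inj₁ (Equivalence.to v-∞ eq)
    lemma [ i ] eq = inj₂ (i , eq)

  inverse : ∀ {x i} → v x ≡ [ i ] → ∃[ y ] x * y ≈ 1# × v y ≡ [ ℤ.- i ]
  inverse eq = let (y , xy≈1) = invertible (v≢∞ eq) in y , xy≈1 , vinv eq xy≈1

  v-*-≡ : ∀ {x y i j} → v x ≡ [ i ] → v y ≡ [ j ] → v (x * y) ≡ [ i ℤ.+ j ]
  v-*-≡ {x} {y} p q = ≡.trans (v-* x y) (≡.cong₂ _+∞_ p q)

  quotient-integral : ∀ {x x⁻¹ y i} → v x ≡ [ i ] → x * x⁻¹ ≈ 1# → v x ≤∞ v y → 𝒪 (x⁻¹ * y)
  quotient-integral {x⁻¹ = x⁻¹} {y} {i} eq xx⁻¹ le =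
    ≡.subst (λ k → v≥ k (x⁻¹ * y)) (ℤ.+-inverseˡ i) (v≥-* (≡⇒v≥ (vinv eq xx⁻¹)) (≡.subst (_≤∞ v y) eq le))

  infix 4 _≼_
  _≼_ : ℕ → Carrier → Set
  n ≼ x = v≥ (+ n) x

  _≼?_ : ∀ n x → Dec (n ≼ x)
  n ≼? x = v≥? (+ n) x

  ≼-mono : ∀ {m n x} → m ℕ.≤ n → n ≼ x → m ≼ x
  ≼-mono m≤n = v≥-mono (ℤ.+≤+ m≤n)

  ≼⇒𝒪 : ∀ {n x} → n ≼ x → 𝒪 x
  ≼⇒𝒪 = ≼-mono z≤n

  ≼-* : ∀ {m n x y} → m ≼ x → n ≼ y → m ℕ.+ n ≼ x * y
  ≼-* = v≥-*

  ≼-*ˡ : ∀ {n x y} → 𝒪 x → n ≼ y → n ≼ x * y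
  ≼-*ˡ = v≥-*

  ≼-*ʳ : ∀ {n x y} → n ≼ x → 𝒪 y → n ≼ x * y
  ≼-*ʳ p q = v≥-resp (*-comm _ _) (≼-*ˡ q p)

  𝒪-1 : 𝒪 1#
  𝒪-1 = ≡⇒v≥ v1

  ≡⇒⋠ : ∀ {n x} → v x ≡ [ + n ] → ¬ (suc n ≼ x)
  ≡⇒⋠ {n} eq p with ≤[ q ] ← ≡.subst (_ ≤∞_) eq p = ℕ.<-irrefl ≡.refl (ℤ.drop‿+≤+ q)

  ≼-≡ : ∀ {m n x} → v x ≡ [ + n ] → m ≼ x → m ℕ.≤ n
  ≼-≡ eq p with ≤[ q ] ← ≡.subst (_ ≤∞_) eq p = ℤ.drop‿+≤+ q

  exactℤ : ∀ {n x} → v≥ n x → ¬ v≥ (1ℤ ℤ.+ n) x → v x ≡ [ n ]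
  exactℤ {n} {x} p ¬p = lemma (v x) p ¬p
    where
    lemma : ∀ i → [ n ] ≤∞ i → ¬ ([ 1ℤ ℤ.+ n ] ≤∞ i) → i ≡ [ n ]
    lemma ⊤⁺        p        ¬p = contradiction (_ ≤⊤⁺) ¬p
    lemma [ m ]     ≤[ p ]   ¬p = ≡.cong [_] (ℤ.≤-antisym (ℤ.≮⇒≥ (λ n<m → ¬p ≤[ ℤ.i<j⇒suc[i]≤j n<m ])) p)

  exact : ∀ {n x} → n ≼ x → ¬ (suc n ≼ x) → v x ≡ [ + n ]
  exact = exactℤ

  ≼-or-exact : ∀ n {x} → 𝒪 x → n ≼ x ⊎ (∃[ k ] k ℕ.< n × v x ≡ [ + k ])
  ≼-or-exact zero    x∈𝒪 = inj₁ x∈𝒪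
  ≼-or-exact (suc n) {x} x∈𝒪 with ≼-or-exact n x∈𝒪
  ... | inj₂ (k , k<n , eq) = inj₂ (k , ℕ.m<n⇒m<1+n k<n , eq)
  ... | inj₁ p with suc n ≼? x
  ...   | yes q = inj₁ q
  ...   | no ¬q = inj₂ (n , ℕ.≤-refl , exact p ¬q)

  ≡⇒≱ : ∀ {n x} → v x ≡ [ n ] → ¬ v≥ (1ℤ ℤ.+ n) x
  ≡⇒≱ {n} eq p with ≤[ q ] ← ≡.subst (_ ≤∞_) eq p = ℤ.i≮i (ℤ.suc[i]≤j⇒i<j q)

  exactℤ-+ : ∀ {n x y} → v x ≡ [ n ] → v≥ (1ℤ ℤ.+ n) y → v (x + y) ≡ [ n ]
  exactℤ-+ {n} {x} {y} eq p = exactℤ (v≥-+ (≡⇒v≥ eq) (v≥-mono (ℤ.i≤suc[i] n) p))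
    (λ q → ≡⇒≱ eq (v≥-resp (solve 2 (λ x y → x :+ y :- y := x) refl x y) (v≥-- q p)))

  exact-+ : ∀ {n x y} → v x ≡ [ + n ] → suc n ≼ y → v (x + y) ≡ [ + n ]
  exact-+ = exactℤ-+

  exact-resp : ∀ {n x y} → x ≈ y → v x ≡ [ n ] → v y ≡ [ n ]
  exact-resp x≈y eq = ≡.trans (v-cong (sym x≈y)) eq

  ≼-cancelˡ : ∀ {m n x y} → v x ≡ [ + m ] → m ℕ.+ n ≼ x * y → n ≼ y
  ≼-cancelˡ {m} {n} {x} {y} eq p = let (z , xz≈1 , vz) = inverse eq in
    v≥-resp (trans (sym (*-assoc z x y)) (trans (*-congʳ (trans (*-comm z x) xz≈1)) (*-identityˡ y)))
      (≡.subst (λ k → v≥ k (z * (x * y))) (arith (+ m) (+ n)) (v≥-* (≡⇒v≥ vz) p))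
    where
    arith : ∀ a b → ℤ.- a ℤ.+ (a ℤ.+ b) ≡ b
    arith a b = ≡.trans (≡.sym (ℤ.+-assoc (ℤ.- a) a b)) (≡.trans (≡.cong (ℤ._+ b) (ℤ.+-inverseˡ a)) (ℤ.+-identityˡ b))

  *-cancelˡ-nz : ∀ {i x y z} → v x ≡ [ i ] → x * y ≈ x * z → y ≈ z
  *-cancelˡ-nz {x = x} {y} {z} eq e = let (w , xw≈1 , _) = inverse eq in begin
      y            ≈⟨ cancel w xw≈1 y ⟨
      w * (x * y)  ≈⟨ *-congˡ e ⟩
      w * (x * z)  ≈⟨ cancel w xw≈1 z ⟩
      z            ∎
    where
    open import Relation.Binary.Reasoning.Setoid setoid
    cancel : ∀ w → x * w ≈ 1# → ∀ y → w * (x * y) ≈ y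
    cancel w xw y = trans (sym (*-assoc w x y)) (trans (*-congʳ (trans (*-comm w x) xw)) (*-identityˡ y))

  vpow : ∀ {x i} → v x ≡ [ i ] → ∀ n → v (x ^ n) ≡ [ + n ℤ.* i ]
  vpow eq zero = v1
  vpow {i = i} eq (suc n) = ≡.trans (v-*-≡ eq (vpow eq n)) (≡.cong [_] (≡.sym (ℤ.suc-* (+ n) i)))

  -- Powers of an element of negative valuation stay in `P` and pass every bound; the exponent
  -- `suc B` suffices because the valuation is at most -1. It is applied to the two projections of
  -- an order.
  bounded⇒integral : ∀ {p} (P : Pred Carrier p) → P 1# → (∀ {x y} → P x → P y → P (x * y)) →
                     ∀ B → (∀ {x} → P x → v≥ (ℤ.- (+ B)) x) → ∀ {x} → P x → 𝒪 x
  bounded⇒integral P P1 P* B bound {x} Px with zero? x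
  ... | inj₁ x≈0 = v≥-≈0 x≈0
  ... | inj₂ (+ n , eq) = ≡.subst ([ 0ℤ ] ≤∞_) (≡.sym eq) ≤[ ℤ.+≤+ z≤n ]
  ... | inj₂ (-[1+ n ] , eq) = contradiction (bound (pow (suc B))) absurd
    where
    pow : ∀ k → P (x ^ k)
    pow zero    = P1
    pow (suc k) = P* Px (pow k)
    absurd : ¬ v≥ (ℤ.- (+ B)) (x ^ suc B)
    absurd p with ≤[ q ] ← ≡.subst (_ ≤∞_) (vpow eq (suc B)) p =
      ℕ.<-irrefl ≡.refl (ℕ.≤-trans (ℕ.m≤m*n (suc B) (suc n))
        (ℤ.drop‿+≤+ (ℤ.neg-cancel-≤ {+ B} {+ (suc B ℕ.* suc n)} q)))

  finite-bound : ∀ {m} (h : Fin m → Carrier) → ∃[ B ] ∀ i → v≥ (ℤ.- (+ B)) (h i)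
  finite-bound {zero}  h = 0 , λ ()
  finite-bound {suc m} h with finite-bound (h ∘ suc) | zero? (h zero)
  ... | B , bound | inj₁ h₀≈0 = B , λ { zero → v≥-≈0 h₀≈0 ; (suc i) → bound i }
  ... | B , bound | inj₂ (+ n , eq) = B , λ { zero → v≥-mono ℤ.neg-≤-pos (≡⇒v≥ eq) ; (suc i) → bound i }
  ... | B , bound | inj₂ (-[1+ n ] , eq) = suc n ℕ.+ B , λ
    { zero    → v≥-mono (ℤ.neg-mono-≤ (ℤ.+≤+ (ℕ.m≤m+n (suc n) B))) (≡⇒v≥ eq)
    ; (suc i) → v≥-mono (ℤ.neg-mono-≤ (ℤ.+≤+ (ℕ.m≤n+m B (suc n)))) (bound i) }

  finite-minimum : ∀ {m} (h : Fin m → Carrier) → (∀ i → h i ≈ 0#) ⊎ (∃[ i ] ∃[ k ] v (h i) ≡ [ k ] × (∀ j → v≥ k (h j)))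
  finite-minimum {zero}  h = inj₁ λ ()
  finite-minimum {suc m} h with finite-minimum (h ∘ suc) | zero? (h zero)
  ... | inj₁ zs | inj₁ z = inj₁ λ { zero → z ; (suc i) → zs i }
  ... | inj₁ zs | inj₂ (k , eq) = inj₂ (zero , k , eq , λ { zero → ≡⇒v≥ eq ; (suc i) → v≥-≈0 (zs i) })
  ... | inj₂ (i , k , eq , min) | inj₁ z = inj₂ (suc i , k , eq , λ { zero → v≥-≈0 z ; (suc j) → min j })
  ... | inj₂ (i , k , eq , min) | inj₂ (k′ , eq′) with ℤ.≤-total k k′
  ...   | inj₁ k≤k′ = inj₂ (suc i , k , eq , λ { zero → v≥-mono k≤k′ (≡⇒v≥ eq′) ; (suc j) → min j })
  ...   | inj₂ k′≤k = inj₂ (zero , k′ , eq′ , λ { zero → ≡⇒v≥ eq′ ; (suc j) → v≥-mono k′≤k (min j) })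

  module Uniformizer {π : Carrier} (vπ : IsUniformizer π) where

    vπ^ : ∀ n → v (π ^ n) ≡ [ + n ]
    vπ^ n = ≡.trans (vpow vπ n) (≡.cong [_] (ℤ.*-identityʳ (+ n)))

    ≼-π^ : ∀ {n} → n ≼ π ^ n
    ≼-π^ {n} = ≡⇒v≥ (vπ^ n)

    𝒪-π^ : ∀ {n} → 𝒪 (π ^ n)
    𝒪-π^ {n} = ≼⇒𝒪 {n} (≼-π^ {n})

    π^-+ : ∀ m n → π ^ (m ℕ.+ n) ≈ π ^ m * π ^ n
    π^-+ m n = ^-homo-* π m n
      where open import Algebra.Properties.Semiring.Exp semiring using (^-homo-*)

    ≼-cancel-π : ∀ m {n x} → m ℕ.+ n ≼ π ^ m * x → n ≼ x
    ≼-cancel-π m = ≼-cancelˡ (vπ^ m)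

    divide : ∀ n x → ∃[ y ] x ≈ π ^ n * y
    divide n x = let (w , πw≈1 , _) = inverse (vπ^ n) in w * x ,
      sym (trans (sym (*-assoc (π ^ n) w x)) (trans (*-congʳ πw≈1) (*-identityˡ x)))

    divide≼ : ∀ n {x} → n ≼ x → ∃[ y ] 𝒪 y × x ≈ π ^ n * y
    divide≼ n {x} p = let (y , eq) = divide n x in
      y , ≼-cancel-π n (≡.subst (_≼ π ^ n * y) (≡.sym (ℕ.+-identityʳ n)) (v≥-resp eq p)) , eq

-- The ring of integers of E′

-- A generator ω of the ring of integers of E′ over 𝔬, root of X² − tX + n.
record IntegralGenerator {ℓ} (F : NonArchimedeanLocalField ℓ) (E′ : UnramifiedQuadraticExtension F) : Set ℓ where
  private
    module F = NonArchimedeanLocalField F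
    module E = UnramifiedQuadraticExtension E′
  field
    ω   : E.Carrier
    t n : F.Carrier
    ω-𝒪 : E.𝒪 ω
    t-𝒪 : F.𝒪 t
    n-𝒪 : F.𝒪 n
    ω²  : ω E.* ω E.≈ E.ι t E.* ω E.- E.ι n

  at : F.Carrier → F.Carrier → E.Carrier
  at x y = E.ι x E.+ E.ι y E.* ω

  norm : F.Carrier → F.Carrier → F.Carrier
  norm x y = x F.* x F.+ t F.* x F.* y F.+ n F.* y F.* y

  field
    coordinates : ∀ z → ∃[ x ] ∃[ y ] z E.≈ at x y
    at≈0        : ∀ {x y} → at x y E.≈ E.0# → x F.≈ F.0# × y F.≈ F.0#
    at-𝒪        : ∀ {x y} → E.𝒪 (at x y) → F.𝒪 x × F.𝒪 y
    anisotropic : ∀ {x y} → F.𝒪 x → F.𝒪 y → F.v x ≡ [ 0ℤ ] ⊎ F.v y ≡ [ 0ℤ ] → F.v (norm x y) ≡ [ 0ℤ ]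

module _ {ℓ} (F : NonArchimedeanLocalField ℓ) (E′ : UnramifiedQuadraticExtension F) where
  private
    module F = NonArchimedeanLocalField F
    module E = UnramifiedQuadraticExtension E′
    module VF = Valuation F.valuedField
    module VE = Valuation E.valuedField
  open E using (ι; ι-homomorphism; ι-𝒪)
  open IsRingHomomorphism ι-homomorphism public
    renaming (+-homo to ι-+; *-homo to ι-*; -‿homo to ι-neg; 0#-homo to ι-0; 1#-homo to ι-1; ⟦⟧-cong to ι-cong)
    using ()

  ι-- : ∀ x y → ι (x F.- y) E.≈ ι x E.- ι y
  ι-- x y = E.trans (ι-+ x (F.- y)) (E.+-congˡ (ι-neg y))

  ι-inverse : ∀ {x y} → x F.* y F.≈ F.1# → ι x E.* ι y E.≈ E.1#
  ι-inverse xy≈1 = E.trans (E.sym (ι-* _ _)) (E.trans (ι-cong xy≈1) ι-1)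

  ι-integral : ∀ {x} → F.𝒪 x → E.𝒪 (ι x)
  ι-integral = Equivalence.to ι-𝒪

  ι≈0 : ∀ {x} → ι x E.≈ E.0# → x F.≈ F.0#
  ι≈0 {x} ιx≈0 with VF.zero? x
  ... | inj₁ x≈0      = x≈0
  ... | inj₂ (_ , eq) = let (y , xy≈1 , _) = VF.inverse eq in
    contradiction (E.trans (E.sym (ι-inverse xy≈1)) (E.trans (E.*-congʳ ιx≈0) (E.zeroˡ (ι y)))) E.1≉0

  private
    both-integral : ∀ {i} → 0ℤ ℤ.≤ i → 0ℤ ℤ.≤ ℤ.- i → i ≡ 0ℤ
    both-integral {+ zero}  _ _ = ≡.refl
    both-integral {+ suc i} _ ()

    unit : ∀ {i j} → [ 0ℤ ] ≤∞ i → i ≡ [ j ] → 0ℤ ℤ.≤ ℤ.- j → i ≡ [ 0ℤ ]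
    unit ≤[ p ] ≡.refl q = ≡.cong [_] (both-integral p q)

  -- `ι-𝒪` compares integrality only, so it is applied both to `x` and to its inverse.
  ι-unit⁻¹ : ∀ {x} → E.v (ι x) ≡ [ 0ℤ ] → F.v x ≡ [ 0ℤ ]
  ι-unit⁻¹ {x} eq with VF.zero? x
  ... | inj₁ x≈0 = contradiction (E.trans (ι-cong x≈0) ι-0) (VE.v≢∞ eq)
  ... | inj₂ (i , eq′) = let (y , xy≈1 , vy) = VF.inverse eq′ in
    unit (Equivalence.from ι-𝒪 (VE.≡⇒v≥ eq)) eq′
      ([≤]-injective (≡.subst ([ 0ℤ ] ≤∞_) vy (Equivalence.from ι-𝒪 (VE.≡⇒v≥ (VE.vinv eq (ι-inverse xy≈1))))))

  private
    module Sol = IntegerRingSolver E.commutativeRing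
    module SolF = IntegerRingSolver F.commutativeRing
    open Sol using (_:+_; _:*_; _:-_; :-_; _:=_; con)
    open SetoidReasoning E.setoid

    ∉𝔪⇒unit : ∀ {x} → ¬ F.𝔪 x → F.𝒪 x → F.v x ≡ [ 0ℤ ]
    ∉𝔪⇒unit ¬p p = VF.exact p ¬p

    1∉𝔪 : ¬ E.𝔪 E.1#
    1∉𝔪 = VE.≡⇒⋠ VE.v1

    ResidueIndependent : E.Carrier → E.Carrier → Set ℓ
    ResidueIndependent a b = ∀ {x y} → F.𝒪 x → F.𝒪 y → E.𝔪 (ι x E.* a E.+ ι y E.* b) → F.𝔪 x × F.𝔪 y

    -- Steinitz exchange over the residue field: in `1 ≡ p a + q b` the coefficient `q` is a unit,
    -- so `b` may be replaced by `1`.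
    exchange : ∀ {a b p q} → ResidueIndependent a b → F.𝒪 p → F.𝒪 q →
               E.𝔪 (E.1# E.- (ι p E.* a E.+ ι q E.* b)) → ¬ F.𝔪 q → ResidueIndependent E.1# a
    exchange {a} {b} {p} {q} ind p∈ q∈ rel q∉ {x} {y} x∈ y∈ h =
      let k = VE.v≥-- h (VE.≼-*ˡ (ι-integral x∈) rel)
          (m₁ , m₂) = ind (VF.v≥-+ (VF.≼-*ˡ x∈ p∈) y∈) (VF.≼-*ˡ x∈ q∈) (VE.v≥-resp eq k)
          x∈𝔪 = VF.≼-cancelˡ (∉𝔪⇒unit q∉ q∈) (VF.v≥-resp (F.*-comm x q) m₂)
      in x∈𝔪 , VF.v≥-resp (SolF.solve 3 (λ x y p → (x SolF.:* p SolF.:+ y) SolF.:- x SolF.:* p SolF.:= y) F.refl x y p)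
                 (VF.v≥-- m₁ (VF.≼-*ʳ x∈𝔪 p∈))
      where
      eq : (ι x E.* E.1# E.+ ι y E.* a) E.- ι x E.* (E.1# E.- (ι p E.* a E.+ ι q E.* b))
           E.≈ ι (x F.* p F.+ y) E.* a E.+ ι (x F.* q) E.* b
      eq = begin
        _ ≈⟨ Sol.solve 6 (λ x y p q a b → (x :* con (+ 1) :+ y :* a) :- x :* (con (+ 1) :- (p :* a :+ q :* b))
                := (x :* p :+ y) :* a :+ (x :* q) :* b) E.refl (ι x) (ι y) (ι p) (ι q) a b ⟩
        _ ≈⟨ E.+-cong (E.*-congʳ (E.+-congʳ (ι-* x p))) (E.*-congʳ (ι-* x q)) ⟨
        _ ≈⟨ E.+-congʳ (E.*-congʳ (ι-+ (x F.* p) y)) ⟨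
        _ ∎

    -- In a residue basis the two coefficients of `1` cannot both vanish. The vector with a unit
    -- coefficient is exchanged for `1`, and the other one becomes `ω`.
    residue-generator : ∃[ ω ] E.𝒪 ω × ResidueIndependent E.1# ω
    residue-generator =
      let (e , span , independent) = E.residueDegree
          a = proj₁ (e zero) ; b = proj₁ (e (suc zero))
          ind : ResidueIndependent a b
          ind {x} {y} x∈ y∈ h =
            let z = independent ((x , x∈) V.∷ (y , y∈) V.∷ V.[])
                      (VE.v≥-resp (Sol.solve 2 (λ u w → u :+ w := u :+ (w :+ con (+ 0)) :- con (+ 0)) E.refl _ _) h)
                drop0 : ∀ {x} → F.𝔪 (x F.- F.0#) → F.𝔪 x
                drop0 {x} = VF.v≥-resp (SolF.solve 1 (λ x → x SolF.:- SolF.con (+ 0) SolF.:= x) F.refl x)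
            in drop0 (z zero) , drop0 (z (suc zero))
          (c , rel₀) = span (E.1# , VE.𝒪-1)
          (p , p∈) = c zero ; (q , q∈) = c (suc zero)
          rel : E.𝔪 (E.1# E.- (ι p E.* a E.+ ι q E.* b))
          rel = VE.v≥-resp (E.+-congˡ (E.-‿cong (E.+-congˡ (E.+-identityʳ _)))) rel₀
      in choose ind (proj₂ (e zero)) (proj₂ (e (suc zero))) p∈ q∈ rel
      where
      choose : ∀ {a b p q} → ResidueIndependent a b → E.𝒪 a → E.𝒪 b → F.𝒪 p → F.𝒪 q →
               E.𝔪 (E.1# E.- (ι p E.* a E.+ ι q E.* b)) → ∃[ ω ] E.𝒪 ω × ResidueIndependent E.1# ω
      choose {a} {b} {p} {q} ind a∈ b∈ p∈ q∈ rel with 1 VF.≼? q | 1 VF.≼? p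
      ... | no q∉ | _ = a , a∈ , exchange ind p∈ q∈ rel q∉
      ... | yes q∈𝔪 | no p∉ = b , b∈ , exchange
              (λ {x} {y} x∈ y∈ h → let (l , r) = ind y∈ x∈ (VE.v≥-resp (E.+-comm _ _) h) in r , l) q∈ p∈
              (VE.v≥-resp (E.+-congˡ (E.-‿cong (E.+-comm _ _))) rel) p∉
      ... | yes q∈𝔪 | yes p∈𝔪 = contradiction
              (VE.v≥-resp (Sol.solve 2 (λ u w → (u :- w) :+ w := u) E.refl _ _)
                (VE.v≥-+ rel (VE.v≥-+ (VE.≼-*ʳ (ι-𝔪 p∈𝔪) a∈) (VE.≼-*ʳ (ι-𝔪 q∈𝔪) b∈)))) 1∉𝔪
        where
        ι-𝔪 : ∀ {x} → F.𝔪 x → E.𝔪 (ι x)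
        ι-𝔪 {x} x∈𝔪 with 1 VE.≼? ι x
        ... | yes q = q
        ... | no ¬q = contradiction x∈𝔪 (VF.≡⇒⋠ (ι-unit⁻¹ (VE.exact (ι-integral (VF.≼⇒𝒪 x∈𝔪)) ¬q)))

    module Generator {ω : E.Carrier} (ω-𝒪 : E.𝒪 ω) (ind : ResidueIndependent E.1# ω) where

      at : F.Carrier → F.Carrier → E.Carrier
      at x y = ι x E.+ ι y E.* ω

      -- This is where unramifiedness enters: `1` and `ω` are independent over the residue field, so
      -- a combination with a unit coefficient is not in the maximal ideal.
      at-primitive : ∀ {x y} → F.𝒪 x → F.𝒪 y → F.v x ≡ [ 0ℤ ] ⊎ F.v y ≡ [ 0ℤ ] → E.v (at x y) ≡ [ 0ℤ ]
      at-primitive {x} {y} x∈ y∈ prim =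
        VE.exact (VE.v≥-+ (ι-integral x∈) (VE.≼-*ˡ (ι-integral y∈) ω-𝒪))
          (λ h → let (x∈𝔪 , y∈𝔪) = ind x∈ y∈ (VE.v≥-resp (E.+-congʳ (E.sym (E.*-identityʳ _))) h) in
            [ (λ eq → VF.≡⇒⋠ eq x∈𝔪) , (λ eq → VF.≡⇒⋠ eq y∈𝔪) ]′ prim)

      private
        ∞≤ : ∀ {x y} → x F.≈ F.0# → F.v x ≤∞ F.v y → y F.≈ F.0#
        ∞≤ {x} {y} x≈0 le = Equivalence.to F.v-∞ (lemma (≡.subst (_≤∞ F.v y) (Equivalence.from F.v-∞ x≈0) le))
          where
          lemma : ∀ {i} → ⊤⁺ ≤∞ i → i ≡ ⊤⁺
          lemma (_ ≤⊤⁺) = ≡.refl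

        v-absorb : ∀ {x z} → E.v z ≡ [ 0ℤ ] → E.v (ι x E.* z) ≡ E.v (ι x)
        v-absorb {x} {z} eq with VE.zero? (ι x)
        ... | inj₁ ιx≈0 = ≡.trans (E.v-cong (E.trans (E.*-congʳ ιx≈0) (E.zeroˡ z))) (≡.sym (E.v-cong ιx≈0))
        ... | inj₂ (i , eq′) = ≡.trans (VE.v-*-≡ eq′ eq) (≡.trans (≡.cong [_] (ℤ.+-identityʳ i)) (≡.sym eq′))

      -- Dividing by the coordinate of smaller valuation reduces to `at-primitive`. The value is
      -- given through `ι` because the two valuations are compared by `ι-𝒪` alone.
      at-v : ∀ x y → (F.v x ≤∞ F.v y × E.v (at x y) ≡ E.v (ι x)) ⊎ (F.v y ≤∞ F.v x × E.v (at x y) ≡ E.v (ι y))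
      at-v x y with VF.zero? x | VF.zero? y | VF.≤∞-total (F.v x) (F.v y)
      ... | inj₁ x≈0 | _ | inj₁ le = inj₁ (le , E.v-cong (E.trans (E.+-congˡ (E.trans (E.*-congʳ (E.trans (ι-cong y≈0) ι-0)) (E.zeroˡ ω))) (E.+-identityʳ _)))
        where y≈0 = ∞≤ x≈0 le
      ... | inj₂ (i , eq) | _ | inj₁ le = inj₁ (le , ≡.trans (E.v-cong e) (v-absorb prim))
        where
        x⁻¹ = proj₁ (VF.inverse eq)
        xx⁻¹ = proj₁ (proj₂ (VF.inverse eq))
        prim : E.v (at F.1# (x⁻¹ F.* y)) ≡ [ 0ℤ ]
        prim = at-primitive VF.𝒪-1 (VF.quotient-integral eq xx⁻¹ le) (inj₁ VF.v1)
        e : at x y E.≈ ι x E.* at F.1# (x⁻¹ F.* y)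
        e = begin
          ι x E.+ ι y E.* ω                       ≈⟨ Sol.solve 3 (λ x y o → x :+ y :* o := x :* con (+ 1) :+ con (+ 1) :* y :* o) E.refl (ι x) (ι y) ω ⟩
          ι x E.* E.1# E.+ E.1# E.* ι y E.* ω     ≈⟨ E.+-congˡ (E.*-congʳ (E.*-congʳ (ι-inverse xx⁻¹))) ⟨
          ι x E.* E.1# E.+ ι x E.* ι x⁻¹ E.* ι y E.* ω ≈⟨ Sol.solve 5 (λ x z y o j → x :* j :+ x :* z :* y :* o := x :* (j :+ z :* y :* o)) E.refl (ι x) (ι x⁻¹) (ι y) ω E.1# ⟩
          ι x E.* (E.1# E.+ ι x⁻¹ E.* ι y E.* ω)   ≈⟨ E.*-congˡ (E.+-cong ι-1 (E.*-congʳ (ι-* x⁻¹ y))) ⟨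
          ι x E.* at F.1# (x⁻¹ F.* y) ∎
      ... | _ | inj₁ y≈0 | inj₂ le = inj₂ (le , E.v-cong (E.trans (E.+-cong (E.trans (ι-cong x≈0) ι-0) (E.trans (E.*-congʳ ιy≈0) (E.zeroˡ ω))) (E.trans (E.+-identityʳ _) (E.sym ιy≈0))))
        where
        ιy≈0 = E.trans (ι-cong y≈0) ι-0
        x≈0 = ∞≤ y≈0 le
      ... | _ | inj₂ (i , eq) | inj₂ le = inj₂ (le , ≡.trans (E.v-cong e) (v-absorb prim))
        where
        y⁻¹ = proj₁ (VF.inverse eq)
        yy⁻¹ = proj₁ (proj₂ (VF.inverse eq))
        prim : E.v (at (y⁻¹ F.* x) F.1#) ≡ [ 0ℤ ]
        prim = at-primitive (VF.quotient-integral eq yy⁻¹ le) VF.𝒪-1 (inj₂ VF.v1)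
        e : at x y E.≈ ι y E.* at (y⁻¹ F.* x) F.1#
        e = begin
          ι x E.+ ι y E.* ω                       ≈⟨ Sol.solve 3 (λ x y o → x :+ y :* o := con (+ 1) :* x :+ y :* (con (+ 1) :* o)) E.refl (ι x) (ι y) ω ⟩
          E.1# E.* ι x E.+ ι y E.* (E.1# E.* ω)   ≈⟨ E.+-congʳ (E.*-congʳ (ι-inverse yy⁻¹)) ⟨
          ι y E.* ι y⁻¹ E.* ι x E.+ ι y E.* (E.1# E.* ω) ≈⟨ Sol.solve 5 (λ x z y o j → y :* z :* x :+ y :* (j :* o) := y :* (z :* x :+ j :* o)) E.refl (ι x) (ι y⁻¹) (ι y) ω E.1# ⟩
          ι y E.* (ι y⁻¹ E.* ι x E.+ E.1# E.* ω)   ≈⟨ E.*-congˡ (E.+-cong (ι-* y⁻¹ x) (E.*-congʳ ι-1)) ⟨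
          ι y E.* at (y⁻¹ F.* x) F.1# ∎

      at≈0 : ∀ {x y} → at x y E.≈ E.0# → x F.≈ F.0# × y F.≈ F.0#
      at≈0 {x} {y} z≈0 with at-v x y
      ... | inj₁ (le , eq) = x≈0 , ∞≤ x≈0 le
        where x≈0 = ι≈0 (Equivalence.to E.v-∞ (≡.trans (≡.sym eq) (Equivalence.from E.v-∞ z≈0)))
      ... | inj₂ (le , eq) = ∞≤ y≈0 le , y≈0
        where y≈0 = ι≈0 (Equivalence.to E.v-∞ (≡.trans (≡.sym eq) (Equivalence.from E.v-∞ z≈0)))

      at-𝒪 : ∀ {x y} → E.𝒪 (at x y) → F.𝒪 x × F.𝒪 y
      at-𝒪 {x} {y} z∈ with at-v x y
      ... | inj₁ (le , eq) = x∈ , VF.≤∞-trans x∈ le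
        where x∈ = Equivalence.from ι-𝒪 (≡.subst ([ 0ℤ ] ≤∞_) eq z∈)
      ... | inj₂ (le , eq) = VF.≤∞-trans y∈ le , y∈
        where y∈ = Equivalence.from ι-𝒪 (≡.subst ([ 0ℤ ] ≤∞_) eq z∈)

      -- Cramer's rule for the matrix expressing 1, ω in an F-basis of E′
      coordinates : ∀ z → ∃[ x ] ∃[ y ] z E.≈ at x y
      coordinates z =
        let (e , span , _) = E.degree
            (A , eA) = span E.1# ; (B , eB) = span ω ; (C , eC) = span z
        in cramer eA eB eC
        where
        cramer : ∀ {e₀ e₁ a b c d x y} → E.1# E.≈ ι a E.* e₀ E.+ (ι b E.* e₁ E.+ E.0#) →
                 ω E.≈ ι c E.* e₀ E.+ (ι d E.* e₁ E.+ E.0#) → z E.≈ ι x E.* e₀ E.+ (ι y E.* e₁ E.+ E.0#) →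
                 ∃[ x ] ∃[ y ] z E.≈ at x y
        cramer {e₀} {e₁} {a} {b} {c} {d} {x} {y} e1 eω ez with VF.zero? (a F.* d F.- b F.* c)
        -- A vanishing determinant would make both `at (- c) a` and `at (- d) b` zero, hence `a` and
        -- `b` zero by `at≈0`; but these are the coordinates of `1`.
        ... | inj₁ det≈0 = contradiction 1≈0 E.1≉0
          where
          ιdet : ι a E.* ι d E.- ι b E.* ι c E.≈ E.0#
          ιdet = E.trans (E.sym (E.trans (ι-- _ _) (E.+-cong (ι-* a d) (E.-‿cong (ι-* b c))))) (E.trans (ι-cong det≈0) ι-0)
          rel₁ : at (F.- c) a E.≈ E.0#
          rel₁ = begin
            ι (F.- c) E.+ ι a E.* ω     ≈⟨ E.+-cong (E.trans (ι-neg c) (E.-‿cong (E.sym (E.*-identityʳ _)))) (E.*-congˡ eω) ⟩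
            E.- (ι c E.* E.1#) E.+ ι a E.* _       ≈⟨ E.+-congʳ (E.-‿cong (E.*-congˡ e1)) ⟩
            _ ≈⟨ Sol.solve 6 (λ a b c d e f → :- (c :* (a :* e :+ (b :* f :+ con (+ 0)))) :+ a :* (c :* e :+ (d :* f :+ con (+ 0))) := (a :* d :- b :* c) :* f) E.refl (ι a) (ι b) (ι c) (ι d) e₀ e₁ ⟩
            _ ≈⟨ E.trans (E.*-congʳ ιdet) (E.zeroˡ e₁) ⟩
            E.0# ∎
          rel₂ : at (F.- d) b E.≈ E.0#
          rel₂ = begin
            ι (F.- d) E.+ ι b E.* ω     ≈⟨ E.+-cong (E.trans (ι-neg d) (E.-‿cong (E.sym (E.*-identityʳ _)))) (E.*-congˡ eω) ⟩
            E.- (ι d E.* E.1#) E.+ ι b E.* _       ≈⟨ E.+-congʳ (E.-‿cong (E.*-congˡ e1)) ⟩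
            _ ≈⟨ Sol.solve 6 (λ a b c d e f → :- (d :* (a :* e :+ (b :* f :+ con (+ 0)))) :+ b :* (c :* e :+ (d :* f :+ con (+ 0))) := (a :* d :- b :* c) :* (:- e)) E.refl (ι a) (ι b) (ι c) (ι d) e₀ e₁ ⟩
            _ ≈⟨ E.trans (E.*-congʳ ιdet) (E.zeroˡ _) ⟩
            E.0# ∎
          1≈0 : E.1# E.≈ E.0#
          1≈0 = begin
            E.1# ≈⟨ e1 ⟩
            _ ≈⟨ E.+-cong (E.*-congʳ (ι0 (proj₂ (at≈0 rel₁)))) (E.+-congʳ (E.*-congʳ (ι0 (proj₂ (at≈0 rel₂))))) ⟩
            E.0# E.* e₀ E.+ (E.0# E.* e₁ E.+ E.0#) ≈⟨ Sol.solve 2 (λ e f → con (+ 0) :* e :+ (con (+ 0) :* f :+ con (+ 0)) := con (+ 0)) E.refl e₀ e₁ ⟩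
            E.0# ∎
            where
            ι0 : ∀ {x} → x F.≈ F.0# → ι x E.≈ E.0#
            ι0 p = E.trans (ι-cong p) ι-0
        ... | inj₂ (_ , eq) = δ F.* (x F.* d F.- y F.* c) , δ F.* (y F.* a F.- x F.* b) , E.sym (begin
            _ ≈⟨ E.+-cong (ι-poly δ x d y c) (E.*-congʳ (ι-poly δ y a x b)) ⟩
            D E.* (X E.* ι d E.- Y E.* ι c) E.+ (D E.* (Y E.* ι a E.- X E.* ι b)) E.* ω
              ≈⟨ E.+-cong (E.sym (E.*-identityʳ _)) (E.*-congˡ eω) ⟩
            D E.* (X E.* ι d E.- Y E.* ι c) E.* E.1# E.+ (D E.* (Y E.* ι a E.- X E.* ι b)) E.* (ι c E.* e₀ E.+ (ι d E.* e₁ E.+ E.0#))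
              ≈⟨ E.+-congʳ (E.*-congˡ e1) ⟩
            _ ≈⟨ Sol.solve 9 (λ D X Y a b c d e f →
                   D :* (X :* d :- Y :* c) :* (a :* e :+ (b :* f :+ con (+ 0))) :+ (D :* (Y :* a :- X :* b)) :* (c :* e :+ (d :* f :+ con (+ 0)))
                   := ((a :* d :- b :* c) :* D) :* (X :* e :+ (Y :* f :+ con (+ 0)))) E.refl D X Y (ι a) (ι b) (ι c) (ι d) e₀ e₁ ⟩
            _ ≈⟨ E.*-congʳ (E.*-congʳ (E.sym (E.trans (ι-- _ _) (E.+-cong (ι-* a d) (E.-‿cong (ι-* b c)))))) ⟩
            _ ≈⟨ E.*-congʳ (ι-inverse detδ) ⟩
            _ ≈⟨ E.*-identityˡ _ ⟩
            _ ≈⟨ ez ⟨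
            z ∎)
          where
          δ = proj₁ (VF.inverse eq)
          detδ = proj₁ (proj₂ (VF.inverse eq))
          D = ι δ
          X = ι x
          Y = ι y
          ι-poly : ∀ δ x d y c → ι (δ F.* (x F.* d F.- y F.* c)) E.≈ ι δ E.* (ι x E.* ι d E.- ι y E.* ι c)
          ι-poly δ x d y c = E.trans (ι-* _ _) (E.*-congˡ (E.trans (ι-- _ _) (E.+-cong (ι-* _ _) (E.-‿cong (ι-* _ _)))))

      private
        s u : F.Carrier
        s = proj₁ (coordinates (ω E.* ω))
        u = proj₁ (proj₂ (coordinates (ω E.* ω)))
        su-𝒪 = at-𝒪 (VE.v≥-resp (proj₂ (proj₂ (coordinates (ω E.* ω)))) (VE.≼-*ˡ ω-𝒪 ω-𝒪))

      generator : IntegralGenerator F E′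
      generator = record
        { ω = ω ; t = u ; n = F.- s ; ω-𝒪 = ω-𝒪 ; t-𝒪 = proj₂ su-𝒪 ; n-𝒪 = VF.v≥-neg (proj₁ su-𝒪)
        ; ω² = ω²
        ; coordinates = coordinates ; at≈0 = at≈0 ; at-𝒪 = at-𝒪
        -- The norm is the product of `at x y` and its conjugate `at (x + u y) (- y)`, which is
        -- again primitive; so both factors are units.
        ; anisotropic = λ {x} {y} x∈ y∈ prim → ι-unit⁻¹ (VE.exact-resp (conjugate x y)
            (VE.v-*-≡ (at-primitive x∈ y∈ prim)
              (at-primitive (VF.v≥-+ x∈ (VF.≼-*ˡ (proj₂ su-𝒪) y∈)) (VF.v≥-neg y∈) (prim′ x∈ y∈ prim)))) }
        where
        ω² : ω E.* ω E.≈ ι u E.* ω E.- ι (F.- s)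
        ω² = begin
            ω E.* ω                     ≈⟨ proj₂ (proj₂ (coordinates (ω E.* ω))) ⟩
            ι s E.+ ι u E.* ω           ≈⟨ Sol.solve 2 (λ s x → s :+ x := x :- :- s) E.refl (ι s) (ι u E.* ω) ⟩
            ι u E.* ω E.- (E.- ι s)     ≈⟨ E.+-congˡ (E.-‿cong (ι-neg s)) ⟨
            ι u E.* ω E.- ι (F.- s)     ∎
        unit-neg : ∀ {y} → F.v y ≡ [ 0ℤ ] → F.v (F.- y) ≡ [ 0ℤ ]
        unit-neg {y} eq = VF.exact-resp (SolF.solve 1 (λ y → (SolF.:- SolF.con (+ 1)) SolF.:* y SolF.:= SolF.:- y) F.refl y)
                        (VF.v-*-≡ VF.v-1 eq)
        prim′ : ∀ {x y} → F.𝒪 x → F.𝒪 y → F.v x ≡ [ 0ℤ ] ⊎ F.v y ≡ [ 0ℤ ] →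
                F.v (x F.+ u F.* y) ≡ [ 0ℤ ] ⊎ F.v (F.- y) ≡ [ 0ℤ ]
        prim′ {x} {y} x∈ y∈ (inj₂ eq) = inj₂ (unit-neg eq)
        prim′ {x} {y} x∈ y∈ (inj₁ eq) with 1 VF.≼? y
        ... | no y∉ = inj₂ (unit-neg (VF.exact y∈ y∉))
        ... | yes y∈𝔪 = inj₁ (VF.exact-+ eq (VF.≼-*ˡ (proj₂ su-𝒪) y∈𝔪))
        conjugate : ∀ x y → at x y E.* at (x F.+ u F.* y) (F.- y) E.≈
                    ι (x F.* x F.+ u F.* x F.* y F.+ (F.- s) F.* y F.* y)
        conjugate x y = begin
          _ ≈⟨ E.*-congˡ (E.+-cong (E.trans (ι-+ _ _) (E.+-congˡ (ι-* u y))) (E.*-congʳ (ι-neg y))) ⟩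
          (X E.+ Y E.* ω) E.* (X E.+ U E.* Y E.+ (E.- Y) E.* ω)
            ≈⟨ Sol.solve 4 (λ X Y U o → (X :+ Y :* o) :* (X :+ U :* Y :+ (:- Y) :* o) := X :* X :+ U :* X :* Y :+ U :* Y :* Y :* o :- Y :* Y :* (o :* o)) E.refl X Y U ω ⟩
          X E.* X E.+ U E.* X E.* Y E.+ U E.* Y E.* Y E.* ω E.- Y E.* Y E.* (ω E.* ω)
            ≈⟨ E.+-congˡ (E.-‿cong (E.*-congˡ ω²)) ⟩
          X E.* X E.+ U E.* X E.* Y E.+ U E.* Y E.* Y E.* ω E.- Y E.* Y E.* (U E.* ω E.- ι (F.- s))
            ≈⟨ Sol.solve 5 (λ X Y U o n → X :* X :+ U :* X :* Y :+ U :* Y :* Y :* o :- Y :* Y :* (U :* o :- n) := X :* X :+ U :* X :* Y :+ n :* Y :* Y) E.refl X Y U ω (ι (F.- s)) ⟩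
          _ ≈⟨ E.+-cong (E.+-cong (ι-* _ _) (E.trans (ι-* _ _) (E.*-congʳ (ι-* _ _)))) (E.trans (ι-* _ _) (E.*-congʳ (ι-* _ _))) ⟨
          _ ≈⟨ E.+-congʳ (ι-+ _ _) ⟨
          _ ≈⟨ ι-+ _ _ ⟨
          _ ∎
          where
          X = ι x
          Y = ι y
          U = ι u

  integral-generator : IntegralGenerator F E′
  integral-generator = let (_ , ω-𝒪 , ind) = residue-generator in Generator.generator ω-𝒪 ind

-- Counting classes by systems of representatives

-- Representatives of the `_~_`-classes that meet `P`. Working on subsets instead of quotients
-- allows a set to be cut into pieces, and each piece to be counted for a relation of its own.
record Enumeration {a r p} {A : Set a} (_~_ : Rel A r) (P : Pred A p) (n : ℕ) : Set (a ⊔ r ⊔ p) where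
  field
    enum      : Fin n → A
    enum∈     : ∀ i → enum i ∈ P
    injective : ∀ {i j} → enum i ~ enum j → i ≡ j
    covers    : ∀ {x} → x ∈ P → ∃[ i ] x ~ enum i

open Enumeration

module _ {a r} {A : Set a} {_~_ : Rel A r} where

  empty : ∀ {p} {P : Pred A p} → (∀ x → ¬ P x) → Enumeration _~_ P 0
  empty ¬P = record
    { enum = λ () ; enum∈ = λ () ; injective = λ { {()} } ; covers = λ {x} x∈P → contradiction x∈P (¬P x) }

  singleton : ∀ {p} {P : Pred A p} x → x ∈ P → (∀ {y} → y ∈ P → y ~ x) → Enumeration _~_ P 1
  singleton x x∈P h = record
    { enum = λ _ → x ; enum∈ = λ _ → x∈P ; injective = λ { {zero} {zero} _ → ≡.refl } ; covers = λ y∈P → zero , h y∈P }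

  -- The two relations are compared on `P` only: homothety is congruence to a modulus that varies
  -- from piece to piece.
  Enumeration-resp : ∀ {p q r′ m n} {P : Pred A p} {Q : Pred A q} {_≈_ : Rel A r′} → m ≡ n → P ⊆ Q → Q ⊆ P →
                     (∀ {x y} → P x → P y → (x ~ y → x ≈ y) × (x ≈ y → x ~ y)) →
                     Enumeration _~_ P m → Enumeration _≈_ Q n
  Enumeration-resp ≡.refl P⊆Q Q⊆P eq e = record
    { enum      = enum e
    ; enum∈     = λ i → P⊆Q (enum∈ e i)
    ; injective = λ {i} {j} x≈y → injective e (proj₂ (eq (enum∈ e i) (enum∈ e j)) x≈y)
    ; covers    = λ x∈Q → let (i , x~) = covers e (Q⊆P x∈Q) in i , proj₁ (eq (Q⊆P x∈Q) (enum∈ e i)) x~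
    }

  union : Symmetric _~_ → ∀ {p q s m n} {P : Pred A p} {Q : Pred A q} {R : Pred A s} →
          P ⊆ R → Q ⊆ R → (∀ {x} → R x → P x ⊎ Q x) → (∀ {x y} → P x → Q y → ¬ x ~ y) →
          Enumeration _~_ P m → Enumeration _~_ Q n → Enumeration _~_ R (m ℕ.+ n)
  union ~-sym {m = m} {n} {P} {Q} {R} P⊆R Q⊆R R⊆ disj e f = record
    { enum      = g ∘ splitAt m
    ; enum∈     = g∈ ∘ splitAt m
    ; injective = λ {i} {j} h → ≡.trans (≡.sym (Fin.join-splitAt m n i))
                    (≡.trans (≡.cong (join m n) (inj (splitAt m i) (splitAt m j) h)) (Fin.join-splitAt m n j))
    ; covers    = λ {x} x∈R → [ (λ x∈P → let (i , h) = covers e x∈P in at (inj₁ i) h)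
                              , (λ x∈Q → let (i , h) = covers f x∈Q in at (inj₂ i) h) ]′ (R⊆ x∈R)
    }
    where
    g : Fin m ⊎ Fin n → A
    g = [ enum e , enum f ]′
    g∈ : ∀ s → R (g s)
    g∈ (inj₁ i) = P⊆R (enum∈ e i)
    g∈ (inj₂ i) = Q⊆R (enum∈ f i)
    inj : ∀ s s′ → g s ~ g s′ → s ≡ s′
    inj (inj₁ i) (inj₁ j) h = ≡.cong inj₁ (injective e h)
    inj (inj₁ i) (inj₂ j) h = contradiction h (disj (enum∈ e i) (enum∈ f j))
    inj (inj₂ i) (inj₁ j) h = contradiction (~-sym h) (disj (enum∈ e j) (enum∈ f i))
    inj (inj₂ i) (inj₂ j) h = ≡.cong inj₂ (injective f h)
    at : ∀ {x} s → x ~ g s → ∃[ i ] x ~ g (splitAt m i)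
    at {x} s h = join m n s , ≡.subst (λ z → x ~ g z) (≡.sym (Fin.splitAt-join m n s)) h

  ⋃-below : Symmetric _~_ → ∀ {p} (P : ℕ → Pred A p) (c : ℕ → ℕ) k →
            (∀ i → i ℕ.< k → Enumeration _~_ (P i) (c i)) →
            (∀ {i j x y} → i ℕ.< j → P i x → P j y → ¬ x ~ y) →
            Enumeration _~_ (λ x → ∃[ i ] i ℕ.< k × P i x) (∑[ k ] c)
  ⋃-below ~-sym P c zero    e disj = empty (λ { _ (_ , () , _) })
  ⋃-below ~-sym P c (suc k) e disj = union ~-sym
    (λ (i , i<k , h) → i , ℕ.m<n⇒m<1+n i<k , h) (λ h → k , ℕ.n<1+n k , h)
    (λ (i , i<1+k , h) → [ (λ i<k → inj₁ (i , i<k , h)) , (λ { ≡.refl → inj₂ h }) ]′ (ℕ.m≤n⇒m<n∨m≡n (ℕ.s≤s⁻¹ i<1+k)))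
    (λ (i , i<k , h) → disj i<k h)
    (⋃-below ~-sym P c k (λ i i<k → e i (ℕ.m<n⇒m<1+n i<k)) disj) (e k (ℕ.n<1+n k))

  -- The last hypothesis makes the index `i` an invariant of the class of a point of `Q i`, so the
  -- counts multiply. In the applications `i` is the next digit of a π-adic expansion.
  fibred : ∀ {b s p q m n} {B : Set b} {_≈_ : Rel B s} {I : Pred B p} {P : Pred A q} (Q : B → Pred A q) →
           Enumeration _≈_ I m → (∀ i → I i → Enumeration _~_ (Q i) n) →
           (∀ {i} → I i → Q i ⊆ P) → (∀ {x} → P x → ∃[ i ] I i × Q i x) →
           (∀ {i j x} → i ≈ j → Q i x → Q j x) →
           (∀ {i j x y} → Q i x → Q j y → x ~ y → i ≈ j) →
           Enumeration _~_ P (m ℕ.* n)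
  fibred {m = m} {n} {_≈_ = _≈_} {I} Q e f Q⊆P P⊆Q resp sep = record
    { enum      = g ∘ remQuot n
    ; enum∈     = λ k → let (i , j) = remQuot n k in Q⊆P (enum∈ e i) (enum∈ (f′ i) j)
    ; injective = λ {k} {l} h → ≡.trans (≡.sym (Fin.combine-remQuot {m} n k))
                    (≡.trans (≡.cong (uncurry combine) (inj (remQuot n k) (remQuot n l) h)) (Fin.combine-remQuot {m} n l))
    ; covers    = λ {x} x∈P → let (z , z∈I , h) = P⊆Q x∈P
                                  (i , z≈) = covers e z∈I
                                  (j , x~) = covers (f′ i) (resp z≈ h)
                              in combine i j , ≡.subst (λ ij → x ~ g ij) (≡.sym (Fin.remQuot-combine i j)) x~
    }
    where
    f′ : ∀ i → Enumeration _~_ (Q (enum e i)) n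
    f′ i = f (enum e i) (enum∈ e i)
    g : Fin m × Fin n → A
    g (i , j) = enum (f′ i) j
    inj : ∀ s t → g s ~ g t → s ≡ t
    inj (i , j) (k , l) h with injective e (sep (enum∈ (f′ i) j) (enum∈ (f′ k) l) h)
    ... | ≡.refl = ≡.cong (i ,_) (injective (f′ i) h)

-- Residue classes modulo powers of π

module Residues {ℓ} (F : NonArchimedeanLocalField ℓ) {π} (vπ : NonArchimedeanLocalField.IsUniformizer F π) where
  open NonArchimedeanLocalField F
  open Valuation valuedField
  open Uniformizer vπ
  open IntegerRingSolver commutativeRing
  private module Bij = Bijection residueField-finite

  infix 4 _≡_mod_
  _≡_mod_ : Carrier → Carrier → ℕ → Set
  x ≡ y mod n = n ≼ x - y

  mod-refl : ∀ {x n} → x ≡ x mod n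
  mod-refl = v≥-≈0 (-‿inverseʳ _)

  mod-sym : ∀ {x y n} → x ≡ y mod n → y ≡ x mod n
  mod-sym {x} {y} p = v≥-resp (solve 2 (λ x y → :- (x :- y) := y :- x) refl x y) (v≥-neg p)

  mod-trans : ∀ {x y z n} → x ≡ y mod n → y ≡ z mod n → x ≡ z mod n
  mod-trans {x} {y} {z} p q = v≥-resp (solve 3 (λ x y z → (x :- y) :+ (y :- z) := x :- z) refl x y z) (v≥-+ p q)

  mod-≼ : ∀ {x y n} → x ≡ y mod n → n ≼ y → n ≼ x
  mod-≼ {x} {y} p q = v≥-resp (solve 2 (λ x y → (x :- y) :+ y := x) refl x y) (v≥-+ p q)

  residues : Enumeration (_≡_mod 1) 𝒪 q
  residues = record
    { enum      = λ i → proj₁ (Bij.to i)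
    ; enum∈     = λ i → proj₂ (Bij.to i)
    ; injective = Bij.injective
    ; covers    = λ {x} x∈𝒪 → let (i , h) = Bij.strictlySurjective (x , x∈𝒪) in i , mod-sym {proj₁ (Bij.to i)} {x} h
    }

  q≥1 : 1 ℕ.≤ q
  q≥1 = positive (proj₁ (covers residues {0#} v≥-0))
    where
    positive : ∀ {k} → Fin k → 1 ℕ.≤ k
    positive {suc k} _ = s≤s z≤n

  nonzero-residues : Enumeration (_≡_mod 1) (λ x → v x ≡ [ 0ℤ ]) (q ℕ.∸ 1)
  nonzero-residues = remove residues
    where
    remove : ∀ {n} → Enumeration (_≡_mod 1) 𝒪 n → Enumeration (_≡_mod 1) (λ x → v x ≡ [ 0ℤ ]) (n ℕ.∸ 1)
    remove {zero} e with () ← proj₁ (covers e v≥-0)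
    remove {suc n} e = let (i₀ , 0~) = covers e v≥-0 in record
      { enum      = λ i → enum e (punchIn i₀ i)
      ; enum∈     = λ i → exact (enum∈ e (punchIn i₀ i)) (λ h →
          Fin.punchInᵢ≢i i₀ i (injective e (mod-trans {_} {0#} (v≥-- h v≥-0) 0~)))
      ; injective = λ h → Fin.punchIn-injective i₀ _ _ (injective e h)
      ; covers    = λ {x} vx → let (i , x~) = covers e (≡⇒v≥ vx)
                                   i₀≢i = λ eq → ≡⇒⋠ vx (mod-≼ (≡.subst (λ k → x ≡ enum e k mod 1) (≡.sym eq) x~) (mod-≼ (mod-sym {0#} 0~) v≥-0))
                               in punchOut i₀≢i , ≡.subst (λ k → x ≡ enum e k mod 1) (≡.sym (Fin.punchIn-punchOut i₀≢i)) x~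
      }

  private
    next-digit : ∀ {j x₀ x} → x ≡ x₀ mod j → ∃[ s ] 𝒪 s × x ≡ x₀ + π ^ j * s mod suc j
    next-digit {j} {x₀} {x} h = let (s , s∈ , eq) = divide≼ j h in
      s , s∈ , v≥-≈0 (trans (solve 3 (λ x y z → x :- (y :+ z) := (x :- y) :- z) refl x x₀ (π ^ j * s))
                        (trans (+-congʳ eq) (-‿inverseʳ _)))

    digit-resp : ∀ {j x₀ x s s′} → s ≡ s′ mod 1 → x ≡ x₀ + π ^ j * s mod suc j → x ≡ x₀ + π ^ j * s′ mod suc j
    digit-resp {j} {x₀} {x} {s} {s′} s~ h =
      v≥-resp (solve 5 (λ x y p s u → x :- (y :+ p :* s) :+ p :* (s :- u) := x :- (y :+ p :* u)) refl x x₀ (π ^ j) s s′)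
        (v≥-+ h (≡.subst (_≼ π ^ j * (s - s′)) (ℕ.+-comm j 1) (≼-* (≼-π^ {j}) s~)))

    digit-unique : ∀ {j x₀ x y s s′} → x ≡ x₀ + π ^ j * s mod suc j → y ≡ x₀ + π ^ j * s′ mod suc j →
                   x ≡ y mod suc j → s ≡ s′ mod 1
    digit-unique {j} {x₀} {x} {y} {s} {s′} hx hy h =
      ≼-cancel-π j (≡.subst (_≼ π ^ j * (s - s′)) (ℕ.+-comm 1 j)
        (v≥-resp (solve 6 (λ x y z p s u → (x :- y) :- (x :- (z :+ p :* s)) :+ (y :- (z :+ p :* u)) := p :* (s :- u)) refl x y x₀ (π ^ j) s s′)
          (v≥-+ (v≥-- h hx) hy)))

  coset-enumeration : ∀ n j x₀ → Enumeration (_≡_mod (j ℕ.+ n)) (_≡ x₀ mod j) (q ℕ.^ n)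
  coset-enumeration zero    j x₀ = singleton x₀ (mod-refl {x₀})
    (λ {y} h → ≡.subst (_≼ y - x₀) (≡.sym (ℕ.+-identityʳ j)) h)
  coset-enumeration (suc n) j x₀ = ≡.subst (λ k → Enumeration (_≡_mod k) (_≡ x₀ mod j) (q ℕ.^ suc n)) (≡.sym (ℕ.+-suc j n))
    (fibred (λ s x → x ≡ x₀ + π ^ j * s mod suc j) residues
      (λ s _ → coset-enumeration n (suc j) (x₀ + π ^ j * s))
      (λ {s} s∈ {x} h → v≥-resp (solve 3 (λ x y z → x :- (y :+ z) :+ z := x :- y) refl x x₀ (π ^ j * s))
                          (v≥-+ (≼-mono (ℕ.n≤1+n j) h) (≼-*ʳ (≼-π^ {j}) s∈)))
      next-digit digit-resp
      (λ hx hy h → digit-unique hx hy (≼-mono (s≤s (ℕ.m≤m+n j n)) h)))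

  -- The digit at `π ^ k` runs through the nonzero residues and the next `n` digits are free.
  sphere-enumeration : ∀ n k → Enumeration (_≡_mod (suc k ℕ.+ n)) (λ x → v x ≡ [ + k ]) ((q ℕ.∸ 1) ℕ.* q ℕ.^ n)
  sphere-enumeration n k = fibred (λ s x → x ≡ 0# + π ^ k * s mod suc k) nonzero-residues
      (λ s _ → coset-enumeration n (suc k) (0# + π ^ k * s))
      (λ {s} vs {x} h → exact-resp (solve 2 (λ z x → z :+ (x :- (con (+ 0) :+ z)) := x) refl (π ^ k * s) x)
                          (exact-+ (≡.subst (λ i → v (π ^ k * s) ≡ [ i ]) (≡.cong +_ (ℕ.+-identityʳ k)) (v-*-≡ (vπ^ k) vs)) h))
      (λ {x} vx → let (s , s∈ , h) = next-digit {k} {0#} {x} (v≥-- (≡⇒v≥ vx) v≥-0) in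
        s , exact s∈ (λ s∈𝔪 → ≡⇒⋠ vx (mod-≼ h (v≥-+ v≥-0 (≡.subst (_≼ π ^ k * s) (ℕ.+-comm k 1) (≼-* (≼-π^ {k}) s∈𝔪))))) , h)
      digit-resp
      (λ hx hy h → digit-unique hx hy (≼-mono (s≤s (ℕ.m≤m+n k n)) h))

-- Hermite normal form of lattices in 𝒪ⁿ

module Exponents {ℓ} (K : DiscretelyValuedField ℓ) {π} (vπ : DiscretelyValuedField.IsUniformizer K π) where
  open DiscretelyValuedField K hiding (zero)
  open Valuation K
  open Uniformizer vπ
  open IntegerRingSolver commutativeRing using (solve; con; _:+_; _:*_; _:-_; :-_; _:=_)

  V : ℕ → Set ℓ
  V n = Fin n → Carrier

  record Is𝒪Module {n p} (M : Pred (V n) p) : Set (ℓ ⊔ p) where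
    field
      resp : ∀ {x y} → (∀ i → x i ≈ y i) → M x → M y
      0∈   : M (λ _ → 0#)
      +∈   : ∀ {x y} → M x → M y → M (λ i → x i + y i)
      *∈   : ∀ {a x} → 𝒪 a → M x → M (λ i → a * x i)

    -∈ : ∀ {a x y} → 𝒪 a → M x → M y → M (λ i → x i - a * y i)
    -∈ {a} {x} {y} a∈ x∈ y∈ = resp (λ i → solve 3 (λ a x y → x :+ :- a :* y := x :- a :* y) refl a (x i) (y i)) (+∈ x∈ (*∈ (v≥-neg a∈) y∈))

  Tail : ∀ {n p} → Pred (V (suc n)) p → Pred (V n) p
  Tail M t = M (0# V.∷ t)

  module _ {n p} {M : Pred (V (suc n)) p} (isM : Is𝒪Module M) where
    open Is𝒪Module isM

    ∈-Tail : ∀ {x} → x zero ≈ 0# → M x → Tail M (V.tail x)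
    ∈-Tail x₀≈0 = resp λ { zero → x₀≈0 ; (suc i) → refl }

    isModule-Tail : Is𝒪Module (Tail M)
    isModule-Tail = record
      { resp = λ x≈y → resp λ { zero → refl ; (suc i) → x≈y i }
      ; 0∈   = ∈-Tail refl 0∈
      ; +∈   = λ x∈ y∈ → ∈-Tail (+-identityʳ 0#) (+∈ x∈ y∈)
      ; *∈   = λ {a} a∈ x∈ → ∈-Tail (zeroʳ a) (*∈ a∈ x∈)
      }

  -- The exponents of a lattice M ⊆ 𝒪ⁿ in Hermite normal form.
  HasExponents : ∀ {n p} → Vec ℕ n → Pred (V n) p → Set (ℓ ⊔ p)
  HasExponents {p = p} []       M = Level.Lift (ℓ ⊔ p) ⊤
  HasExponents         (k ∷ ks) M = (∀ {x} → M x → k ≼ x zero) × (∃[ x ] M x × x zero ≈ π ^ k) × HasExponents ks (Tail M)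

  HasExponents-resp : ∀ {n p p′} {M : Pred (V n) p} {M′ : Pred (V n) p′} ks → M ⊆ M′ → M′ ⊆ M → HasExponents ks M → HasExponents ks M′
  HasExponents-resp []       ⊆ ⊇ _ = Level.lift tt
  HasExponents-resp (k ∷ ks) ⊆ ⊇ (bound , (x , x∈ , eq) , rest) = (bound ∘ ⊇) , (x , ⊆ x∈ , eq) , HasExponents-resp ks ⊆ ⊇ rest

  HasExponents-unique : ∀ {n p} {M : Pred (V n) p} ks ls → HasExponents ks M → HasExponents ls M → ks ≡ ls
  HasExponents-unique []       []       _ _ = ≡.refl
  HasExponents-unique (k ∷ ks) (l ∷ ls) (bk , (x , x∈ , xk) , rk) (bl , (y , y∈ , yl) , rl) =
    ≡.cong₂ _∷_ (ℕ.≤-antisym (≼-≡ (exact-resp (sym yl) (vπ^ l)) (bk y∈)) (≼-≡ (exact-resp (sym xk) (vπ^ k)) (bl x∈)))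
      (HasExponents-unique ks ls rk rl)

  -- Membership is tested by clearing one coordinate after the other with the pivots. The length
  -- computation relies on it to find the last multiple of a vector outside `M`.
  HasExponents⇒decidable : ∀ {n p} {M : Pred (V n) p} → Is𝒪Module M → ∀ ks → HasExponents ks M → ∀ z → Dec (M z)
  HasExponents⇒decidable isM [] _ z = yes (Is𝒪Module.resp isM (λ ()) (Is𝒪Module.0∈ isM))
  HasExponents⇒decidable {M = M} isM (k ∷ ks) (bound , (b , b∈ , b₀) , rest) z with k ≼? z zero
  ... | no k⋠ = no (λ z∈ → k⋠ (bound z∈))
  ... | yes k≼ = let (c , c∈ , z₀≈) = divide≼ k k≼ in
    map′ (λ h → resp (λ i → solve 3 (λ z c b → z :- c :* b :+ c :* b := z) refl (z i) c (b i))
                  (+∈ (resp (λ { zero → sym (head≈0 c z₀≈) ; (suc i) → refl }) h) (*∈ c∈ b∈)))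
         (λ z∈ → ∈-Tail isM (head≈0 c z₀≈) (-∈ c∈ z∈ b∈))
         (HasExponents⇒decidable (isModule-Tail isM) ks rest (λ i → z (suc i) - c * b (suc i)))
    where
    open Is𝒪Module isM
    head≈0 : ∀ c → z zero ≈ π ^ k * c → z zero - c * b zero ≈ 0#
    head≈0 c z₀≈ = trans (+-cong z₀≈ (-‿cong (*-congˡ b₀))) (solve 2 (λ p c → p :* c :- c :* p := con (+ 0)) refl (π ^ k) c)

  private
    monic-multiple : ∀ {h k} → v h ≡ [ + k ] → ∃[ w ] 𝒪 w × w * h ≈ π ^ k
    monic-multiple {h} {k} vh =
      let (u , hu≈1 , vu) = inverse vh
      in π ^ k * u , v≥-resp refl (≡.subst (λ i → v≥ i (π ^ k * u)) (ℤ.+-inverseʳ (+ k)) (v≥-* (≼-π^ {k}) (≡⇒v≥ vu)))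
       , trans (*-assoc (π ^ k) u h) (trans (*-congˡ (trans (*-comm u h) hu≈1)) (*-identityʳ _))
      where import Data.Integer.Properties as ℤ

  -- Adjoining to M a vector x ∉ M with πx ∈ M lowers one exponent by one.
  adjoin-exponents : ∀ {n p p′} {M : Pred (V n) p} {P : Pred (V n) p′} (ks : Vec ℕ n) → Is𝒪Module M → Is𝒪Module P →
    (∀ {z} → P z → ∀ i → 𝒪 (z i)) → M ⊆ P → ∀ x → P x → ¬ M x → M (λ i → π * x i) →
    (∀ {z} → P z → ∃[ c ] 𝒪 c × M (λ i → z i - c * x i)) →
    HasExponents ks M → ∃[ ls ] HasExponents ls P × Vec.sum ks ≡ suc (Vec.sum ls)
  adjoin-exponents [] isM isP int M⊆P x x∈ x∉ _ _ _ = contradiction (Is𝒪Module.resp isM (λ ()) (Is𝒪Module.0∈ isM)) x∉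
  adjoin-exponents {M = M} {P} (k ∷ ks) isM isP int M⊆P x x∈ x∉ πx∈ gen (bound , (b , b∈ , b₀) , rest) with k ≼? x zero
  -- The pivot stays. Modulo `M` the vector `x - c b` generates the same enlargement, and its first
  -- coordinate is zero, so the drop takes place in the tail.
  ... | yes k≼ =
    let (c , c∈ , x₀≈) = divide≼ k k≼
        x′ : V _
        x′ i = x i - c * b i
        x′₀≈0 : x′ zero ≈ 0#
        x′₀≈0 = trans (+-cong x₀≈ (-‿cong (*-congˡ b₀))) (solve 2 (λ p c → p :* c :- c :* p := con (+ 0)) refl (π ^ k) c)
        x′∈P = IP.-∈ c∈ x∈ (M⊆P b∈)
        (ls , exps , eq) = adjoin-exponents ks (isModule-Tail isM) (isModule-Tail isP) (λ z∈ i → int z∈ (suc i)) M⊆P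
          (V.tail x′) (∈-Tail isP x′₀≈0 x′∈P)
          (λ x′∈M → x∉ (IM.resp (λ { zero → trans (+-congʳ (sym x′₀≈0)) (back c zero) ; (suc i) → back c (suc i) }) (IM.+∈ x′∈M (IM.*∈ c∈ b∈))))
          (∈-Tail isM (trans (*-congˡ x′₀≈0) (zeroʳ π)) (IM.resp (λ i → solve 4 (λ p x c b → p :* x :- (p :* c) :* b := p :* (x :- c :* b)) refl π (x i) c (b i))
            (IM.-∈ (≼-*ˡ 𝒪-π c∈) πx∈ b∈)))
          (λ {z} z∈ → let (d , d∈ , m∈) = gen z∈ in d , d∈ ,
            ∈-Tail isM (m₀ c x′₀≈0 d) (shift {c} {d} {0# V.∷ z} c∈ m∈ d∈))
          rest
    in k ∷ ls , ((λ {z} z∈ → bound-P {z} k≼ (gen z∈)) , (b , M⊆P b∈ , b₀) , exps) , ≡.trans (≡.cong (k ℕ.+_) eq) (ℕ.+-suc k _)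
    where
    module IM = Is𝒪Module isM
    module IP = Is𝒪Module isP
    𝒪-π : 𝒪 π
    𝒪-π = v≥-mono (ℤ.+≤+ z≤n) (≡⇒v≥ vπ)
    back : ∀ c i → x i - c * b i + c * b i ≈ x i
    back c i = solve 3 (λ x c b → x :- c :* b :+ c :* b := x) refl (x i) c (b i)
    bound-P : ∀ {z} → k ≼ x zero → ∃[ c ] 𝒪 c × M (λ i → z i - c * x i) → k ≼ z zero
    bound-P {z} k≼ (d , d∈ , m∈) = v≥-resp (solve 3 (λ z d x → z :- d :* x :+ d :* x := z) refl (z zero) d (x zero)) (v≥-+ (bound m∈) (≼-*ˡ d∈ k≼))
    m₀ : ∀ c → x zero - c * b zero ≈ 0# → ∀ d → 0# - d * (x zero - c * b zero) ≈ 0#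
    m₀ c e d = trans (+-congˡ (-‿cong (trans (*-congˡ e) (zeroʳ d)))) (-‿inverseʳ 0#)
    shift : ∀ {c d z} → 𝒪 c → M (λ i → z i - d * x i) → 𝒪 d → M (λ i → z i - d * (x i - c * b i))
    shift {c} {d} {z} c∈ m∈ d∈ = IM.resp (λ i → solve 5 (λ z d x c b → (z :- d :* x) :- (:- d :* c) :* b := z :- d :* (x :- c :* b)) refl (z i) d (x i) c (b i))
      (IM.-∈ (≼-*ˡ (v≥-neg d∈) c∈) m∈ b∈)
  ... | no k⋠ with ≼-or-exact k (int x∈ zero)
  ...   | inj₁ k≼ = contradiction k≼ k⋠
  -- The pivot drops to `j`, and `πx ∈ M` forces `k = j + 1`. The tails agree: in an element
  -- `m + d x` of the tail, `k ≼ d x₀` makes `d` divisible by π, so `d x` is already in `M`.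
  ...   | inj₂ (j , j<k , vx₀) =
    let (u , u∈ , ux₀) = monic-multiple vx₀
    in j ∷ ks , ((λ {z} z∈ → bound-P {z} (gen z∈)) , (_ , IP.*∈ u∈ x∈ , ux₀) , HasExponents-resp ks M⊆P tail-P⊆M rest) , ≡.cong (ℕ._+ Vec.sum ks) k≡1+j
    where
    module IM = Is𝒪Module isM
    module IP = Is𝒪Module isP
    k≡1+j : k ≡ suc j
    k≡1+j = ℕ.≤-antisym (≼-≡ (v-*-≡ vπ vx₀) (bound πx∈)) j<k
    bound-P : ∀ {z} → ∃[ c ] 𝒪 c × M (λ i → z i - c * x i) → j ≼ z zero
    bound-P {z} (d , d∈ , m∈) = v≥-resp (solve 3 (λ z d x → z :- d :* x :+ d :* x := z) refl (z zero) d (x zero))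
      (v≥-+ (≼-mono (ℕ.<⇒≤ j<k) (bound m∈)) (≼-*ˡ d∈ (≡⇒v≥ vx₀)))
    tail-P⊆M : Tail P ⊆ Tail M
    tail-P⊆M {t} t∈ =
      let (d , d∈ , m∈) = gen t∈
          k≼dx₀ : k ≼ x zero * d
          k≼dx₀ = v≥-resp (solve 2 (λ x d → :- (con (+ 0) :- d :* x) := x :* d) refl (x zero) d) (v≥-neg (bound m∈))
          1≼d = ≼-cancelˡ vx₀ (≡.subst (_≼ x zero * d) (≡.trans k≡1+j (ℕ.+-comm 1 j)) k≼dx₀)
          (e , e∈ , d≈) = divide≼ 1 1≼d
      in IM.resp (λ i → trans (+-congˡ (trans (sym (*-assoc e π (x i))) (*-congʳ (trans (*-comm e π) (trans (*-congʳ (sym (*-identityʳ π))) (sym d≈))))))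
                           (solve 3 (λ z d x → (z :- d :* x) :+ d :* x := z) refl ((0# V.∷ t) i) d (x i)))
           (IM.+∈ m∈ (IM.*∈ e∈ πx∈))

  -- Membership is recursive in the list, with one integral multiple subtracted per generator; so
  -- `reduce-span` can follow the elimination of a coordinate by induction.
  Span : ∀ {n} → List (V n) → Pred (V n) ℓ
  Span []       x = ∀ i → x i ≈ 0#
  Span (g ∷ gs) x = ∃[ c ] 𝒪 c × Span gs (λ i → x i - c * g i)

  Span-resp : ∀ {n} (gs : List (V n)) {x y} → (∀ i → x i ≈ y i) → Span gs x → Span gs y
  Span-resp []       x≈y x≈0          i = trans (sym (x≈y i)) (x≈0 i)
  Span-resp (g ∷ gs) x≈y (c , c∈ , s) = c , c∈ , Span-resp gs (λ i → +-congʳ (x≈y i)) s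

  private
    least : ∀ {n p} {M : Pred (V (suc n)) p} (gs : List (V (suc n))) → All M gs → All (λ g → 𝒪 (g zero)) gs →
            All (λ g → g zero ≈ 0#) gs ⊎ (∃[ k ] ∃[ g ] M g × v (g zero) ≡ [ + k ] × All (λ g → k ≼ g zero) gs)
    least [] _ _ = inj₁ []
    least (g ∷ gs) (g∈ ∷ gs∈) (i ∷ is) with least gs gs∈ is | zero? (g zero)
    ... | inj₁ zs | inj₁ z = inj₁ (z ∷ zs)
    ... | inj₁ zs | inj₂ (ℤ.+ n , eq) = inj₂ (n , g , g∈ , eq , ≡⇒v≥ eq ∷ All.map v≥-≈0 zs)
    ... | inj₁ zs | inj₂ (ℤ.-[1+ _ ] , eq) with ≤[ () ] ← ≡.subst ([ 0ℤ ] ≤∞_) eq i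
    ... | inj₂ (k , h , h∈ , vh , ks) | _ with ≼-or-exact k i
    ...   | inj₁ k≼ = inj₂ (k , h , h∈ , vh , k≼ ∷ ks)
    ...   | inj₂ (j , j<k , eq) = inj₂ (j , g , g∈ , eq , ≡⇒v≥ eq ∷ All.map (≼-mono (ℕ.<⇒≤ j<k)) ks)

    span-head : ∀ {n k} (gs : List (V (suc n))) → All (λ g → k ≼ g zero) gs → ∀ {x} → Span gs x → k ≼ x zero
    span-head []       []       x≈0          = v≥-≈0 (x≈0 zero)
    span-head (g ∷ gs) (k≼ ∷ ks) {x} (c , c∈ , s) =
      v≥-resp (solve 3 (λ x c g → (x :- c :* g) :+ c :* g := x) refl (x zero) c (g zero)) (v≥-+ (span-head gs ks s) (≼-*ˡ c∈ k≼))

    module Reduction {n} k (b : V (suc n)) (b₀ : b zero ≈ π ^ k) where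
      π⁻ᵏ : Carrier
      π⁻ᵏ = proj₁ (inverse (vπ^ k))

      π⁻ᵏπᵏ : π⁻ᵏ * π ^ k ≈ 1#
      π⁻ᵏπᵏ = trans (*-comm π⁻ᵏ (π ^ k)) (proj₁ (proj₂ (inverse (vπ^ k))))

      reduce : V (suc n) → V (suc n)
      reduce x i = x i - π⁻ᵏ * x zero * b i

      reduce-head : ∀ x → reduce x zero ≈ 0#
      reduce-head x = trans (+-congˡ (-‿cong (trans (*-congˡ b₀) (trans (solve 3 (λ p x q → p :* x :* q := (p :* q) :* x) refl π⁻ᵏ (x zero) (π ^ k))
        (trans (*-congʳ π⁻ᵏπᵏ) (*-identityˡ (x zero))))))) (-‿inverseʳ (x zero))

      coefficient-𝒪 : ∀ {x : V (suc n)} → k ≼ x zero → 𝒪 (π⁻ᵏ * x zero)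
      coefficient-𝒪 {x} k≼ = quotient-integral (vπ^ k) (proj₁ (proj₂ (inverse (vπ^ k)))) (≡.subst (λ i → i ≤∞ v (x zero)) (≡.sym (vπ^ k)) k≼)

      reduce-span : ∀ gs {x} → Span gs x → Span (List.map (V.tail ∘ reduce) gs) (V.tail (reduce x))
      reduce-span []       {x} x≈0 i = trans (+-cong (x≈0 (suc i)) (-‿cong (trans (*-congʳ (trans (*-congˡ (x≈0 zero)) (zeroʳ π⁻ᵏ))) (zeroˡ (b (suc i))))))
                                         (-‿inverseʳ 0#)
      reduce-span (g ∷ gs) {x} (c , c∈ , s) = c , c∈ , Span-resp (List.map (V.tail ∘ reduce) gs)
        (λ i → solve 7 (λ x c g p x₀ g₀ b → (x :- c :* g) :- p :* (x₀ :- c :* g₀) :* b := (x :- p :* x₀ :* b) :- c :* (g :- p :* g₀ :* b)) refl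
                 (x (suc i)) c (g (suc i)) π⁻ᵏ (x zero) (g zero) (b (suc i)))
        (reduce-span gs s)

      reduce-tail : ∀ t i → V.tail (reduce (0# V.∷ t)) i ≈ t i
      reduce-tail t i = solve 3 (λ t p b → t :- p :* con (+ 0) :* b := t) refl (t i) π⁻ᵏ (b (suc i))

  -- Gaussian elimination over a valuation ring: a generator with first coordinate of least
  -- valuation is the pivot, and clearing the other generators with it yields generators of the
  -- tail.
  exponents : ∀ {n p} {M : Pred (V n) p} → Is𝒪Module M → (∀ {z} → M z → ∀ i → 𝒪 (z i)) →
    ∀ e → (∀ z → (∀ i → e ≼ z i) → M z) → (gs : List (V n)) → All M gs → M ⊆ Span gs → ∃[ ks ] HasExponents ks M
  exponents {zero} isM int e full gs gs∈ span = [] , Level.lift tt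
  exponents {suc n} {M = M} isM int e full gs gs∈ span with least gs gs∈ (All.map (λ g∈ → int g∈ zero) gs∈)
  -- If all generators had first coordinate zero, so would the vector with all entries `π ^ e`,
  -- which lies in `M`.
  ... | inj₁ zs = contradiction (span-head gs (All.map v≥-≈0 zs) (span (full (λ _ → π ^ e) (λ _ → ≼-π^ {e})))) (≡⇒⋠ (vπ^ e))
  ... | inj₂ (k , g , g∈ , vg , k≼gs) =
    let (u , u∈ , ug₀) = monic-multiple vg
        b∈ = *∈ u∈ g∈
        open Reduction k (λ i → u * g i) ug₀
        (ks , rest) = exponents (isModule-Tail isM) (λ z∈ i → int z∈ (suc i)) e
          (λ z e≼ → full (0# V.∷ z) λ { zero → v≥-0 ; (suc i) → e≼ i })
          (List.map (V.tail ∘ reduce) gs)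
          (All.map⁺ (All.zipWith (λ {h} (k≼ , h∈) → ∈-Tail isM (reduce-head h) (-∈ (coefficient-𝒪 {h} k≼) h∈ b∈)) (k≼gs , gs∈)))
          (λ {t} t∈ → Span-resp (List.map (V.tail ∘ reduce) gs) (reduce-tail t) (reduce-span gs (span t∈)))
    in k ∷ ks , (λ z∈ → span-head gs k≼gs (span z∈)) , (_ , b∈ , ug₀) , rest
    where open Is𝒪Module isM

-- The lattices L a b β: stability and homothety

module Lattices {ℓ} (F : NonArchimedeanLocalField ℓ) (E′ : UnramifiedQuadraticExtension F)
                {π} (vπ : NonArchimedeanLocalField.IsUniformizer F π) (generator : IntegralGenerator F E′) where
  open NonArchimedeanLocalField F hiding (zero)
  open Valuation valuedField
  open Uniformizer vπ
  open IntegerRingSolver commutativeRing using (solve; con; _:+_; _:*_; _:-_; :-_; _:=_)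
  module E = UnramifiedQuadraticExtension E′
  module VE = Valuation E.valuedField
  open E using (ι; ι-homomorphism; ι-𝒪)
  open IntegralGenerator generator
  open Orders F E′ using (𝒪ᴱ; diagonal; Δ𝔬; ΔF) renaming (E to 𝔼ring)
  module 𝔼 = CommutativeRing 𝔼ring
  private module SE = IntegerRingSolver E.commutativeRing

  𝔼 : Set ℓ
  𝔼 = 𝔼.Carrier

  at-cong : ∀ {x y x′ y′} → x ≈ x′ → y ≈ y′ → at x y E.≈ at x′ y′
  at-cong p q = E.+-cong (ι-cong F E′ p) (E.*-congʳ (ι-cong F E′ q))

  at-+ : ∀ x y x′ y′ → at x y E.+ at x′ y′ E.≈ at (x + x′) (y + y′)
  at-+ x y x′ y′ = E.sym (E.trans (E.+-cong (ι-+ F E′ x x′) (E.*-congʳ (ι-+ F E′ y y′)))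
    (SE.solve 5 (λ x y x′ y′ o → (x SE.:+ x′) SE.:+ (y SE.:+ y′) SE.:* o SE.:= (x SE.:+ y SE.:* o) SE.:+ (x′ SE.:+ y′ SE.:* o))
      E.refl (ι x) (ι y) (ι x′) (ι y′) ω))

  at-neg : ∀ x y → E.- at x y E.≈ at (- x) (- y)
  at-neg x y = E.sym (E.trans (E.+-cong (ι-neg F E′ x) (E.*-congʳ (ι-neg F E′ y)))
    (SE.solve 3 (λ x y o → SE.:- x SE.:+ SE.:- y SE.:* o SE.:= SE.:- (x SE.:+ y SE.:* o)) E.refl (ι x) (ι y) ω))

  at-* : ∀ x y x′ y′ → at x y E.* at x′ y′ E.≈ at (x * x′ - n * (y * y′)) (x * y′ + y * x′ + t * (y * y′))
  at-* x y x′ y′ = E.sym (begin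
    _ ≈⟨ E.+-cong (E.trans (ι-- F E′ _ _) (E.+-cong (ι-* F E′ _ _) (E.-‿cong (E.trans (ι-* F E′ _ _) (E.*-congˡ (ι-* F E′ _ _))))))
           (E.*-congʳ (E.trans (ι-+ F E′ _ _) (E.+-cong (E.trans (ι-+ F E′ _ _) (E.+-cong (ι-* F E′ _ _) (ι-* F E′ _ _)))
              (E.trans (ι-* F E′ _ _) (E.*-congˡ (ι-* F E′ _ _)))))) ⟩
    _ ≈⟨ SE.solve 7 (λ x y x′ y′ t n o →
           (x SE.:* x′ SE.:- n SE.:* (y SE.:* y′)) SE.:+ (x SE.:* y′ SE.:+ y SE.:* x′ SE.:+ t SE.:* (y SE.:* y′)) SE.:* o
           SE.:= x SE.:* x′ SE.:+ (x SE.:* y′ SE.:+ y SE.:* x′) SE.:* o SE.:+ (y SE.:* y′) SE.:* (t SE.:* o SE.:- n))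
           E.refl (ι x) (ι y) (ι x′) (ι y′) (ι t) (ι n) ω ⟩
    _ ≈⟨ E.+-congˡ (E.*-congˡ ω²) ⟨
    _ ≈⟨ SE.solve 5 (λ x y x′ y′ o → x SE.:* x′ SE.:+ (x SE.:* y′ SE.:+ y SE.:* x′) SE.:* o SE.:+ (y SE.:* y′) SE.:* (o SE.:* o)
           SE.:= (x SE.:+ y SE.:* o) SE.:* (x′ SE.:+ y′ SE.:* o)) E.refl (ι x) (ι y) (ι x′) (ι y′) ω ⟩
    _ ∎)
    where open SetoidReasoning E.setoid

  at-scale : ∀ a x y → ι a E.* at x y E.≈ at (a * x) (a * y)
  at-scale a x y = E.sym (E.trans (E.+-cong (ι-* F E′ a x) (E.*-congʳ (ι-* F E′ a y)))
    (SE.solve 4 (λ a x y o → a SE.:* x SE.:+ (a SE.:* y) SE.:* o SE.:= a SE.:* (x SE.:+ y SE.:* o)) E.refl (ι a) (ι x) (ι y) ω))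

  at-1 : E.1# E.≈ at 1# 0#
  at-1 = E.sym (E.trans (E.+-cong (ι-1 F E′) (E.trans (E.*-congʳ (ι-0 F E′)) (E.zeroˡ ω))) (E.+-identityʳ _))

  at-0 : E.0# E.≈ at 0# 0#
  at-0 = E.sym (E.trans (E.+-cong (ι-0 F E′) (E.trans (E.*-congʳ (ι-0 F E′)) (E.zeroˡ ω))) (E.+-identityʳ _))

  at-injective : ∀ {x y x′ y′} → at x y E.≈ at x′ y′ → x ≈ x′ × y ≈ y′
  at-injective {x} {y} {x′} {y′} eq = lemma (proj₁ (at≈0 difference)) , lemma (proj₂ (at≈0 difference))
    where
    open SetoidReasoning E.setoid
    difference : at (x - x′) (y - y′) E.≈ E.0#
    difference = begin
      at (x - x′) (y - y′)           ≈⟨ at-+ x y (- x′) (- y′) ⟨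
      at x y E.+ at (- x′) (- y′)    ≈⟨ E.+-congˡ (at-neg x′ y′) ⟨
      at x y E.- at x′ y′            ≈⟨ E.+-congʳ eq ⟩
      at x′ y′ E.- at x′ y′          ≈⟨ E.-‿inverseʳ _ ⟩
      E.0#                           ∎
    lemma : ∀ {x y} → x - y ≈ 0# → x ≈ y
    lemma {x} {y} p = trans (solve 2 (λ x y → x := (x :- y) :+ y) refl x y) (trans (+-congʳ p) (+-identityˡ y))

  𝒪-at : ∀ {x y} → 𝒪 x → 𝒪 y → E.𝒪 (at x y)
  𝒪-at x∈ y∈ = VE.v≥-+ (ι-integral F E′ x∈) (VE.≼-*ˡ (ι-integral F E′ y∈) ω-𝒪)

  ι≈at : ∀ x → ι x E.≈ at x 0#
  ι≈at x = E.sym (E.trans (E.+-congˡ (E.trans (E.*-congʳ (ι-0 F E′)) (E.zeroˡ ω))) (E.+-identityʳ _))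

  ι^≈at : ∀ k → ι π E.^ k E.≈ at (π ^ k) 0#
  ι^≈at zero    = at-1
  ι^≈at (suc k) = E.trans (E.*-congˡ (ι^≈at k)) (E.trans (at-scale π (π ^ k) 0#) (at-cong refl (zeroʳ π)))

  L : ℕ → ℕ → Carrier → Pred 𝔼 ℓ
  L a b β (x , w) = ∃[ y ] ∃[ s ] 𝒪 y × 𝒪 s × w E.≈ at y (π ^ b * s) × a ≼ x - (y + β * s)

  -- the norm of β - πᵇω
  N : ℕ → Carrier → Carrier
  N b β = β * β - t * (β * π ^ b) + n * (π ^ b * π ^ b)

  ≼-N : ∀ {k b β} → k ≼ β → k ℕ.≤ b → k ℕ.+ k ≼ N b β
  ≼-N {k} {b} k≼β k≤b = v≥-+ (v≥-- (≼-* k≼β k≼β) (≼-*ˡ t-𝒪 (≼-* k≼β k≼πᵇ))) (≼-*ˡ n-𝒪 (≼-* k≼πᵇ k≼πᵇ))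
    where
    k≼πᵇ : k ≼ π ^ b
    k≼πᵇ = ≼-mono k≤b (≼-π^ {b})

  -- Under these hypotheses `k` is the minimum of `v β` and `b`. Dividing both arguments of the norm
  -- form by `π ^ k` leaves a primitive pair, whose norm is a unit by anisotropy.
  v-N : ∀ {k b β} → k ≼ β → k ℕ.≤ b → v β ≡ [ + k ] ⊎ b ≡ k → v (N b β) ≡ [ + (k ℕ.+ k) ]
  v-N {k} {b} {β} k≼β k≤b prim =
    let (γ , γ∈ , β≈) = divide≼ k k≼β
        δ = π ^ (b ℕ.∸ k)
        πᵇ≈ : π ^ b ≈ π ^ k * δ
        πᵇ≈ = trans (reflexive (≡.cong (π ^_) (≡.sym (ℕ.m+[n∸m]≡n k≤b)))) (π^-+ k (b ℕ.∸ k))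
        unit : v γ ≡ [ 0ℤ ] ⊎ v (- δ) ≡ [ 0ℤ ]
        unit = [ (λ vβ → inj₁ (exact γ∈ (λ h → ≡⇒⋠ vβ (v≥-resp (sym β≈) (≡.subst (_≼ π ^ k * γ) (ℕ.+-comm k 1) (≼-* (≼-π^ {k}) h))))))
               , (λ { ≡.refl → inj₂ (exact-resp (trans (*-congˡ (reflexive (≡.cong (π ^_) (≡.sym (ℕ.n∸n≡0 b))))) (solve 1 (λ x → :- con (+ 1) :* x := :- x) refl (π ^ (b ℕ.∸ b))))
                                  (v-*-≡ v-1 v1)) }) ]′ prim
    in exact-resp (begin
          π ^ k * π ^ k * norm γ (- δ)
            ≈⟨ solve 5 (λ p g d t n → p :* p :* (g :* g :+ t :* g :* (:- d) :+ n :* (:- d) :* (:- d))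
                 := (p :* g) :* (p :* g) :- t :* ((p :* g) :* (p :* d)) :+ n :* ((p :* d) :* (p :* d))) refl (π ^ k) γ δ t n ⟩
          _ ≈⟨ +-cong (+-cong (*-cong β≈ β≈) (-‿cong (*-congˡ (*-cong β≈ πᵇ≈)))) (*-congˡ (*-cong πᵇ≈ πᵇ≈)) ⟨
          N b β ∎)
        (≡.trans (v-*-≡ (v-*-≡ (vπ^ k) (vπ^ k)) (anisotropic γ∈ (v≥-neg (𝒪-π^ {b ℕ.∸ k})) unit)) (≡.cong [_] (ℤ.+-identityʳ _)))
    where open SetoidReasoning setoid

  module _ {a b : ℕ} {β : Carrier} where

    L-resp : ∀ {z z′} → z 𝔼.≈ z′ → L a b β z → L a b β z′
    L-resp (x≈ , w≈) (y , s , y∈ , s∈ , eq , p) = y , s , y∈ , s∈ , E.trans (E.sym w≈) eq , v≥-resp (+-congʳ x≈) p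

    L-0 : L a b β 𝔼.0#
    L-0 = 0# , 0# , v≥-0 , v≥-0 , E.trans at-0 (at-cong refl (sym (zeroʳ (π ^ b)))) ,
      v≥-≈0 (solve 1 (λ β → con (+ 0) :- (con (+ 0) :+ β :* con (+ 0)) := con (+ 0)) refl β)

    L-+ : ∀ {z z′} → L a b β z → L a b β z′ → L a b β (z 𝔼.+ z′)
    L-+ {x , _} {x′ , _} (y , s , y∈ , s∈ , eq , p) (y′ , s′ , y′∈ , s′∈ , eq′ , p′) =
      y + y′ , s + s′ , v≥-+ y∈ y′∈ , v≥-+ s∈ s′∈ ,
      E.trans (E.+-cong eq eq′) (E.trans (at-+ y _ y′ _) (at-cong refl (sym (distribˡ (π ^ b) s s′)))) ,
      v≥-resp (solve 7 (λ x y s x′ y′ s′ β → (x :- (y :+ β :* s)) :+ (x′ :- (y′ :+ β :* s′)) := (x :+ x′) :- ((y :+ y′) :+ β :* (s :+ s′)))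
        refl x y s x′ y′ s′ β) (v≥-+ p p′)

    L-scale : ∀ {c z} → 𝒪 c → L a b β z → L a b β (diagonal c 𝔼.* z)
    L-scale {c} {x , _} c∈ (y , s , y∈ , s∈ , eq , p) =
      c * y , c * s , ≼-*ˡ c∈ y∈ , ≼-*ˡ c∈ s∈ ,
      E.trans (E.*-congˡ eq) (E.trans (at-scale c y _) (at-cong refl (solve 3 (λ c p s → c :* (p :* s) := p :* (c :* s)) refl c (π ^ b) s))) ,
      v≥-resp (solve 5 (λ c x y s β → c :* (x :- (y :+ β :* s)) := c :* x :- (c :* y :+ β :* (c :* s))) refl c x y s β) (≼-*ˡ c∈ p)

    L-1 : L a b β 𝔼.1#
    L-1 = 1# , 0# , 𝒪-1 , v≥-0 , E.trans at-1 (at-cong refl (sym (zeroʳ (π ^ b)))) ,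
      v≥-≈0 (solve 1 (λ β → con (+ 1) :- (con (+ 1) :+ β :* con (+ 0)) := con (+ 0)) refl β)

    L-θ : L a b β (β , at 0# (π ^ b))
    L-θ = 0# , 1# , v≥-0 , 𝒪-1 , at-cong refl (sym (*-identityʳ (π ^ b))) ,
      v≥-≈0 (solve 1 (λ β → β :- (con (+ 0) :+ β :* con (+ 1)) := con (+ 0)) refl β)

    L-ε : ∀ {x} → a ≼ x → L a b β (x , E.0#)
    L-ε {x} a≼x = 0# , 0# , v≥-0 , v≥-0 , E.trans at-0 (at-cong refl (sym (zeroʳ (π ^ b)))) ,
      v≥-resp (solve 2 (λ x β → x := x :- (con (+ 0) :+ β :* con (+ 0))) refl x β) a≼x

    L-at : ∀ {x y s} → L a b β (x , at y (π ^ b * s)) → 𝒪 y × 𝒪 s × a ≼ x - (y + β * s)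
    L-at {x} {y} {s} (y′ , s′ , y′∈ , s′∈ , eq , p) =
      let (y≈ , πs≈) = at-injective eq
          s≈ = *-cancelˡ-nz (vπ^ b) πs≈
      in v≥-resp (sym y≈) y′∈ , v≥-resp (sym s≈) s′∈ , v≥-resp (+-congˡ (-‿cong (+-cong (sym y≈) (*-congˡ (sym s≈))))) p

    L-b : ∀ {x y w} → L a b β (x , at y w) → b ≼ w
    L-b (y′ , s′ , y′∈ , s′∈ , eq , p) = v≥-resp (sym (proj₂ (at-injective eq))) (≼-*ʳ (≼-π^ {b}) s′∈)

  L⊆𝒪ᴱ : ∀ {a b β} → 𝒪 β → ∀ {z} → L a b β z → 𝒪ᴱ z
  L⊆𝒪ᴱ {a} {b} {β} β∈ {x , w} (y , s , y∈ , s∈ , eq , p) =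
    v≥-resp (solve 2 (λ x u → (x :- u) :+ u := x) refl x (y + β * s)) (v≥-+ (≼⇒𝒪 {a} p) (v≥-+ y∈ (≼-*ˡ β∈ s∈))) ,
    VE.v≥-resp (E.sym eq) (𝒪-at y∈ (≼-*ˡ (𝒪-π^ {b}) s∈))

  -- The sublattice L a b β is stable under the order L f c r.
  record Stable (f c : ℕ) (r : Carrier) (a b : ℕ) (β : Carrier) : Set where
    field
      b≤c       : b ℕ.≤ c
      a≤f       : a ℕ.≤ f
      congruent : a ≼ π ^ (c ℕ.∸ b) * β - r
      norm-≼    : a ≼ π ^ (c ℕ.∸ b) * N b β

  module _ {f c : ℕ} {r : Carrier} {a b : ℕ} {β : Carrier} where

    stable⇒ : 𝒪 β → Stable f c r a b β → ∀ {ρ z} → L f c r ρ → L a b β z → L a b β (ρ 𝔼.* z)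
    stable⇒ β∈ st {ρ , _} {z , _} (p , q , p∈ , q∈ , eq , h) (y , s , y∈ , s∈ , eq′ , h′) =
      p * y - n * (π ^ c * q * (π ^ b * s)) , p * s + d * q * y + t * (π ^ c * q * s) ,
      v≥-- (≼-*ˡ p∈ y∈) (≼-*ˡ n-𝒪 (≼-*ˡ (≼-*ˡ (𝒪-π^ {c}) q∈) (≼-*ˡ (𝒪-π^ {b}) s∈))) ,
      v≥-+ (v≥-+ (≼-*ˡ p∈ s∈) (≼-*ˡ (≼-*ˡ (𝒪-π^ {c ℕ.∸ b}) q∈) y∈)) (≼-*ˡ t-𝒪 (≼-*ˡ (≼-*ˡ (𝒪-π^ {c}) q∈) s∈)) ,
      E.trans (E.*-cong eq eq′) (E.trans (at-* p _ y _) (at-cong refl (trans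
        (+-congʳ (+-congˡ (*-congʳ (*-congʳ πᶜ≈))))
        (solve 8 (λ p b s d q y t c → p :* (b :* s) :+ (b :* d) :* q :* y :+ t :* (c :* q :* (b :* s)) := b :* (p :* s :+ d :* q :* y :+ t :* (c :* q :* s)))
           refl p (π ^ b) s d q y t (π ^ c))))) ,
      -- The defect of the product is a combination of the defects of the two factors, of
      -- `d * N b β` and of `d * β - r`. Each is divisible by πᵃ, the defect of the element of the
      -- order because of `a ≤ f`.
      v≥-resp (begin
          (ρ - (p + r * q)) * z + ((p + r * q) * (z - (y + β * s)) + (q * s * (d * N b β) - (q * y + q * s * β) * (d * β - r)))
            ≈⟨ solve 12 (λ ρ p r q z y β s d t n b →
                 (ρ :- (p :+ r :* q)) :* z :+ ((p :+ r :* q) :* (z :- (y :+ β :* s)) :+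
                    (q :* s :* (d :* (β :* β :- t :* (β :* b) :+ n :* (b :* b))) :- (q :* y :+ q :* s :* β) :* (d :* β :- r)))
                 := ρ :* z :- (p :* y :- n :* (b :* d :* q :* (b :* s)) :+ β :* (p :* s :+ d :* q :* y :+ t :* (b :* d :* q :* s))))
                 refl ρ p r q z y β s d t n (π ^ b) ⟩
          ρ * z - (p * y - n * (π ^ b * d * q * (π ^ b * s)) + β * (p * s + d * q * y + t * (π ^ b * d * q * s)))
            ≈⟨ +-congˡ (-‿cong (+-cong (+-congˡ (-‿cong (*-congˡ (*-congʳ (*-congʳ πᶜ≈))))) (*-congˡ (+-congˡ (*-congˡ (*-congʳ (*-congʳ πᶜ≈))))))) ⟨
          _ ∎)
        (v≥-+ (≼-*ʳ (≼-mono a≤f h) z∈) (v≥-+ (≼-*ˡ pr∈ h′) (v≥-- (≼-*ˡ (≼-*ˡ q∈ s∈) norm-≼) (≼-*ˡ (v≥-+ (≼-*ˡ q∈ y∈) (≼-*ˡ (≼-*ˡ q∈ s∈) β∈)) congruent))))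
      where
      open Stable st
      open SetoidReasoning setoid
      d = π ^ (c ℕ.∸ b)
      πᶜ≈ : π ^ c ≈ π ^ b * d
      πᶜ≈ = trans (reflexive (≡.cong (π ^_) (≡.sym (ℕ.m+[n∸m]≡n b≤c)))) (π^-+ b (c ℕ.∸ b))
      z∈ : 𝒪 z
      z∈ = v≥-resp (solve 2 (λ x u → (x :- u) :+ u := x) refl z (y + β * s)) (v≥-+ (≼⇒𝒪 {a} h′) (v≥-+ y∈ (≼-*ˡ β∈ s∈)))
      -- The integrality of `r` comes from the congruence, as `r ≡ d * β`.
      pr∈ : 𝒪 (p + r * q)
      pr∈ = v≥-resp (trans (solve 4 (λ p r q e → p :+ (e :- (e :- r)) :* q := p :+ r :* q) refl p r q (d * β)) refl)
              (v≥-+ p∈ (≼-*ʳ (v≥-- (≼-*ˡ (𝒪-π^ {c ℕ.∸ b}) β∈) (≼⇒𝒪 {a} congruent)) q∈))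

    -- Three products suffice. (r , πᶜω)·1 gives `b ≤ c` and the congruence, (π^f , 0)·1 gives
    -- `a ≤ f`, and (r , πᶜω)·(β , πᵇω) gives a relation that becomes the norm condition after
    -- adding `β` times the congruence.
    stable⇐ : 𝒪 β → (∀ {ρ z} → L f c r ρ → L a b β z → L a b β (ρ 𝔼.* z)) → Stable f c r a b β
    stable⇐ β∈ closed = record { b≤c = b≤c ; a≤f = a≤f ; congruent = congruent ; norm-≼ = norm-≼ }
      where
      open SetoidReasoning setoid
      d = π ^ (c ℕ.∸ b)
      r∈L : L a b β (r , at 0# (π ^ c))
      r∈L = L-resp {a} {b} {β} (*-identityʳ r , E.*-identityʳ _) (closed (L-θ {f} {c} {r}) (L-1 {a} {b} {β}))
      b≤c : b ℕ.≤ c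
      b≤c = ≼-≡ (vπ^ c) (L-b {a} {b} {β} r∈L)
      πᶜ≈ : π ^ c ≈ π ^ b * d
      πᶜ≈ = trans (reflexive (≡.cong (π ^_) (≡.sym (ℕ.m+[n∸m]≡n b≤c)))) (π^-+ b (c ℕ.∸ b))
      a≤f : a ℕ.≤ f
      a≤f = ≼-≡ (vπ^ f) (v≥-resp (solve 2 (λ x β → x :- (con (+ 0) :+ β :* con (+ 0)) := x) refl (π ^ f) β)
              (proj₂ (proj₂ (L-at {a} {b} {β} (L-resp {a} {b} {β} (*-identityʳ _ , E.trans (E.zeroˡ _) (E.trans at-0 (at-cong refl (sym (zeroʳ (π ^ b))))))
                (closed (L-ε {f} {c} {r} (≼-π^ {f})) (L-1 {a} {b} {β})))))))
      congruent : a ≼ d * β - r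
      congruent = v≥-resp (solve 3 (λ r β d → :- (r :- (con (+ 0) :+ β :* d)) := d :* β :- r) refl r β d)
        (v≥-neg (proj₂ (proj₂ (L-at {a} {b} {β} (L-resp {a} {b} {β} (refl , at-cong refl πᶜ≈) r∈L)))))
      product : a ≼ r * β - (- (n * (π ^ c * π ^ b)) + β * (t * π ^ c))
      product = proj₂ (proj₂ (L-at {a} {b} {β} (L-resp {a} {b} {β} (refl , E.trans (at-* 0# (π ^ c) 0# (π ^ b)) (at-cong
        (solve 3 (λ n c b → con (+ 0) :* con (+ 0) :- n :* (c :* b) := :- (n :* (c :* b))) refl n (π ^ c) (π ^ b))
        (solve 3 (λ t c b → con (+ 0) :* b :+ c :* con (+ 0) :+ t :* (c :* b) := b :* (t :* c)) refl t (π ^ c) (π ^ b))))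
        (closed (L-θ {f} {c} {r}) (L-θ {a} {b} {β})))))
      norm-≼ : a ≼ d * N b β
      norm-≼ = v≥-resp (begin
          β * (d * β - r) + (r * β - (- (n * (π ^ c * π ^ b)) + β * (t * π ^ c)))
            ≈⟨ +-congˡ (+-congˡ (-‿cong (+-cong (-‿cong (*-congˡ (*-congʳ πᶜ≈))) (*-congˡ (*-congˡ πᶜ≈))))) ⟩
          β * (d * β - r) + (r * β - (- (n * (π ^ b * d * π ^ b)) + β * (t * (π ^ b * d))))
            ≈⟨ solve 6 (λ β d r n b t → β :* (d :* β :- r) :+ (r :* β :- (:- (n :* (b :* d :* b)) :+ β :* (t :* (b :* d))))
                 := d :* (β :* β :- t :* (β :* b) :+ n :* (b :* b))) refl β d r n (π ^ b) t ⟩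
          d * N b β ∎)
        (v≥-+ (≼-*ˡ β∈ congruent) product)

  record Homothetic {p q} (M : Pred 𝔼 p) (M′ : Pred 𝔼 q) : Set (ℓ Level.⊔ p Level.⊔ q) where
    field
      factor factor⁻¹ : 𝔼
      inverseʳ        : factor 𝔼.* factor⁻¹ 𝔼.≈ 𝔼.1#
      to              : ∀ {z} → M z → M′ (factor 𝔼.* z)
      from            : ∀ {z} → M′ z → M (factor⁻¹ 𝔼.* z)

  Homothetic-sym : ∀ {p q} {M : Pred 𝔼 p} {M′ : Pred 𝔼 q} → Homothetic M M′ → Homothetic M′ M
  Homothetic-sym h = record { factor = factor⁻¹ ; factor⁻¹ = factor ; inverseʳ = 𝔼.trans (𝔼.*-comm _ _) inverseʳ ; to = from ; from = to }
    where open Homothetic h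

  private
    unit : ∀ {x y} → x * y ≈ 1# → 𝒪 x → 𝒪 y → v x ≡ [ 0ℤ ]
    unit {x} {y} xy≈1 x∈ y∈ = exact x∈ (λ x∈𝔪 → ≡⇒⋠ v1 (v≥-resp xy≈1 (≼-*ʳ x∈𝔪 y∈)))

  module _ {a b a′ b′ β β′} (β∈ : 𝒪 β) (β′∈ : 𝒪 β′) (h : Homothetic (L a b β) (L a′ b′ β′)) where
    open Homothetic h
    private
      u u⁻¹ : Carrier
      u   = proj₁ factor
      u⁻¹ = proj₁ factor⁻¹
      w w⁻¹ : E.Carrier
      w   = proj₂ factor
      w⁻¹ = proj₂ factor⁻¹

      factor∈ : L a′ b′ β′ factor
      factor∈ = L-resp {a′} {b′} {β′} (𝔼.*-identityʳ factor) (to (L-1 {a} {b} {β}))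

      factor⁻¹∈ : L a b β factor⁻¹
      factor⁻¹∈ = L-resp {a} {b} {β} (𝔼.*-identityʳ factor⁻¹) (from (L-1 {a′} {b′} {β′}))

      vu : v u ≡ [ 0ℤ ]
      vu = unit (proj₁ inverseʳ) (proj₁ (L⊆𝒪ᴱ {a′} {b′} {β′} β′∈ factor∈)) (proj₁ (L⊆𝒪ᴱ {a} {b} {β} β∈ factor⁻¹∈))

    -- `π ^ a` generates the intersection of the lattice with F × 0, and the first component of the
    -- factor is a unit because it and its inverse are integral.
    homothetic⇒a′≤a : a′ ℕ.≤ a
    homothetic⇒a′≤a = ≼-≡ (vπ^ a) (≼-cancelˡ vu (v≥-resp (solve 2 (λ x β → x :- (con (+ 0) :+ β :* con (+ 0)) := x) refl (u * π ^ a) β′)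
      (proj₂ (proj₂ (L-at {a′} {b′} {β′} (L-resp {a′} {b′} {β′} (refl , E.trans (E.zeroʳ w) (E.trans at-0 (at-cong refl (sym (zeroʳ (π ^ b′))))))
        (to (L-ε {a} {b} {β} (≼-π^ {a})))))))))

    -- The second projection of L a′ b′ β′ is stable under πᵇω and contains 1.
    homothetic⇒b′≤b : b′ ℕ.≤ b
    homothetic⇒b′≤b = let (y , s , y∈ , s∈ , eq , _) = factor⁻¹∈ in b′≤b y s y∈ s∈ eq
      where
      open SetoidReasoning E.setoid
      b′≤b : ∀ y s → 𝒪 y → 𝒪 s → w⁻¹ E.≈ at y (π ^ b * s) → b′ ℕ.≤ b
      b′≤b y s y∈ s∈ eq = ≼-≡ (vπ^ b) (L-b {a′} {b′} {β′} (L-resp {a′} {b′} {β′} (refl , shape) (to {y₁ + β * s₁ , at y₁ (π ^ b * s₁)}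
          (y₁ , s₁ , v≥-neg (≼-*ˡ n-𝒪 (≼-*ˡ (𝒪-π^ {b}) (≼-*ˡ (𝒪-π^ {b}) s∈))) , v≥-+ y∈ (≼-*ˡ t-𝒪 (≼-*ˡ (𝒪-π^ {b}) s∈)) , E.refl , v≥-≈0 (-‿inverseʳ _)))))
        where
        -- `at y₁ (π ^ b * s₁)` is πᵇω·w⁻¹. It lies in the second projection of `L a b β` because
        -- `w⁻¹` does, and multiplication by `w` turns it into πᵇω.
        y₁ = - (n * (π ^ b * (π ^ b * s)))
        s₁ = y + t * (π ^ b * s)
        shape : w E.* at y₁ (π ^ b * s₁) E.≈ at 0# (π ^ b)
        shape = begin
          w E.* at y₁ (π ^ b * s₁)                        ≈⟨ E.*-congˡ (at-cong
                                                                (solve 4 (λ n b s y → :- (n :* (b :* (b :* s))) := con (+ 0) :* y :- n :* (b :* (b :* s))) refl n (π ^ b) s y)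
                                                                (solve 4 (λ b s t y → b :* (y :+ t :* (b :* s)) := con (+ 0) :* (b :* s) :+ b :* y :+ t :* (b :* (b :* s))) refl (π ^ b) s t y)) ⟩
          w E.* at (0# * y - n * (π ^ b * (π ^ b * s))) (0# * (π ^ b * s) + π ^ b * y + t * (π ^ b * (π ^ b * s)))
                                                          ≈⟨ E.*-congˡ (at-* 0# (π ^ b) y (π ^ b * s)) ⟨
          w E.* (at 0# (π ^ b) E.* at y (π ^ b * s))      ≈⟨ E.*-congˡ (E.*-congˡ eq) ⟨
          w E.* (at 0# (π ^ b) E.* w⁻¹)                   ≈⟨ E.*-congˡ (E.*-comm _ _) ⟩
          w E.* (w⁻¹ E.* at 0# (π ^ b))                   ≈⟨ E.*-assoc _ _ _ ⟨
          w E.* w⁻¹ E.* at 0# (π ^ b)                     ≈⟨ E.*-congʳ (proj₂ inverseʳ) ⟩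
          E.1# E.* at 0# (π ^ b)                          ≈⟨ E.*-identityˡ _ ⟩
          at 0# (π ^ b)                                   ∎

  -- For a homothety by (u, y + sπᵇω) one finds (β - β′)u ≡ - s N(β′) mod πᵃ.
  homothetic⇒close : ∀ {a b β β′} → 𝒪 β → 𝒪 β′ → Homothetic (L a b β) (L a b β′) →
                     ∀ {k} → k ℕ.≤ a → k ≼ N b β′ → k ≼ β - β′
  homothetic⇒close {a} {b} {β} {β′} β∈ β′∈ h {k} k≤a k≼N =
    let (y , s , y∈ , s∈ , eq , p) = factor∈ in close y s s∈ eq p
    where
    open Homothetic h
    u = proj₁ factor
    w = proj₂ factor
    factor∈ : L a b β′ factor
    factor∈ = L-resp {a} {b} {β′} (𝔼.*-identityʳ factor) (to (L-1 {a} {b} {β}))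
    factor⁻¹∈ : L a b β factor⁻¹
    factor⁻¹∈ = L-resp {a} {b} {β} (𝔼.*-identityʳ factor⁻¹) (from (L-1 {a} {b} {β′}))
    vu : v u ≡ [ 0ℤ ]
    vu = unit (proj₁ inverseʳ) (proj₁ (L⊆𝒪ᴱ {a} {b} {β′} β′∈ factor∈)) (proj₁ (L⊆𝒪ᴱ {a} {b} {β} β∈ factor⁻¹∈))
    close : ∀ y s → 𝒪 s → w E.≈ at y (π ^ b * s) → a ≼ u - (y + β′ * s) → k ≼ β - β′
    close y s s∈ eq p = ≼-cancelˡ vu (v≥-resp
        (solve 8 (λ u β β′ y s n b t → (u :* β :- (:- (n :* (b :* (s :* b))) :+ β′ :* (y :+ t :* (b :* s)))) :- β′ :* (u :- (y :+ β′ :* s))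
                     :- s :* (β′ :* β′ :- t :* (β′ :* b) :+ n :* (b :* b)) := u :* (β :- β′)) refl u β β′ y s n (π ^ b) t)
        (v≥-- (v≥-- (≼-mono k≤a θ∈) (≼-*ˡ β′∈ (≼-mono k≤a p))) (≼-*ˡ s∈ k≼N)))
      where
      θ∈ : a ≼ u * β - (- (n * (π ^ b * (s * π ^ b))) + β′ * (y + t * (π ^ b * s)))
      θ∈ = proj₂ (proj₂ (L-at {a} {b} {β′} (L-resp {a} {b} {β′} (refl , E.trans (E.*-congʳ eq) (E.trans (at-* y (π ^ b * s) 0# (π ^ b)) (at-cong
        (solve 4 (λ y n b s → y :* con (+ 0) :- n :* (b :* s :* b) := :- (n :* (b :* (s :* b)))) refl y n (π ^ b) s)
        (solve 4 (λ y t b s → y :* b :+ b :* s :* con (+ 0) :+ t :* (b :* s :* b) := b :* (y :+ t :* (b :* s))) refl y t (π ^ b) s))))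
        (to (L-θ {a} {b} {β})))))

  congruent⇒homothetic : ∀ {a b β β′} → a ≼ β - β′ → Homothetic (L a b β) (L a b β′)
  congruent⇒homothetic {a} {b} {β} {β′} p = record
    { factor = 𝔼.1# ; factor⁻¹ = 𝔼.1# ; inverseʳ = 𝔼.*-identityˡ 𝔼.1#
    ; to   = λ {z} (y , s , y∈ , s∈ , eq , q) → y , s , y∈ , s∈ , E.trans (E.*-identityˡ _) eq ,
        v≥-resp (solve 5 (λ x y β s β′ → (x :- (y :+ β :* s)) :+ (β :- β′) :* s := con (+ 1) :* x :- (y :+ β′ :* s)) refl (proj₁ z) y β s β′)
          (v≥-+ q (≼-*ʳ p s∈))
    ; from = λ {z} (y , s , y∈ , s∈ , eq , q) → y , s , y∈ , s∈ , E.trans (E.*-identityˡ _) eq ,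
        v≥-resp (solve 5 (λ x y β s β′ → (x :- (y :+ β′ :* s)) :- (β :- β′) :* s := con (+ 1) :* x :- (y :+ β :* s)) refl (proj₁ z) y β s β′)
          (v≥-- q (≼-*ʳ p s∈))
    }

  -- The factor (1, w) with w = 1 + s(πᵇω - β′) does it when β = β′ - s N(β′), and then N(β) = N(β′) · norm w.
  close⇒homothetic : ∀ {a b β β′ k} → 𝒪 β → 𝒪 β′ → v (N b β) ≡ [ + k ] → v (N b β′) ≡ [ + k ] → k ≼ β - β′ →
                     Homothetic (L a b β) (L a b β′)
  close⇒homothetic {a} {b} {β} {β′} {k} β∈ β′∈ vN vN′ p = record
    { factor = 1# , at y (B * s) ; factor⁻¹ = 1# , at (ν * (y + t * (s * B))) (B * (- (ν * s)))
    ; inverseʳ = *-identityˡ 1# , E.trans (at-* y (B * s) _ _) (E.trans (at-cong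
        (trans (solve 6 (λ y B s ν t n → y :* (ν :* (y :+ t :* (s :* B))) :- n :* (B :* s :* (B :* (:- (ν :* s)))) := ν :* (y :* y :+ t :* (y :* (s :* B)) :+ n :* (s :* B :* (s :* B)))) refl y B s ν t n) νM≈1)
        (solve 5 (λ y B s ν t → y :* (B :* (:- (ν :* s))) :+ B :* s :* (ν :* (y :+ t :* (s :* B))) :+ t :* (B :* s :* (B :* (:- (ν :* s)))) := con (+ 0)) refl y B s ν t))
        (E.sym at-1))
    ; to   = λ {z} (p , q , p∈ , q∈ , eq , h) → y * p - n * (B * s * (B * q)) , y * q + s * p + t * (s * B * q) ,
        v≥-- (≼-*ˡ y∈ p∈) (≼-*ˡ n-𝒪 (≼-*ˡ (≼-*ˡ B∈ s∈) (≼-*ˡ B∈ q∈))) , v≥-+ (v≥-+ (≼-*ˡ y∈ q∈) (≼-*ˡ s∈ p∈)) (≼-*ˡ t-𝒪 (≼-*ˡ (≼-*ˡ s∈ B∈) q∈)) ,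
        E.trans (E.*-congˡ eq) (E.trans (at-* y (B * s) p (B * q)) (at-cong refl
          (solve 6 (λ y B q s p t → y :* (B :* q) :+ B :* s :* p :+ t :* (B :* s :* (B :* q)) := B :* (y :* q :+ s :* p :+ t :* (s :* B :* q))) refl y B q s p t))) ,
        v≥-resp (trans (+-congˡ (-‿cong (+-congˡ (*-congʳ β≈))))
          (solve 8 (λ x p q s β′ B t n → x :- (p :+ (β′ :- s :* (β′ :* β′ :- t :* (β′ :* B) :+ n :* (B :* B))) :* q)
             := con (+ 1) :* x :- (((con (+ 1) :- s :* β′) :* p :- n :* (B :* s :* (B :* q))) :+ β′ :* ((con (+ 1) :- s :* β′) :* q :+ s :* p :+ t :* (s :* B :* q))))
             refl (proj₁ z) p q s β′ B t n)) h
    ; from = λ {z} (p , q , p∈ , q∈ , eq , h) → ν * ((y + t * (s * B)) * p + n * (B * s * (B * q))) , ν * (y * q - s * p) ,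
        ≼-*ˡ ν∈ (v≥-+ (≼-*ˡ (v≥-+ y∈ (≼-*ˡ t-𝒪 (≼-*ˡ s∈ B∈))) p∈) (≼-*ˡ n-𝒪 (≼-*ˡ (≼-*ˡ B∈ s∈) (≼-*ˡ B∈ q∈)))) , ≼-*ˡ ν∈ (v≥-- (≼-*ˡ y∈ q∈) (≼-*ˡ s∈ p∈)) ,
        E.trans (E.*-congˡ eq) (E.trans (at-* _ _ p (B * q)) (at-cong
          (solve 8 (λ ν y t s B p n q → ν :* (y :+ t :* (s :* B)) :* p :- n :* (B :* (:- (ν :* s)) :* (B :* q)) := ν :* ((y :+ t :* (s :* B)) :* p :+ n :* (B :* s :* (B :* q)))) refl ν y t s B p n q)
          (solve 7 (λ ν y t s B p q → ν :* (y :+ t :* (s :* B)) :* (B :* q) :+ B :* (:- (ν :* s)) :* p :+ t :* (B :* (:- (ν :* s)) :* (B :* q)) := B :* (ν :* (y :* q :- s :* p))) refl ν y t s B p q))) ,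
        v≥-resp (begin
          proj₁ z - (p + β′ * q)                         ≈⟨ solve 4 (λ x p q β′ → x :- (p :+ β′ :* q) := con (+ 1) :* x :- con (+ 1) :* (p :+ β′ :* q)) refl (proj₁ z) p q β′ ⟩
          1# * proj₁ z - 1# * (p + β′ * q)               ≈⟨ +-congˡ (-‿cong (*-congʳ νM≈1)) ⟨
          1# * proj₁ z - ν * M * (p + β′ * q)
            ≈⟨ solve 9 (λ x ν p q s β′ B t n → con (+ 1) :* x :- ν :* ((con (+ 1) :- s :* β′) :* (con (+ 1) :- s :* β′) :+ t :* ((con (+ 1) :- s :* β′) :* (s :* B)) :+ n :* (s :* B :* (s :* B))) :* (p :+ β′ :* q)
                 := con (+ 1) :* x :- (ν :* (((con (+ 1) :- s :* β′) :+ t :* (s :* B)) :* p :+ n :* (B :* s :* (B :* q)))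
                       :+ (β′ :- s :* (β′ :* β′ :- t :* (β′ :* B) :+ n :* (B :* B))) :* (ν :* ((con (+ 1) :- s :* β′) :* q :- s :* p))))
                 refl (proj₁ z) ν p q s β′ B t n ⟩
          _                                              ≈⟨ +-congˡ (-‿cong (+-congˡ (*-congʳ β≈))) ⟨
          _                                              ∎) h
    }
    where
    open SetoidReasoning setoid
    B N′⁻¹ s y M : Carrier
    B = π ^ b
    N′⁻¹ = proj₁ (inverse vN′)
    s = - (N′⁻¹ * (β - β′))
    y = 1# - s * β′
    M = y * y + t * (y * (s * B)) + n * (s * B * (s * B))
    B∈ : 𝒪 B
    B∈ = 𝒪-π^ {b}
    s∈ : 𝒪 s
    s∈ = v≥-neg (quotient-integral vN′ (proj₁ (proj₂ (inverse vN′))) (≡.subst (λ i → i ≤∞ v (β - β′)) (≡.sym vN′) p))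
    y∈ : 𝒪 y
    y∈ = v≥-- 𝒪-1 (≼-*ˡ s∈ β′∈)
    β≈ : β ≈ β′ - s * N b β′
    β≈ = begin
      β                                       ≈⟨ solve 2 (λ β β′ → β := β′ :+ con (+ 1) :* (β :- β′)) refl β β′ ⟩
      β′ + 1# * (β - β′)                      ≈⟨ +-congˡ (*-congʳ (proj₁ (proj₂ (inverse vN′)))) ⟨
      β′ + N b β′ * N′⁻¹ * (β - β′)           ≈⟨ solve 4 (λ β β′ N i → β′ :+ N :* i :* (β :- β′) := β′ :- (:- (i :* (β :- β′))) :* N) refl β β′ (N b β′) N′⁻¹ ⟩
      β′ - s * N b β′                         ∎
    N≈ : N b β′ * M ≈ N b β
    N≈ = begin
      N b β′ * M
        ≈⟨ solve 5 (λ s β′ B t n → let N′ = β′ :* β′ :- t :* (β′ :* B) :+ n :* (B :* B) ; y = con (+ 1) :- s :* β′ ; β = β′ :- s :* N′ in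
             N′ :* (y :* y :+ t :* (y :* (s :* B)) :+ n :* (s :* B :* (s :* B))) := β :* β :- t :* (β :* B) :+ n :* (B :* B)) refl s β′ B t n ⟩
      N b (β′ - s * N b β′) ≈⟨ +-congʳ (+-cong (*-cong β≈ β≈) (-‿cong (*-congˡ (*-congʳ β≈)))) ⟨
      N b β ∎
    M∈ : 𝒪 M
    M∈ = v≥-+ (v≥-+ (≼-*ˡ y∈ y∈) (≼-*ˡ t-𝒪 (≼-*ˡ y∈ (≼-*ˡ s∈ B∈)))) (≼-*ˡ n-𝒪 (≼-*ˡ (≼-*ˡ s∈ B∈) (≼-*ˡ s∈ B∈)))
    -- `M` is the norm of the second component of the factor. The equal valuations of `N b β` and
    -- `N b β′` make it a unit, and its inverse `ν` times the conjugate inverts the factor.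
    vM : v M ≡ [ 0ℤ ]
    vM = exact M∈ (λ M∈𝔪 → ≡⇒⋠ vN (v≥-resp N≈ (≡.subst (_≼ N b β′ * M) (ℕ.+-comm k 1) (≼-* (≡⇒v≥ vN′) M∈𝔪))))
    ν = proj₁ (inverse vM)
    ν∈ : 𝒪 ν
    ν∈ = ≡⇒v≥ (proj₂ (proj₂ (inverse vM)))
    νM≈1 : ν * M ≈ 1#
    νM≈1 = trans (*-comm ν M) (proj₁ (proj₂ (inverse vM)))

  -- Coordinates and the normal form of a lattice containing 1

  open Exponents valuedField vπ renaming (Span to SpanV)
  open Submodules (Orders.E F E′) using (Span; IsSubmodule)
  open Sum 𝔼.semiring using (sum; *-distribˡ-sum; sum-cong-≋)

  sum-closed : ∀ {p} (P : Pred 𝔼 p) → P 𝔼.0# → (∀ x y → P x → P y → P (x 𝔼.+ y)) → ∀ {m} (w : Fin m → 𝔼) → (∀ i → P (w i)) → P (sum w)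
  sum-closed P P0 P+ {zero}  w h = P0
  sum-closed P P0 P+ {suc m} w h = P+ _ _ (h zero) (sum-closed P P0 P+ (w ∘ suc) (h ∘ suc))

  private
    one two : Fin 3
    one = suc zero
    two = suc (suc zero)

  -- Coordinates are listed from the one used first in the Hermite normal form.
  fromCoordinates : V 3 → 𝔼
  fromCoordinates z = z two , at (z one) (z zero)

  toCoordinates : 𝔼 → V 3
  toCoordinates (x , w) = let (y , s , _) = coordinates w in s V.∷ y V.∷ x V.∷ V.[]

  from∘to : ∀ z → fromCoordinates (toCoordinates z) 𝔼.≈ z
  from∘to (x , w) = refl , E.sym (proj₂ (proj₂ (coordinates w)))

  from-injective : ∀ {z z′} → fromCoordinates z 𝔼.≈ fromCoordinates z′ → ∀ i → z i ≈ z′ i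
  from-injective (p , q) zero             = proj₂ (at-injective q)
  from-injective (p , q) (suc zero)       = proj₁ (at-injective q)
  from-injective (p , q) (suc (suc zero)) = p

  from-+ : ∀ z z′ → fromCoordinates (λ i → z i + z′ i) 𝔼.≈ fromCoordinates z 𝔼.+ fromCoordinates z′
  from-+ z z′ = refl , E.sym (at-+ _ _ _ _)

  from-* : ∀ c z → fromCoordinates (λ i → c * z i) 𝔼.≈ diagonal c 𝔼.* fromCoordinates z
  from-* c z = refl , E.sym (at-scale c _ _)

  Spanᴱ : List (V 3) → Pred 𝔼 ℓ
  Spanᴱ gs w = ∃[ c ] fromCoordinates c 𝔼.≈ w × SpanV gs c

  private
    span-0 : ∀ (gs : List (V 3)) → SpanV gs (λ _ → 0#)
    span-0 []       i = refl
    span-0 (g ∷ gs)   = 0# , v≥-0 , Span-resp gs (λ i → solve 1 (λ g → con (+ 0) := con (+ 0) :- con (+ 0) :* g) refl (g i)) (span-0 gs)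

    span-++ : ∀ (gs : List (V 3)) {hs x y} → SpanV gs x → SpanV hs y → SpanV (gs ++ hs) (λ i → x i + y i)
    span-++ []       {hs} x≈0 s′ = Span-resp hs (λ i → sym (trans (+-congʳ (x≈0 i)) (+-identityˡ _))) s′
    span-++ (g ∷ gs) {hs} {x} {y} (c , c∈ , s) s′ = c , c∈ ,
      Span-resp (gs ++ hs) (λ i → solve 4 (λ x c g y → x :- c :* g :+ y := x :+ y :- c :* g) refl (x i) c (g i) (y i)) (span-++ gs s s′)

  Spanᴱ-0 : ∀ gs → Spanᴱ gs 𝔼.0#
  Spanᴱ-0 gs = (λ _ → 0#) , (refl , E.sym at-0) , span-0 gs

  Spanᴱ-++ : ∀ gs {hs x y} → Spanᴱ gs x → Spanᴱ hs y → Spanᴱ (gs ++ hs) (x 𝔼.+ y)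
  Spanᴱ-++ gs (c , eq , s) (c′ , eq′ , s′) = _ , 𝔼.trans (from-+ c c′) (𝔼.+-cong eq eq′) , span-++ gs s s′

  Spanᴱ-resp : ∀ gs {x y} → x 𝔼.≈ y → Spanᴱ gs x → Spanᴱ gs y
  Spanᴱ-resp gs x≈y (c , eq , s) = c , 𝔼.trans eq x≈y , s

  Spanᴱ-[_] : ∀ g {c} → 𝒪 c → Spanᴱ (toCoordinates g ∷ []) (diagonal c 𝔼.* g)
  Spanᴱ-[ g ] {c} c∈ = (λ i → c * toCoordinates g i) , 𝔼.trans (from-* c (toCoordinates g)) (𝔼.*-congˡ (from∘to g)) , c , c∈ , λ i → -‿inverseʳ _

  Spanᴱ-sum : ∀ {m} (gs : Fin m → List (V 3)) (w : Fin m → 𝔼) → (∀ i → Spanᴱ (gs i) (w i)) → Spanᴱ (List.concat (List.tabulate gs)) (sum w)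
  Spanᴱ-sum {zero}  gs w h = Spanᴱ-0 []
  Spanᴱ-sum {suc m} gs w h = Spanᴱ-++ (gs zero) (h zero) (Spanᴱ-sum (gs ∘ suc) (w ∘ suc) (h ∘ suc))

  Spanᴱ⇒Span : ∀ gs {z} → Spanᴱ gs (fromCoordinates z) → SpanV gs z
  Spanᴱ⇒Span gs (c , eq , s) = Span-resp gs (from-injective eq) s

  record IsLattice {p} (M : Pred 𝔼 p) : Set (ℓ Level.⊔ p) where
    field
      resp     : ∀ {x y} → x 𝔼.≈ y → M x → M y
      +-closed : ∀ {x y} → M x → M y → M (x 𝔼.+ y)
      scale    : ∀ {c x} → 𝒪 c → M x → M (diagonal c 𝔼.* x)
      1∈       : M 𝔼.1#

    0∈ : M 𝔼.0#
    0∈ = resp (zeroˡ 1# , E.trans (E.*-congʳ (ι-0 F E′)) (E.zeroˡ E.1#)) (scale v≥-0 1∈)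

    isModule : Is𝒪Module (M ∘ fromCoordinates)
    isModule = record
      { resp = λ x≈y → resp (x≈y two , at-cong (x≈y one) (x≈y zero))
      ; 0∈   = resp (refl , at-0) 0∈
      ; +∈   = λ {x} {y} x∈ y∈ → resp (𝔼.sym (from-+ x y)) (+-closed x∈ y∈)
      ; *∈   = λ {c} {x} c∈ x∈ → resp (𝔼.sym (from-* c x)) (scale c∈ x∈)
      }

  module _ {p} {M : Pred 𝔼 p} (isLattice : IsLattice M) (M⊆𝒪ᴱ : ∀ {z} → M z → 𝒪ᴱ z) where
    open IsLattice isLattice

    private
      integral : ∀ {z} → M (fromCoordinates z) → ∀ i → 𝒪 (z i)
      integral z∈ zero             = proj₂ (at-𝒪 (proj₂ (M⊆𝒪ᴱ z∈)))
      integral z∈ (suc zero)       = proj₁ (at-𝒪 (proj₂ (M⊆𝒪ᴱ z∈)))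
      integral z∈ (suc (suc zero)) = proj₁ (M⊆𝒪ᴱ z∈)

    -- The element 1 serves as pivot for the middle coordinate. Subtracting multiples of 1 and of
    -- the pivot (β , πᵇω) leaves an element of F × 0, where `π ^ a` generates.
    hermite : ∀ {a b k β} → HasExponents (b ∷ k ∷ a ∷ []) (M ∘ fromCoordinates) → M (β , at 0# (π ^ b)) → M ≐ L a b β
    hermite {a} {b} {k} {β} (bound , _ , _ , _ , bound″ , (ε , ε∈ , ε≈) , _) θ∈ = M⊆L , L⊆M
      where
      M⊆L : ∀ {z} → M z → L a b β z
      M⊆L {z} z∈ = let
          (x , w) = z
          c = toCoordinates z
          c∈ : M (fromCoordinates c)
          c∈ = resp (𝔼.sym (from∘to z)) z∈
          y = c one
          (s , s∈ , c₀≈) = divide≼ b (bound {c} c∈)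
          y∈ = integral {c} c∈ one
          rest : M ((x + - y * 1#) + - s * β , at 0# 0#)
          rest = resp (refl , E.trans (E.+-cong (E.+-cong (proj₂ (coordinates w) .proj₂) (E.trans (E.*-congˡ at-1) (at-scale (- y) 1# 0#))) (at-scale (- s) 0# (π ^ b)))
                          (E.trans (E.+-congʳ (at-+ y (c zero) (- y * 1#) (- y * 0#))) (E.trans (at-+ _ _ _ _) (at-cong
                            (solve 2 (λ y s → y :+ :- y :* con (+ 1) :+ :- s :* con (+ 0) := con (+ 0)) refl y s)
                            (trans (+-congʳ (+-congʳ c₀≈)) (solve 3 (λ y s p → p :* s :+ :- y :* con (+ 0) :+ :- s :* p := con (+ 0)) refl y s (π ^ b)))))))
                   (+-closed (+-closed z∈ (scale (v≥-neg y∈) 1∈)) (scale (v≥-neg s∈) θ∈))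
        in y , s , y∈ , s∈ , E.trans (proj₂ (coordinates w) .proj₂) (at-cong refl c₀≈) ,
           v≥-resp (solve 4 (λ x y s β → (x :+ :- y :* con (+ 1)) :+ :- s :* β := x :- (y :+ β :* s)) refl x y s β)
             (bound″ {((x + - y * 1#) + - s * β) V.∷ V.[]} rest)
      L⊆M : ∀ {z} → L a b β z → M z
      L⊆M {x , w} (y , s , y∈ , s∈ , eq , p) = let
          (μ , μ∈ , μ≈) = divide≼ a p
        in resp (trans (+-cong refl (trans (*-congˡ ε≈) (trans (*-comm μ (π ^ a)) (sym μ≈))))
                   (solve 4 (λ x y s β → (y :* con (+ 1) :+ s :* β) :+ (x :- (y :+ β :* s)) := x) refl x y s β) ,
                 E.trans (E.+-cong (E.+-cong (E.trans (E.*-congˡ at-1) (at-scale y 1# 0#)) (at-scale s 0# (π ^ b))) (at-scale μ 0# 0#))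
                   (E.trans (E.+-congʳ (at-+ _ _ _ _)) (E.trans (at-+ _ _ _ _) (E.trans (at-cong
                     (solve 3 (λ y s μ → y :* con (+ 1) :+ s :* con (+ 0) :+ μ :* con (+ 0) := y) refl y s μ)
                     (solve 4 (λ y s μ p → y :* con (+ 0) :+ s :* p :+ μ :* con (+ 0) := p :* s) refl y s μ (π ^ b))) (E.sym eq)))))
             (+-closed (+-closed (scale y∈ 1∈) (scale s∈ θ∈)) (scale μ∈ ε∈))

    normal-form : ∀ e → (∀ {x y s} → e ≼ x → e ≼ y → e ≼ s → M (x , at y s)) →
      (gs : List (V 3)) → All (M ∘ fromCoordinates) gs → (∀ {z} → M z → Spanᴱ gs z) →
      ∃[ a ] ∃[ b ] ∃[ β ] 𝒪 β × M ≐ L a b β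
    normal-form e full gs gs∈ span with exponents isModule integral e (λ z h → full (h two) (h one) (h zero)) gs gs∈ (λ {z} z∈ → Spanᴱ⇒Span gs (span z∈))
    ... | b ∷ k ∷ a ∷ [] , exps@(_ , (θ , θ∈ , θ≈) , _) =
      -- Subtracting `θ one` times 1 from the first pivot removes its middle coordinate; what
      -- remains in the F-component is `β`.
      a , b , θ two + - θ one * 1# , v≥-+ (integral {θ} θ∈ two) (≼-*ˡ (v≥-neg (integral {θ} θ∈ one)) 𝒪-1) ,
      hermite exps (resp (refl , E.trans (E.+-congˡ (E.trans (E.*-congˡ at-1) (at-scale (- θ one) 1# 0#))) (E.trans (at-+ _ _ _ _) (at-cong
          (solve 1 (λ y → y :+ :- y :* con (+ 1) := con (+ 0)) refl (θ one)) (trans (+-congˡ (zeroʳ _)) (trans (+-identityʳ _) θ≈)))))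
        (+-closed θ∈ (scale (v≥-neg (integral {θ} θ∈ one)) 1∈)))

  L-exponents : ∀ a b β → 𝒪 β → HasExponents (b ∷ 0 ∷ a ∷ []) (L a b β ∘ fromCoordinates)
  L-exponents a b β β∈ =
    (λ z∈ → L-b {a} {b} {β} z∈) , (π ^ b V.∷ 0# V.∷ β V.∷ V.[] , L-θ {a} {b} {β} , refl) ,
    (λ {z} z∈ → proj₁ (at-𝒪 (proj₂ (L⊆𝒪ᴱ {a} {b} {β} β∈ z∈)))) ,
    (1# V.∷ 1# V.∷ V.[] , L-resp {a} {b} {β} (refl , at-1) (L-1 {a} {b} {β}) , refl) ,
    (λ {z} z∈ → v≥-resp (solve 2 (λ x β → x :- (con (+ 0) :+ β :* con (+ 0)) := x) refl (z zero) β)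
      (proj₂ (proj₂ (L-at {a} {b} {β} (L-resp {a} {b} {β} (refl , at-cong refl (sym (zeroʳ (π ^ b)))) z∈))))) ,
    (π ^ a V.∷ V.[] , L-resp {a} {b} {β} (refl , at-0) (L-ε {a} {b} {β} (≼-π^ {a})) , refl) , Level.lift tt

-- The normal form of an order

module OrderNormalForm {ℓ} (F : NonArchimedeanLocalField ℓ) (E′ : UnramifiedQuadraticExtension F)
    {π} (vπ : NonArchimedeanLocalField.IsUniformizer F π) (generator : IntegralGenerator F E′)
    (O : Orders.Order F E′) {f₁ f₂} (conductor≐ : Orders.conductor F E′ O ≐ Orders.PowerIdeal F E′ π f₁ f₂) where
  open NonArchimedeanLocalField F hiding (zero)
  open Valuation valuedField
  open Uniformizer vπ
  open IntegerRingSolver commutativeRing using (solve; con; _:+_; _:*_; _:-_; :-_; _:=_)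
  open IntegralGenerator generator
  open Orders F E′ using (𝒪ᴱ; diagonal; Δ𝔬; ΔF; Order; FractionalIdeal; conductor; PowerIdeal)
  open Lattices F E′ vπ generator
  open Submodules (Orders.E F E′) using (Span; IsSubmodule)
  open Sum 𝔼.semiring using (sum; *-distribˡ-sum; sum-cong-≋)
  open Order O using (R)

  private
    module O = Order O

  -- Both projections of `R` are closed under products, and finite generation over 𝔬 bounds their
  -- valuations from below; so their elements are integral.
  R⊆𝒪ᴱ : ∀ {z} → R z → 𝒪ᴱ z
  R⊆𝒪ᴱ z∈ =
      bounded⇒integral (λ x → ∃[ w ] R (x , w)) (_ , O.1∈) (λ (_ , p) (_ , q) → _ , O.*-closed p q) B (λ (_ , p) → bound p) (_ , z∈)
    , VE.bounded⇒integral (λ w → ∃[ x ] R (x , w)) (_ , O.1∈) (λ (_ , p) (_ , q) → _ , O.*-closed p q) B′ (λ (_ , p) → bound′ p) (_ , z∈)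
    where
    m = proj₁ O.finitelyGenerated
    g : Fin m → 𝔼
    g = proj₁ (proj₂ O.finitelyGenerated)
    B  = proj₁ (finite-bound (proj₁ ∘ g))
    B′ = proj₁ (VE.finite-bound (proj₂ ∘ g))
    bound : ∀ {z} → R z → v≥ (ℤ.- (+ B)) (proj₁ z)
    bound z∈ = let (a , a∈ , eq) = proj₁ (proj₂ (proj₂ O.finitelyGenerated)) z∈ in
      v≥-resp (sym (proj₁ eq)) (sum-closed (v≥ (ℤ.- (+ B)) ∘ proj₁) v≥-0 (λ _ _ → v≥-+) (λ i → a i 𝔼.* g i)
        (λ i → let (α , α∈ , e) = a∈ i in v≥-resp (*-congʳ (sym (proj₁ e))) (v≥-*ˡ α∈ (proj₂ (finite-bound (proj₁ ∘ g)) i))))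
    bound′ : ∀ {z} → R z → E.v≥ (ℤ.- (+ B′)) (proj₂ z)
    bound′ z∈ = let (a , a∈ , eq) = proj₁ (proj₂ (proj₂ O.finitelyGenerated)) z∈ in
      VE.v≥-resp (E.sym (proj₂ eq)) (sum-closed (E.v≥ (ℤ.- (+ B′)) ∘ proj₂) VE.v≥-0 (λ _ _ → VE.v≥-+) (λ i → a i 𝔼.* g i)
        (λ i → let (α , α∈ , e) = a∈ i in VE.v≥-resp (E.*-congʳ (E.sym (proj₂ e))) (VE.v≥-*ˡ (ι-integral F E′ α∈) (proj₂ (VE.finite-bound (proj₂ ∘ g)) i))))

  R-isLattice : IsLattice R
  R-isLattice = record { resp = O.resp ; +-closed = O.+-closed ; scale = λ c∈ z∈ → O.*-closed (O.𝔬⊆ (_ , c∈ , 𝔼.refl)) z∈ ; 1∈ = O.1∈ }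

  -- The conductor lies in `R`, and `f₁ + f₂` is a single exponent large enough for all three
  -- coordinates.
  R-full : ∀ {x y s} → f₁ ℕ.+ f₂ ≼ x → f₁ ℕ.+ f₂ ≼ y → f₁ ℕ.+ f₂ ≼ s → R (x , at y s)
  R-full {x} {y} {s} px py ps =
    let (x′ , x′∈ , x≈) = divide≼ f₁ (≼-mono (ℕ.m≤m+n f₁ f₂) px)
        (y′ , y′∈ , y≈) = divide≼ f₂ (≼-mono (ℕ.m≤n+m f₂ f₁) py)
        (s′ , s′∈ , s≈) = divide≼ f₂ (≼-mono (ℕ.m≤n+m f₂ f₁) ps)
    in O.resp (trans (*-congʳ (*-identityʳ _)) (sym x≈) ,
               E.trans (E.*-congʳ (E.trans (E.*-identityʳ _) (ι^≈at f₂))) (E.trans (E.*-congʳ (E.sym (ι≈at (π ^ f₂)))) (E.trans (at-scale (π ^ f₂) y′ s′) (at-cong (sym y≈) (sym s≈)))))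
         (proj₂ (proj₂ conductor≐ {π ^ f₁ * 1# , ι π E.^ f₂ E.* E.1#} ((1# , 𝒪-1 , refl) , (E.1# , VE.𝒪-1 , E.refl))) (x′∈ , 𝒪-at y′∈ s′∈))
    where open E using (ι)

  generator∈Span : ∀ {p} {K : Pred 𝔼 p} → K 𝔼.0# → K 𝔼.1# → ∀ {m} (g : Fin m → 𝔼) i → Span K g (g i)
  generator∈Span {K = K} 0∈K 1∈K g i = unit i , unit∈ i , expansion g i
    where
    unit : ∀ {m} → Fin m → Fin m → 𝔼
    unit zero    zero    = 𝔼.1#
    unit zero    (suc j) = 𝔼.0#
    unit (suc i) zero    = 𝔼.0#
    unit (suc i) (suc j) = unit i j
    unit∈ : ∀ {m} (i j : Fin m) → K (unit i j)
    unit∈ zero    zero    = 1∈K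
    unit∈ zero    (suc j) = 0∈K
    unit∈ (suc i) zero    = 0∈K
    unit∈ (suc i) (suc j) = unit∈ i j
    expansion : ∀ {m} (g : Fin m → 𝔼) i → g i 𝔼.≈ sum (λ j → unit i j 𝔼.* g j)
    expansion g zero    = 𝔼.sym (𝔼.trans (𝔼.+-cong (𝔼.*-identityˡ _) (𝔼.trans (𝔼.sym (*-distribˡ-sum 𝔼.0# (g ∘ suc))) (𝔼.zeroˡ _))) (𝔼.+-identityʳ _))
    expansion g (suc i) = 𝔼.trans (expansion (g ∘ suc) i) (𝔼.sym (𝔼.trans (𝔼.+-congʳ (𝔼.zeroˡ _)) (𝔼.+-identityˡ _)))

  order-normal-form : ∃[ f ] ∃[ c ] ∃[ r ] 𝒪 r × R ≐ L f c r
  order-normal-form =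
    let (m , g , R⊆ , ⊆R) = O.finitelyGenerated
        g∈ : ∀ i → R (g i)
        g∈ i = ⊆R (generator∈Span {K = Δ𝔬} (0# , v≥-0 , refl , E.sym (ι-0 F E′)) (1# , 𝒪-1 , refl , E.sym (ι-1 F E′)) g i)
    in normal-form R-isLattice R⊆𝒪ᴱ (f₁ ℕ.+ f₂) R-full (List.concat (List.tabulate (λ i → toCoordinates (g i) ∷ [])))
      (All.concat⁺ (All.tabulate⁺ (λ i → O.resp (𝔼.sym (from∘to (g i))) (g∈ i) ∷ [])))
      (λ z∈ → let (a , a∈ , eq) = R⊆ z∈ in Spanᴱ-resp _ (𝔼.sym eq) (Spanᴱ-sum (λ i → toCoordinates (g i) ∷ []) (λ i → a i 𝔼.* g i)
        (λ i → let (α , α∈ , e) = a∈ i in Spanᴱ-resp _ (𝔼.*-congʳ (𝔼.sym e)) (Spanᴱ-[ g i ] α∈))))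

-- The conductor in terms of the normal form

module OrderInvariants {ℓ} (F : NonArchimedeanLocalField ℓ) (E′ : UnramifiedQuadraticExtension F)
    {π} (vπ : NonArchimedeanLocalField.IsUniformizer F π) (generator : IntegralGenerator F E′)
    (O : Orders.Order F E′) {f₁ f₂} (conductor≐ : Orders.conductor F E′ O ≐ Orders.PowerIdeal F E′ π f₁ f₂)
    {f c r} (r∈𝒪 : NonArchimedeanLocalField.𝒪 F r) (R≐L : Orders.Order.R O ≐ Lattices.L F E′ vπ generator f c r) where
  open NonArchimedeanLocalField F hiding (zero)
  open Valuation valuedField
  open Uniformizer vπ
  open IntegerRingSolver commutativeRing using (solve; con; _:+_; _:*_; _:-_; :-_; _:=_)
  open IntegralGenerator generator
  open Orders F E′ using (𝒪ᴱ; diagonal; Δ𝔬; ΔF; Order; FractionalIdeal; conductor; PowerIdeal)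
  open Lattices F E′ vπ generator
  open Submodules (Orders.E F E′) using (Span; IsSubmodule)
  open Sum 𝔼.semiring using (sum; *-distribˡ-sum; sum-cong-≋)
  open Order O using (R)

  private
    module O = Order O

  private
    R⊆L : R ⊆ L f c r
    R⊆L = proj₁ R≐L

    L⊆R : L f c r ⊆ R
    L⊆R = proj₂ R≐L

  -- `R` is a lattice over itself. With `a = f` and `b = c` the norm condition says that `π ^ f`
  -- divides `N c r`, the trace that closure under products leaves on `r`.
  R-stable : Stable f c r f c r
  R-stable = stable⇐ {f} {c} {r} {f} {c} {r} r∈𝒪 (λ ρ∈ z∈ → R⊆L (O.*-closed (L⊆R ρ∈) (L⊆R z∈)))

  -- The intersection of `R` with F × 0 is already stable under 𝒪ᴱ, so it is the first factor of the
  -- conductor.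
  f≡f₁ : f ≡ f₁
  f≡f₁ = ℕ.≤-antisym f≤f₁ f₁≤f
    where
    f≤f₁ : f ℕ.≤ f₁
    f≤f₁ = ≼-≡ (vπ^ f₁) (v≥-resp (solve 2 (λ x r → (x :* con (+ 1)) :* con (+ 1) :- (con (+ 0) :+ r :* con (+ 0)) := x) refl (π ^ f₁) r)
      (proj₂ (proj₂ (L-at {f} {c} {r} (L-resp {f} {c} {r} (refl , E.trans (E.*-identityʳ _) (E.trans (E.zeroʳ _) (E.trans at-0 (at-cong refl (sym (zeroʳ (π ^ c)))))))
        (R⊆L (proj₂ (proj₂ conductor≐ {π ^ f₁ * 1# , E.ι π E.^ f₂ E.* E.0#} ((1# , 𝒪-1 , refl) , (E.0# , VE.v≥-0 , E.refl))) {𝔼.1#} (𝒪-1 , VE.𝒪-1))))))))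
    f₁≤f : f₁ ℕ.≤ f
    f₁≤f = let ((a , a∈ , eq) , _) = proj₁ conductor≐ {π ^ f , E.0#}
                 ((𝒪-π^ {f} , VE.v≥-0) , (λ {b} b∈ → L⊆R (L-resp {f} {c} {r} (refl , E.sym (E.zeroˡ _)) (L-ε {f} {c} {r} (≼-*ʳ (≼-π^ {f}) (proj₁ b∈))))))
           in ≼-≡ (exact-resp eq (vπ^ f)) (≼-*ʳ (≼-π^ {f₁}) a∈)

  valuation-r : ∃[ m ] m ℕ.≤ c × m ℕ.≤ f × m ≼ r × (v r ≡ [ + m ] ⊎ m ≡ c ⊎ m ≡ f)
  valuation-r with ≼-or-exact (c ℕ.⊓ f) r∈𝒪
  ... | inj₁ p = c ℕ.⊓ f , ℕ.m⊓n≤m c f , ℕ.m⊓n≤n c f , p , inj₂ (ℕ.⊓-sel c f)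
  ... | inj₂ (k , k<cf , eq) = k , ℕ.≤-trans (ℕ.<⇒≤ k<cf) (ℕ.m⊓n≤m c f) , ℕ.≤-trans (ℕ.<⇒≤ k<cf) (ℕ.m⊓n≤n c f) , ≡⇒v≥ eq , inj₁ eq

  module _ {m} (m≤c : m ℕ.≤ c) (m≤f : m ℕ.≤ f) (m≼r : m ≼ r) (m-sharp : v r ≡ [ + m ] ⊎ m ≡ c ⊎ m ≡ f) where

    -- If the minimum `m` is attained by `v r` or by `c`, then `N c r` has valuation `2m` and is
    -- divisible by `π ^ f`; if it is attained by `f`, the bound is trivial.
    f≤m+m : f ℕ.≤ m ℕ.+ m
    f≤m+m = [ (λ vr → from-norm (inj₁ vr)) , [ (λ m≡c → from-norm (inj₂ (≡.sym m≡c))) , (λ { m≡f → ℕ.≤-trans (ℕ.≤-reflexive (≡.sym m≡f)) (ℕ.m≤m+n m m) }) ]′ ]′ m-sharp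
      where
      from-norm : v r ≡ [ + m ] ⊎ c ≡ m → f ℕ.≤ m ℕ.+ m
      from-norm h = ≼-≡ (v-N {m} {c} {r} m≼r m≤c h) (v≥-resp (trans (*-congʳ (reflexive (≡.cong (π ^_) (ℕ.n∸n≡0 c)))) (*-identityˡ _)) (Stable.norm-≼ R-stable))

    -- The second factor of the conductor contains `π ^ k` exactly when (0 , πᵏ) and (0 , πᵏω) lie
    -- in `R`, that is, when `f ≤ k`, `c ≤ k` and `π ^ f` divides `r * π ^ (k ∸ c)`. The least such
    -- `k` is `f + c - m`.
    f₂+m≡f+c : f₂ ℕ.+ m ≡ f ℕ.+ c
    f₂+m≡f+c = ℕ.≤-antisym upper lower
      where
      k = f ℕ.+ c ℕ.∸ m
      k+m : k ℕ.+ m ≡ f ℕ.+ c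
      k+m = ℕ.m∸n+n≡m (ℕ.≤-trans m≤f (ℕ.m≤m+n f c))
      f≤k : f ℕ.≤ k
      f≤k = ℕ.m+n≤o⇒m≤o∸n f (ℕ.+-monoʳ-≤ f m≤c)
      c≤k : c ℕ.≤ k
      c≤k = ℕ.m+n≤o⇒m≤o∸n c (ℕ.≤-trans (ℕ.+-monoʳ-≤ c m≤f) (ℕ.≤-reflexive (ℕ.+-comm c f)))
      in-conductor : ∀ {w} → E.𝒪 w → R (𝔼._*_ (0# , at (π ^ f₂) 0#) (0# , w))
      in-conductor {w} w∈ = O.resp (trans (*-congʳ (zeroʳ _)) refl , E.*-congʳ (E.trans (E.*-identityʳ _) (ι^≈at f₂)))
        (proj₂ (proj₂ conductor≐ {π ^ f₁ * 0# , E.ι π E.^ f₂ E.* E.1#} ((0# , v≥-0 , refl) , (E.1# , VE.𝒪-1 , E.refl))) (v≥-0 , w∈))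
      f≤f₂ : f ℕ.≤ f₂
      f≤f₂ = ≼-≡ (vπ^ f₂) (v≥-resp (solve 2 (λ x r → :- (con (+ 0) :* con (+ 0) :- (x :+ r :* con (+ 0))) := x) refl (π ^ f₂) r) (v≥-neg (proj₂ (proj₂
        (L-at {f} {c} {r} (L-resp {f} {c} {r} (refl , E.trans (at-* _ _ _ _) (at-cong
            (solve 2 (λ x n → x :* con (+ 1) :- n :* (con (+ 0) :* con (+ 0)) := x) refl (π ^ f₂) n)
            (solve 3 (λ x t p → x :* con (+ 0) :+ con (+ 0) :* con (+ 1) :+ t :* (con (+ 0) :* con (+ 0)) := p :* con (+ 0)) refl (π ^ f₂) t (π ^ c))))
          (R⊆L (in-conductor (𝒪-at 𝒪-1 v≥-0)))))))))
      πω∈ : L f c r (0# * 0# , at 0# (π ^ f₂))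
      πω∈ = L-resp {f} {c} {r} (refl , E.trans (at-* _ _ _ _) (at-cong
          (solve 2 (λ x n → x :* con (+ 0) :- n :* (con (+ 0) :* con (+ 1)) := con (+ 0)) refl (π ^ f₂) n)
          (solve 2 (λ x t → x :* con (+ 1) :+ con (+ 0) :* con (+ 0) :+ t :* (con (+ 0) :* con (+ 1)) := x) refl (π ^ f₂) t)))
        (R⊆L (in-conductor (𝒪-at v≥-0 𝒪-1)))
      c≤f₂ : c ℕ.≤ f₂
      c≤f₂ = ≼-≡ (vπ^ f₂) (L-b {f} {c} {r} πω∈)
      split : π ^ f₂ ≈ π ^ c * π ^ (f₂ ℕ.∸ c)
      split = trans (reflexive (≡.cong (π ^_) (≡.sym (ℕ.m+[n∸m]≡n c≤f₂)))) (π^-+ c (f₂ ℕ.∸ c))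
      f≼rπ : f ≼ r * π ^ (f₂ ℕ.∸ c)
      f≼rπ = v≥-resp (solve 2 (λ p r → :- (con (+ 0) :* con (+ 0) :- (con (+ 0) :+ r :* p)) := r :* p) refl (π ^ (f₂ ℕ.∸ c)) r)
        (v≥-neg (proj₂ (proj₂ (L-at {f} {c} {r} (L-resp {f} {c} {r} (refl , at-cong refl split) πω∈)))))
      lower : f ℕ.+ c ℕ.≤ f₂ ℕ.+ m
      lower = [ (λ vr → ℕ.≤-trans (ℕ.+-monoˡ-≤ c (≼-≡ (v-*-≡ vr (vπ^ (f₂ ℕ.∸ c))) f≼rπ))
                         (ℕ.≤-reflexive (≡.trans (ℕ.+-assoc m (f₂ ℕ.∸ c) c) (≡.trans (≡.cong (m ℕ.+_) (ℕ.m∸n+n≡m c≤f₂)) (ℕ.+-comm m f₂)))))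
              , [ (λ m≡c → ℕ.+-mono-≤ f≤f₂ (ℕ.≤-reflexive (≡.sym m≡c)))
                , (λ m≡f → ℕ.≤-trans (ℕ.≤-reflexive (ℕ.+-comm f c)) (ℕ.+-mono-≤ c≤f₂ (ℕ.≤-reflexive (≡.sym m≡f)))) ]′ ]′ m-sharp
      splitₖ : π ^ k ≈ π ^ c * π ^ (k ℕ.∸ c)
      splitₖ = trans (reflexive (≡.cong (π ^_) (≡.sym (ℕ.m+[n∸m]≡n c≤k)))) (π^-+ c (k ℕ.∸ c))
      f≼rπₖ : f ≼ r * π ^ (k ℕ.∸ c)
      f≼rπₖ = ≼-mono (ℕ.+-cancelʳ-≤ c f (m ℕ.+ (k ℕ.∸ c)) (ℕ.≤-reflexive (≡.trans (≡.sym k+m)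
          (≡.sym (≡.trans (ℕ.+-assoc m (k ℕ.∸ c) c) (≡.trans (≡.cong (m ℕ.+_) (ℕ.m∸n+n≡m c≤k)) (ℕ.+-comm m k)))))))
        (≼-* m≼r (≼-π^ {k ℕ.∸ c}))
      πᵏ∈ : conductor O (0# , at (π ^ k) 0#)
      πᵏ∈ = (v≥-0 , 𝒪-at (𝒪-π^ {k}) v≥-0) , λ {b} b∈ →
        let (p , q , eq) = coordinates (proj₂ b)
            (p∈ , q∈) = at-𝒪 (VE.v≥-resp eq (proj₂ b∈))
        in L⊆R (π ^ k * p , π ^ (k ℕ.∸ c) * q , ≼-*ˡ (𝒪-π^ {k}) p∈ , ≼-*ˡ (𝒪-π^ {k ℕ.∸ c}) q∈ ,
             E.trans (E.*-congˡ eq) (E.trans (at-* _ _ _ _) (at-cong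
               (solve 4 (λ x p q n → x :* p :- n :* (con (+ 0) :* q) := x :* p) refl (π ^ k) p q n)
               (trans (trans (+-congʳ (+-congʳ (*-congʳ splitₖ))) refl) (solve 5 (λ c d q p t → c :* d :* q :+ con (+ 0) :* p :+ t :* (con (+ 0) :* q) := c :* (d :* q)) refl (π ^ c) (π ^ (k ℕ.∸ c)) q p t)))) ,
             v≥-resp (solve 6 (λ b x p r d q → :- (x :* p :+ r :* d :* q) := con (+ 0) :* b :- (x :* p :+ r :* (d :* q))) refl (proj₁ b) (π ^ k) p r (π ^ (k ℕ.∸ c)) q)
               (v≥-neg (v≥-+ (≼-*ʳ (≼-mono f≤k (≼-π^ {k})) p∈) (≼-*ʳ f≼rπₖ q∈))))
      upper : f₂ ℕ.+ m ℕ.≤ f ℕ.+ c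
      upper = let (_ , (b , b∈ , eq)) = proj₁ conductor≐ πᵏ∈
                  (p , q , eq′) = coordinates b
                  (p∈ , _) = at-𝒪 (VE.v≥-resp eq′ b∈)
                  (πᵏ≈ , _) = at-injective (E.trans eq (E.trans (E.*-cong (E.trans (ι^≈at f₂) (E.sym (ι≈at (π ^ f₂)))) eq′) (at-scale (π ^ f₂) p q)))
              in ℕ.≤-trans (ℕ.+-monoˡ-≤ m (≼-≡ (exact-resp πᵏ≈ (vπ^ k)) (≼-*ʳ (≼-π^ {f₂}) p∈))) (ℕ.≤-reflexive k+m)

  -- The colength of the order

  open Exponents valuedField vπ hiding (Span)
  open OrderNormalForm F E′ vπ generator O {f₁} {f₂} conductor≐
  open Orders F E′ using (HasColength)
  open Submodules (Orders.E F E′) using (QuotientHasLength; done; step; _·_)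

  private
    submodule⇒module : ∀ {p} {M : Pred 𝔼 p} → IsSubmodule Δ𝔬 M → Is𝒪Module (M ∘ fromCoordinates)
    submodule⇒module isM = record
      { resp = λ x≈y → resp (x≈y (suc (suc zero)) , at-cong (x≈y (suc zero)) (x≈y zero))
      ; 0∈   = resp (refl , at-0) 0∈
      ; +∈   = λ {x} {y} x∈ y∈ → resp (𝔼.sym (from-+ x y)) (+-closed x∈ y∈)
      ; *∈   = λ {a} {x} a∈ x∈ → resp (𝔼.sym (from-* a x)) (*-closed (a , a∈ , 𝔼.refl) x∈)
      }
      where open IsSubmodule isM

    chain-⊆ : ∀ {p} {N : Pred 𝔼 p} {M k} → QuotientHasLength Δ𝔬 N M k → M ⊆ N
    chain-⊆ (done (M⊆N , _)) = M⊆N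
    chain-⊆ (step (_ , (M⊆M₁ , _) , _) rest) = chain-⊆ rest ∘ M⊆M₁

    𝒪ᴱ-exponents : HasExponents (0 ∷ 0 ∷ 0 ∷ []) (𝒪ᴱ ∘ fromCoordinates)
    𝒪ᴱ-exponents = HasExponents-resp (0 ∷ 0 ∷ 0 ∷ []) (L⊆𝒪ᴱ {0} {0} {0#} v≥-0)
      (λ {z} (x∈ , w∈) → let (y∈ , s∈) = at-𝒪 w∈ in
        z (suc zero) , z zero , y∈ , s∈ , at-cong refl (sym (*-identityˡ _)) , v≥-- x∈ (v≥-+ y∈ (≼-*ˡ v≥-0 s∈)))
      (L-exponents 0 0 0# v≥-0)

    -- the last power πⁱx outside M
    socle : ∀ {p p′} {M : Pred (V 3) p} {M₁ : Pred (V 3) p′} → Is𝒪Module M₁ → (∀ z → Dec (M z)) → ∀ e x → M₁ x → ¬ M x →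
            M (λ i → π ^ e * x i) → (∀ {x y} → (∀ i → x i ≈ y i) → M x → M y) → ∃[ y ] M₁ y × ¬ M y × M (λ i → π * y i)
    socle is₁ M? zero    x x∈ x∉ h resp = contradiction (resp (λ i → *-identityˡ (x i)) h) x∉
    socle is₁ M? (suc e) x x∈ x∉ h resp with M? (λ i → π ^ e * x i)
    ... | yes p = socle is₁ M? e x x∈ x∉ p resp
    ... | no ¬p = (λ i → π ^ e * x i) , Is𝒪Module.*∈ is₁ {π ^ e} {x} (𝒪-π^ {e}) x∈ , ¬p , resp (λ i → *-assoc π (π ^ e) (x i)) h

    -- A simple step adjoins one vector `x` with `πx ∈ M`, hence lowers the sum of the exponents by
    -- one, down to 0 for 𝒪ᴱ. Strictness and simplicity of a step are negations and yield no such
    -- `x` outright, so the conclusion is doubly negated; equality of natural numbers is stable.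
    chain-length : ∀ {M k} → QuotientHasLength Δ𝔬 𝒪ᴱ M k → Is𝒪Module (M ∘ fromCoordinates) → (∀ {x y} → x 𝔼.≈ y → M x → M y) →
      ∀ e → (∀ z → (∀ i → e ≼ z i) → M (fromCoordinates z)) → ∀ ks → HasExponents ks (M ∘ fromCoordinates) → ¬ ¬ (k ≡ Vec.sum ks)
    chain-length {M} (done (M⊆ , ⊆M)) isM respM e full ks exps ¬eq =
      ¬eq (≡.cong Vec.sum (HasExponents-unique (0 ∷ 0 ∷ 0 ∷ []) ks (HasExponents-resp (0 ∷ 0 ∷ 0 ∷ []) ⊆M M⊆ 𝒪ᴱ-exponents) exps))
    chain-length {M} (step {M₁ = M₁} (sub₁ , (M⊆M₁ , M₁⊈M) , simple) rest) isM respM e full ks exps ¬eq =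
      -- Under `¬eq` every element of `M₁` must lie in `M`: from one outside, `socle` produces an
      -- `x` outside `M` with `πx ∈ M`.
      M₁⊈M (λ {z} z∈ → respM (from∘to z) (decidable-stable (M? (toCoordinates z)) (λ z∉ →
        let (x , x∈ , x∉ , πx∈) = socle is₁ M? e (toCoordinates z) (resp₁ (𝔼.sym (from∘to z)) z∈) z∉
              (full _ (λ i → ≼-*ʳ (≼-π^ {e}) (integral₁ {toCoordinates z} (resp₁ (𝔼.sym (from∘to z)) z∈) i))) (Is𝒪Module.resp isM)
        in M₁⊆P⇒⊥ x x∈ x∉ πx∈)))
      where
      open IsSubmodule sub₁ using () renaming (resp to resp₁)
      is₁ = submodule⇒module sub₁
      M? = HasExponents⇒decidable isM ks exps
      integral₁ : ∀ {z} → M₁ (fromCoordinates z) → ∀ i → 𝒪 (z i)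
      integral₁ z∈ zero             = proj₂ (at-𝒪 (proj₂ (chain-⊆ rest z∈)))
      integral₁ z∈ (suc zero)       = proj₁ (at-𝒪 (proj₂ (chain-⊆ rest z∈)))
      integral₁ z∈ (suc (suc zero)) = proj₁ (chain-⊆ rest z∈)
      -- P is M + 𝔬x
      M₁⊆P⇒⊥ : ∀ x → M₁ (fromCoordinates x) → ¬ M (fromCoordinates x) → M (fromCoordinates (λ i → π * x i)) → _
      M₁⊆P⇒⊥ x x∈ x∉ πx∈ = simple (P , isP , (M⊆P , P⊈M) , (P⊆M₁ , λ M₁⊆P →
          -- If M + 𝔬x were all of `M₁`, the exponent sum of `M₁` would be one less and induction
          -- would give the length, against `¬eq`. So M + 𝔬x lies strictly between, which simplicity
          -- forbids.
          let (ls , exps₁ , eq) = adjoin-exponents ks isM is₁ (λ {z} → integral₁ {z}) M⊆M₁ x x∈ x∉ πx∈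
                (λ {z} z∈ → let (a , a∈ , m∈) = M₁⊆P {fromCoordinates z} z∈ in a , a∈ , Is𝒪Module.resp isM {λ i → toCoordinates (fromCoordinates z) i - a * x i} {λ i → z i - a * x i} (λ i → +-congʳ (from-injective {toCoordinates (fromCoordinates z)} {z} (from∘to (fromCoordinates z)) i)) m∈) exps
          in chain-length rest is₁ resp₁ e (λ z h → M⊆M₁ (full z h)) ls exps₁ (λ k≡ → ¬eq (≡.trans (≡.cong suc k≡) (≡.sym eq)))))
        where
        reduced : 𝔼 → Carrier → V 3
        reduced z a i = toCoordinates z i - a * x i
        P : Pred 𝔼 ℓ
        P z = ∃[ a ] 𝒪 a × M (fromCoordinates (reduced z a))
        open Is𝒪Module isM
        coordinates-of : ∀ {z′} z → z′ 𝔼.≈ fromCoordinates z → ∀ i → toCoordinates z′ i ≈ z i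
        coordinates-of {z′} z eq = from-injective {toCoordinates z′} {z} (𝔼.trans (from∘to z′) eq)
        isP : IsSubmodule Δ𝔬 P
        isP = record
          { resp     = λ {z} {z′} z≈ (a , a∈ , m∈) → a , a∈ , resp {reduced z a} {reduced z′ a}
              (λ i → +-congʳ (coordinates-of {z} (toCoordinates z′) (𝔼.trans z≈ (𝔼.sym (from∘to z′))) i)) m∈
          ; 0∈       = 0# , v≥-0 , resp {λ _ → 0#} {reduced 𝔼.0# 0#}
              (λ i → sym (trans (+-congʳ (coordinates-of {𝔼.0#} (λ _ → 0#) (refl , at-0) i)) (solve 1 (λ x → con (+ 0) :- con (+ 0) :* x := con (+ 0)) refl (x i)))) 0∈
          ; +-closed = λ {z} {z′} (a , a∈ , m∈) (a′ , a′∈ , m′∈) → a + a′ , v≥-+ a∈ a′∈ ,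
              resp {λ i → reduced z a i + reduced z′ a′ i} {reduced (z 𝔼.+ z′) (a + a′)}
                (λ i → trans (solve 5 (λ z a x z′ a′ → z :- a :* x :+ (z′ :- a′ :* x) := (z :+ z′) :- (a :+ a′) :* x) refl (toCoordinates z i) a (x i) (toCoordinates z′ i) a′)
                  (+-congʳ (sym (coordinates-of {z 𝔼.+ z′} (λ i → toCoordinates z i + toCoordinates z′ i)
                    (𝔼.trans (𝔼.+-cong (𝔼.sym (from∘to z)) (𝔼.sym (from∘to z′))) (𝔼.sym (from-+ (toCoordinates z) (toCoordinates z′)))) i))))
                (+∈ {reduced z a} {reduced z′ a′} m∈ m′∈)
          ; *-closed = λ {d} {z} (δ , δ∈ , d≈) (a , a∈ , m∈) → δ * a , ≼-*ˡ δ∈ a∈ ,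
              resp {λ i → δ * reduced z a i} {reduced (d 𝔼.* z) (δ * a)}
                (λ i → trans (solve 4 (λ d z a x → d :* (z :- a :* x) := d :* z :- d :* a :* x) refl δ (toCoordinates z i) a (x i))
                  (+-congʳ (sym (coordinates-of {d 𝔼.* z} (λ i → δ * toCoordinates z i) (𝔼.trans (𝔼.*-cong d≈ (𝔼.sym (from∘to z))) (𝔼.sym (from-* δ (toCoordinates z)))) i))))
                (*∈ {δ} {reduced z a} δ∈ m∈)
          }
        M⊆P : M ⊆ P
        M⊆P {z} z∈ = 0# , v≥-0 , resp {toCoordinates z} {reduced z 0#} (λ i → solve 2 (λ z x → z := z :- con (+ 0) :* x) refl (toCoordinates z i) (x i)) (respM (𝔼.sym (from∘to z)) z∈)
        x∈P : P (fromCoordinates x)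
        x∈P = 1# , 𝒪-1 , resp {λ _ → 0#} {reduced (fromCoordinates x) 1#}
          (λ i → sym (trans (+-congʳ (coordinates-of {fromCoordinates x} x 𝔼.refl i)) (solve 1 (λ x → x :- con (+ 1) :* x := con (+ 0)) refl (x i)))) 0∈
        P⊈M : ¬ (P ⊆ M)
        P⊈M P⊆M = x∉ (P⊆M x∈P)
        P⊆M₁ : P ⊆ M₁
        P⊆M₁ {z} (a , a∈ , m∈) = resp₁ (from∘to z) (Is𝒪Module.resp is₁ {λ i → reduced z a i + a * x i} {toCoordinates z}
          (λ i → solve 3 (λ z a x → z :- a :* x :+ a :* x := z) refl (toCoordinates z i) a (x i))
          (Is𝒪Module.+∈ is₁ {reduced z a} {λ i → a * x i} (M⊆M₁ m∈) (Is𝒪Module.*∈ is₁ {a} {x} a∈ x∈)))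

  colength : ∀ {S} → HasColength O S → S ≡ f ℕ.+ c
  colength {S} h = decidable-stable (S ℕ.≟ f ℕ.+ c) (λ S≢ → chain-length h (IsLattice.isModule R-isLattice) O.resp (f₁ ℕ.+ f₂)
    (λ z p → R-full (p (suc (suc zero))) (p (suc zero)) (p zero)) (c ∷ 0 ∷ f ∷ [])
    (HasExponents-resp (c ∷ 0 ∷ f ∷ []) L⊆R R⊆L (L-exponents f c r r∈𝒪))
    (λ eq → S≢ (≡.trans eq (≡.trans (≡.cong (c ℕ.+_) (ℕ.+-identityʳ f)) (ℕ.+-comm c f)))))

  -- Normal forms of fractional ideals

  open FractionalIdeal using (I)

  private
    -- R is generated over 𝔬 by 1, ρ and ε
    ρ ε : 𝔼
    ρ = r , at 0# (π ^ c)
    ε = π ^ f , E.0#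

    ρ∈ : R ρ
    ρ∈ = L⊆R (L-θ {f} {c} {r})

    ε∈ : R ε
    ε∈ = L⊆R (L-ε {f} {c} {r} (≼-π^ {f}))

    R-combination : ∀ {z} → R z → ∃[ p ] ∃[ q ] ∃[ u ] 𝒪 p × 𝒪 q × 𝒪 u × z 𝔼.≈ diagonal p 𝔼.+ (diagonal q 𝔼.* ρ 𝔼.+ diagonal u 𝔼.* ε)
    R-combination {x , w} z∈ =
      let (y , s , y∈ , s∈ , eq , h) = R⊆L z∈
          (u , u∈ , x≈) = divide≼ f h
      in y , s , u , y∈ , s∈ , u∈ ,
         trans (solve 4 (λ x y s r → x := y :+ (s :* r :+ (x :- (y :+ r :* s)))) refl x y s r) (+-congˡ (+-congˡ (trans x≈ (*-comm _ _)))) ,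
         E.trans eq (E.sym (E.trans (E.+-cong (ι≈at y) (E.trans (E.+-congˡ (E.zeroʳ _)) (E.trans (E.+-identityʳ _) (at-scale s 0# (π ^ c)))))
           (E.trans (at-+ _ _ _ _) (at-cong (solve 2 (λ y s → y :+ s :* con (+ 0) := y) refl y s) (solve 2 (λ p s → con (+ 0) :+ s :* p := p :* s) refl (π ^ c) s)))))
      where open E using (ι)

    generators : 𝔼 → List (V 3)
    generators h = toCoordinates h ∷ toCoordinates (ρ 𝔼.* h) ∷ toCoordinates (ε 𝔼.* h) ∷ []

    -- Turns finite generation over `R` into finite generation over 𝔬, the form in which
    -- `normal-form` needs it.
    R-multiple : ∀ {z} h → R z → Spanᴱ (generators h) (z 𝔼.* h)
    R-multiple {z} h z∈ =
      let (p , q , u , p∈ , q∈ , u∈ , eq) = R-combination z∈ in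
      Spanᴱ-resp (generators h)
        (𝔼.trans (𝔼.+-congˡ (𝔼.+-cong (𝔼.sym (𝔼.*-assoc _ _ _)) (𝔼.sym (𝔼.*-assoc _ _ _))))
          (𝔼.trans (𝔼.+-congˡ (𝔼.sym (𝔼.distribʳ h _ _))) (𝔼.trans (𝔼.sym (𝔼.distribʳ h _ _)) (𝔼.*-congʳ (𝔼.sym eq)))))
        (Spanᴱ-++ (toCoordinates h ∷ []) (Spanᴱ-[ h ] p∈) (Spanᴱ-++ (toCoordinates (ρ 𝔼.* h) ∷ []) (Spanᴱ-[ ρ 𝔼.* h ] q∈) (Spanᴱ-[ ε 𝔼.* h ] u∈)))

  module _ (J : FractionalIdeal O) where
    private
      module J = FractionalIdeal J
      open IsSubmodule J.isSubmodule using () renaming (resp to respJ; +-closed to +J; *-closed to *J)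
      k = proj₁ J.finitelyGenerated
      h : Fin k → 𝔼
      h = proj₁ (proj₂ J.finitelyGenerated)
      J⊆ = proj₁ (proj₂ (proj₂ J.finitelyGenerated))
      ⊆J = proj₂ (proj₂ (proj₂ J.finitelyGenerated))

      h∈ : ∀ i → J.I (h i)
      h∈ i = ⊆J (generator∈Span {K = R} (IsLattice.0∈ R-isLattice) O.1∈ h i)

      closed : ∀ {p} (P : Pred 𝔼 p) → (∀ {x y} → x 𝔼.≈ y → P x → P y) → P 𝔼.0# → (∀ x y → P x → P y → P (x 𝔼.+ y)) →
               (∀ i {z} → R z → P (z 𝔼.* h i)) → ∀ {z} → J.I z → P z
      closed P resp P0 P+ gen z∈ = let (a , a∈ , eq) = J⊆ z∈ in
        resp (𝔼.sym eq) (sum-closed P P0 P+ (λ i → a i 𝔼.* h i) (λ i → gen i (a∈ i)))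

      -- `P` is an ideal of E without 1, such as the elements with vanishing first component. If it
      -- contained all generators, it would contain F·J = E.
      nonzero : ∀ {p} (P : Pred 𝔼 p) → (∀ {x y} → x 𝔼.≈ y → P x → P y) → P 𝔼.0# → (∀ x y → P x → P y → P (x 𝔼.+ y)) →
                (∀ {x} y → P x → P (y 𝔼.* x)) → ¬ P 𝔼.1# → ¬ (∀ i → P (h i))
      nonzero P resp P0 P+ P* ¬P1 Ph =
        let (k′ , g , g∈ , a , _ , eq) = J.full 𝔼.1# in
        ¬P1 (resp (𝔼.sym eq) (sum-closed P P0 P+ (λ i → a i 𝔼.* g i) (λ i → P* (a i) (closed P resp P0 P+ (λ i _ → P* _ (Ph i)) (g∈ i)))))

      bounded₁ : ∀ {n} → (∀ j → v≥ n (proj₁ (h j))) → ∀ {z} → J.I z → v≥ n (proj₁ z)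
      bounded₁ {n} p = closed (v≥ n ∘ proj₁) (λ e → v≥-resp (proj₁ e)) v≥-0 (λ _ _ → v≥-+) (λ i z∈ → v≥-*ˡ (proj₁ (R⊆𝒪ᴱ z∈)) (p i))

      bounded₂ : ∀ {n} → (∀ j → E.v≥ n (proj₂ (h j))) → ∀ {z} → J.I z → E.v≥ n (proj₂ z)
      bounded₂ {n} p = closed (E.v≥ n ∘ proj₂) (λ e → VE.v≥-resp (proj₂ e)) VE.v≥-0 (λ _ _ → VE.v≥-+) (λ i z∈ → VE.v≥-*ˡ (proj₂ (R⊆𝒪ᴱ z∈)) (p i))

      minimum₁ : ∃[ n ] ∃[ z ] J.I z × v (proj₁ z) ≡ [ n ] × (∀ {z} → J.I z → v≥ n (proj₁ z))
      minimum₁ with finite-minimum (proj₁ ∘ h)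
      ... | inj₂ (i , n , eq , p) = n , h i , h∈ i , eq , bounded₁ p
      ... | inj₁ zs = contradiction zs (nonzero (λ z → proj₁ z ≈ 0#) (λ e p → trans (sym (proj₁ e)) p) refl
                        (λ _ _ p q → trans (+-cong p q) (+-identityʳ 0#)) (λ y p → trans (*-congˡ p) (zeroʳ (proj₁ y))) 1≉0)

      minimum₂ : ∃[ n ] ∃[ z ] J.I z × E.v (proj₂ z) ≡ [ n ] × (∀ {z} → J.I z → E.v≥ n (proj₂ z))
      minimum₂ with VE.finite-minimum (proj₂ ∘ h)
      ... | inj₂ (i , n , eq , p) = n , h i , h∈ i , eq , bounded₂ p
      ... | inj₁ zs = contradiction zs (nonzero (λ z → proj₂ z E.≈ E.0#) (λ e p → E.trans (E.sym (proj₂ e)) p) E.refl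
                        (λ _ _ p q → E.trans (E.+-cong p q) (E.+-identityʳ E.0#)) (λ y p → E.trans (E.*-congˡ p) (E.zeroʳ (proj₂ y))) E.1≉0)

      record Minimal : Set (Level.suc ℓ) where
        field
          z     : 𝔼
          n₁ n₂ : ℤ
          z∈    : J.I z
          vz₁   : v (proj₁ z) ≡ [ n₁ ]
          vz₂   : E.v (proj₂ z) ≡ [ n₂ ]
          J≥₁   : ∀ {w} → J.I w → v≥ n₁ (proj₁ w)
          J≥₂   : ∀ {w} → J.I w → E.v≥ n₂ (proj₂ w)

      -- Take `z` minimal in the first component and `z′` minimal in the second. If neither is
      -- minimal in both, then in each component one of them has strictly larger valuation than the
      -- other, so `z + z′` is minimal in both.
      minimal : Minimal
      minimal with minimum₁ | minimum₂
      ... | n₁ , z , z∈ , vz , J≥₁ | n₂ , z′ , z′∈ , vz′ , J≥₂ with v≥? (1ℤ ℤ.+ n₁) (proj₁ z′) | VE.v≥? (1ℤ ℤ.+ n₂) (proj₂ z)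
      ... | no ¬p | _     = record { z∈ = z′∈ ; vz₁ = exactℤ (J≥₁ z′∈) ¬p ; vz₂ = vz′ ; J≥₁ = J≥₁ ; J≥₂ = J≥₂ }
      ... | yes _ | no ¬q = record { z∈ = z∈ ; vz₁ = vz ; vz₂ = VE.exactℤ (J≥₂ z∈) ¬q ; J≥₁ = J≥₁ ; J≥₂ = J≥₂ }
      ... | yes p | yes q = record { z = z 𝔼.+ z′ ; z∈ = +J z∈ z′∈ ; vz₁ = exactℤ-+ vz p
        ; vz₂ = ≡.trans (E.v-cong (E.+-comm (proj₂ z) (proj₂ z′))) (VE.exactℤ-+ vz′ q) ; J≥₁ = J≥₁ ; J≥₂ = J≥₂ }

      module Division (min : Minimal) where
        open Minimal min
        z⁻¹ : 𝔼
        z⁻¹ = proj₁ (inverse vz₁) , proj₁ (VE.inverse vz₂)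
        zz⁻¹ : z 𝔼.* z⁻¹ 𝔼.≈ 𝔼.1#
        zz⁻¹ = proj₁ (proj₂ (inverse vz₁)) , proj₁ (proj₂ (VE.inverse vz₂))
        cancel : ∀ w → z 𝔼.* (z⁻¹ 𝔼.* w) 𝔼.≈ w
        cancel w = 𝔼.trans (𝔼.sym (𝔼.*-assoc z z⁻¹ w)) (𝔼.trans (𝔼.*-congʳ zz⁻¹) (𝔼.*-identityˡ w))
        cancel⁻¹ : ∀ w → z⁻¹ 𝔼.* (z 𝔼.* w) 𝔼.≈ w
        cancel⁻¹ w = 𝔼.trans (𝔼.sym (𝔼.*-assoc z⁻¹ z w)) (𝔼.trans (𝔼.*-congʳ (𝔼.trans (𝔼.*-comm z⁻¹ z) zz⁻¹)) (𝔼.*-identityˡ w))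
        K : Pred 𝔼 ℓ
        K w = J.I (z 𝔼.* w)
        K-resp : ∀ {x y} → x 𝔼.≈ y → K x → K y
        K-resp e = respJ (𝔼.*-congˡ e)
        K-* : ∀ {x y} → R x → K y → K (x 𝔼.* y)
        K-* {x} {y} x∈ y∈ = respJ (𝔼.trans (𝔼.sym (𝔼.*-assoc x z y)) (𝔼.trans (𝔼.*-congʳ (𝔼.*-comm x z)) (𝔼.*-assoc z x y))) (*J x∈ y∈)
        R⊆K : ∀ {x} → R x → K x
        R⊆K {x} x∈ = respJ (𝔼.*-comm x z) (*J x∈ z∈)
        K-isLattice : IsLattice K
        K-isLattice = record
          { resp = K-resp ; +-closed = λ x∈ y∈ → respJ (𝔼.sym (𝔼.distribˡ z _ _)) (+J x∈ y∈)
          ; scale = λ c∈ x∈ → K-* (O.𝔬⊆ (_ , c∈ , 𝔼.refl)) x∈ ; 1∈ = R⊆K O.1∈ }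
        K⊆𝒪ᴱ : ∀ {w} → K w → 𝒪ᴱ w
        K⊆𝒪ᴱ {w} w∈ =
          v≥-resp (proj₁ (cancel⁻¹ w)) (quotient-integral vz₁ (proj₁ zz⁻¹) (≡.subst (λ i → i ≤∞ v (proj₁ z * proj₁ w)) (≡.sym vz₁) (J≥₁ w∈))) ,
          VE.v≥-resp (proj₂ (cancel⁻¹ w)) (VE.quotient-integral vz₂ (proj₂ zz⁻¹) (≡.subst (λ i → i ≤∞ E.v (proj₂ z E.* proj₂ w)) (≡.sym vz₂) (J≥₂ w∈)))
        gens∈ : ∀ i → K (z⁻¹ 𝔼.* h i)
        gens∈ i = respJ (𝔼.sym (cancel (h i))) (h∈ i)
        K-span : ∀ {w} → K w → Spanᴱ (List.concat (List.tabulate (λ i → generators (z⁻¹ 𝔼.* h i)))) w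
        K-span {w} w∈ = let (a , a∈ , eq) = J⊆ w∈ in
          Spanᴱ-resp _ (𝔼.trans (sum-cong-≋ (λ i → shuffle (a i) (h i))) (𝔼.trans (𝔼.sym (*-distribˡ-sum z⁻¹ (λ i → a i 𝔼.* h i))) (𝔼.trans (𝔼.*-congˡ (𝔼.sym eq)) (cancel⁻¹ w))))
            (Spanᴱ-sum (λ i → generators (z⁻¹ 𝔼.* h i)) (λ i → a i 𝔼.* (z⁻¹ 𝔼.* h i)) (λ i → R-multiple (z⁻¹ 𝔼.* h i) (a∈ i)))
          where
          shuffle : ∀ x y → x 𝔼.* (z⁻¹ 𝔼.* y) 𝔼.≈ z⁻¹ 𝔼.* (x 𝔼.* y)
          shuffle x y = 𝔼.trans (𝔼.sym (𝔼.*-assoc x z⁻¹ y)) (𝔼.trans (𝔼.*-congʳ (𝔼.*-comm x z⁻¹)) (𝔼.*-assoc z⁻¹ x y))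

        normal-form-K : ∃[ a ] ∃[ b ] ∃[ β ] 𝒪 β × K ≐ L a b β
        normal-form-K = normal-form K-isLattice K⊆𝒪ᴱ (f₁ ℕ.+ f₂)
          (λ px py ps → R⊆K (R-full px py ps)) (List.concat (List.tabulate (λ i → generators (z⁻¹ 𝔼.* h i))))
          (All.concat⁺ (All.tabulate⁺ (λ i → K-resp (𝔼.sym (from∘to _)) (gens∈ i) ∷ K-resp (𝔼.sym (from∘to _)) (K-* ρ∈ (gens∈ i)) ∷
             K-resp (𝔼.sym (from∘to _)) (K-* ε∈ (gens∈ i)) ∷ [])))
          K-span

        homothetic-K : ∀ {a b β} → K ≐ L a b β → Homothetic (L a b β) J.I
        homothetic-K (K⊆L , L⊆K) = record
          { factor = z ; factor⁻¹ = z⁻¹ ; inverseʳ = zz⁻¹ ; to = L⊆K ; from = λ {w} w∈ → K⊆L (respJ (𝔼.sym (cancel w)) w∈) }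

        stable-K : ∀ {a b β} → 𝒪 β → K ≐ L a b β → Stable f c r a b β
        stable-K {a} {b} {β} β∈ (K⊆L , L⊆K) = stable⇐ {f} {c} {r} {a} {b} {β} β∈ (λ {x} {y} ρ∈ x∈ → K⊆L (K-* {x} {y} (L⊆R ρ∈) (L⊆K x∈)))

    normal-form-ideal : ∃[ a ] ∃[ b ] ∃[ β ] 𝒪 β × Stable f c r a b β × Homothetic (L a b β) J.I
    normal-form-ideal = finish normal-form-K
      where
      open Division minimal
      finish : ∃[ a ] ∃[ b ] ∃[ β ] 𝒪 β × K ≐ L a b β → ∃[ a ] ∃[ b ] ∃[ β ] 𝒪 β × Stable f c r a b β × Homothetic (L a b β) J.I
      finish (a , b , β , β∈ , K≐L) = a , b , β , β∈ , stable-K {a} {b} {β} β∈ K≐L , homothetic-K {a} {b} {β} K≐L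

  ideal : ∀ {a b β} → 𝒪 β → Stable f c r a b β → FractionalIdeal O
  ideal {a} {b} {β} β∈ stable = record
    { I = L a b β
    ; isSubmodule = record { resp = L-resp {a} {b} {β} ; 0∈ = L-0 {a} {b} {β} ; +-closed = L-+ {a} {b} {β} ; *-closed = L-* }
    ; finitelyGenerated = 3 , g , L⊆Span , Span⊆L
    ; full = full
    }
    where
    L-* : ∀ {x y} → R x → L a b β y → L a b β (x 𝔼.* y)
    L-* x∈ y∈ = stable⇒ {f} {c} {r} {a} {b} {β} β∈ stable (R⊆L x∈) y∈
    g : Fin 3 → 𝔼
    g zero             = 𝔼.1#
    g (suc zero)       = β , at 0# (π ^ b)
    g (suc (suc zero)) = π ^ a , E.0#
    g∈ : ∀ i → L a b β (g i)
    g∈ zero             = L-1 {a} {b} {β}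
    g∈ (suc zero)       = L-θ {a} {b} {β}
    g∈ (suc (suc zero)) = L-ε {a} {b} {β} (≼-π^ {a})
    Span⊆L : Span R g ⊆ L a b β
    Span⊆L (u , u∈ , eq) = L-resp {a} {b} {β} (𝔼.sym eq) (sum-closed (L a b β) (L-0 {a} {b} {β}) (λ x y → L-+ {a} {b} {β} {x} {y}) (λ i → u i 𝔼.* g i) (λ i → L-* (u∈ i) (g∈ i)))
    coefficients : Carrier → Carrier → Carrier → Fin 3 → 𝔼
    coefficients y s μ zero             = diagonal y
    coefficients y s μ (suc zero)       = diagonal s
    coefficients y s μ (suc (suc zero)) = diagonal μ
    expansion : ∀ {x w y s μ} → w E.≈ at y (π ^ b * s) → x - (y + β * s) ≈ π ^ a * μ → (x , w) 𝔼.≈ sum (λ i → coefficients y s μ i 𝔼.* g i)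
    expansion {x} {w} {y} {s} {μ} eq x≈ =
      trans (solve 4 (λ x y s β → x := y :* con (+ 1) :+ (s :* β :+ (x :- (y :+ β :* s)))) refl x y s β) (+-congˡ (+-congˡ (trans x≈ (trans (*-comm _ _) (sym (+-identityʳ _)))))) ,
      E.trans eq (E.sym (E.trans (E.+-cong (E.trans (E.*-identityʳ _) (ι≈at y)) (E.trans (E.+-cong (at-scale s 0# (π ^ b)) (E.trans (E.+-identityʳ _) (E.zeroʳ _))) (E.+-identityʳ _)))
        (E.trans (at-+ _ _ _ _) (at-cong (solve 2 (λ y s → y :+ s :* con (+ 0) := y) refl y s) (solve 2 (λ p s → con (+ 0) :+ s :* p := p :* s) refl (π ^ b) s)))))
    coefficients∈ : ∀ {p} (P : Pred 𝔼 p) {y s μ} → P (diagonal y) → P (diagonal s) → P (diagonal μ) → ∀ i → P (coefficients y s μ i)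
    coefficients∈ P py ps pμ zero             = py
    coefficients∈ P py ps pμ (suc zero)       = ps
    coefficients∈ P py ps pμ (suc (suc zero)) = pμ
    diagonal∈R : ∀ {y} → 𝒪 y → R (diagonal y)
    diagonal∈R y∈ = O.𝔬⊆ (_ , y∈ , 𝔼.refl)
    L⊆Span : L a b β ⊆ Span R g
    L⊆Span {x , w} (y , s , y∈ , s∈ , eq , p) = let (μ , μ∈ , x≈) = divide≼ a p in
      coefficients y s μ , coefficients∈ R (diagonal∈R y∈) (diagonal∈R s∈) (diagonal∈R μ∈) , expansion eq x≈
    full : ∀ z → (ΔF · L a b β) z
    full (x , w) = let (y , s₀ , eq) = coordinates w
                       (s , s₀≈) = divide b s₀
                       (μ , x≈) = divide a (x - (y + β * s))
                   in 3 , g , g∈ , coefficients y s μ , coefficients∈ ΔF (y , 𝔼.refl) (s , 𝔼.refl) (μ , 𝔼.refl) , expansion (E.trans eq (at-cong refl s₀≈)) x≈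

-- Homothety classes of stable parameters for fixed a and b

module Counting {ℓ} (F : NonArchimedeanLocalField ℓ) (E′ : UnramifiedQuadraticExtension F)
    {π} (vπ : NonArchimedeanLocalField.IsUniformizer F π) (generator : IntegralGenerator F E′)
    (q≥1 : 1 ℕ.≤ NonArchimedeanLocalField.q F) where
  open NonArchimedeanLocalField F hiding (zero)
  open Valuation valuedField
  open Uniformizer vπ
  open Residues F vπ hiding (q≥1)
  open IntegerRingSolver commutativeRing using (solve; con; _:+_; _:*_; _:-_; :-_; _:=_)
  open IntegralGenerator generator using (t; n; t-𝒪; n-𝒪)
  open Lattices F E′ vπ generator

  open Formula q q≥1 using (count; count-≤; count->)
  open Count q q≥1 using (level; count≤; count>)

  Homothetic-β : ℕ → ℕ → Carrier → Carrier → Set ℓ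
  Homothetic-β a b β β′ = 𝒪 β × 𝒪 β′ × Homothetic (L a b β) (L a b β′)

  private
    Hom-sym : ∀ {a b β β′} → Homothetic-β a b β β′ → Homothetic-β a b β′ β
    Hom-sym (p , q , h) = q , p , Homothetic-sym h

  sphere-classes : ∀ k → Enumeration (_≡_mod (k ℕ.+ k)) (λ β → v β ≡ [ + k ]) (level k)
  sphere-classes zero    = singleton 1# v1 (λ vβ → v≥-- (≡⇒v≥ vβ) 𝒪-1)
  sphere-classes (suc k) = ≡.subst (λ e → Enumeration (_≡_mod e) (λ β → v β ≡ [ + suc k ]) (level (suc k))) (≡.cong suc (≡.sym (ℕ.+-suc k k))) (sphere-enumeration k (suc k))

  -- A homothety forces congruence because `N b β′` is divisible by `π ^ (k + k)`. Conversely,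
  -- congruence modulo πᵃ is enough with factor 1; when `a` exceeds `k + k`, `cases` makes both
  -- norms have valuation exactly `k + k`, and `close⇒homothetic` applies.
  homothetic⇔congruent : ∀ {a b β β′} k → k ℕ.≤ b → 𝒪 β → 𝒪 β′ → k ≼ β → k ≼ β′ →
    (a ℕ.≤ k ℕ.+ k ⊎ (v β ≡ [ + k ] × v β′ ≡ [ + k ]) ⊎ b ≡ k) →
    (β ≡ β′ mod ((k ℕ.+ k) ℕ.⊓ a) → Homothetic-β a b β β′) × (Homothetic-β a b β β′ → β ≡ β′ mod ((k ℕ.+ k) ℕ.⊓ a))
  homothetic⇔congruent {a} {b} {β} {β′} k k≤b β∈ β′∈ k≼β k≼β′ cases =
    (λ p → β∈ , β′∈ , to p) , (λ (_ , _ , h) → homothetic⇒close {a} {b} β∈ β′∈ h (ℕ.m⊓n≤n (k ℕ.+ k) a) (≼-mono (ℕ.m⊓n≤m (k ℕ.+ k) a) (≼-N {k} {b} k≼β′ k≤b)))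
    where
    close : v β ≡ [ + k ] × v β′ ≡ [ + k ] ⊎ b ≡ k → k ℕ.+ k ≼ β - β′ → Homothetic (L a b β) (L a b β′)
    close h = close⇒homothetic {a} {b} β∈ β′∈ (v-N {k} {b} k≼β k≤b ([ inj₁ ∘ proj₁ , inj₂ ]′ h)) (v-N {k} {b} k≼β′ k≤b ([ inj₁ ∘ proj₂ , inj₂ ]′ h))
    to : β ≡ β′ mod ((k ℕ.+ k) ℕ.⊓ a) → Homothetic (L a b β) (L a b β′)
    to p = [ exactly-a , (λ k+k≤a → [ exactly-a , (λ h → close h (≡.subst (_≼ β - β′) (ℕ.m≤n⇒m⊓n≡m k+k≤a) p)) ]′ cases) ]′ (ℕ.≤-total a (k ℕ.+ k))
      where
      exactly-a : a ℕ.≤ k ℕ.+ k → Homothetic (L a b β) (L a b β′)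
      exactly-a a≤ = congruent⇒homothetic {a} {b} (≡.subst (_≼ β - β′) (ℕ.m≥n⇒m⊓n≡n a≤) p)

  module _ {f c r m} (m≤c : m ℕ.≤ c) (r∈𝒪 : 𝒪 r) (m≼r : m ≼ r) (m-sharp : v r ≡ [ + m ] ⊎ m ≡ c ⊎ m ≡ f) where

    StableSet : ℕ → ℕ → Pred Carrier _
    StableSet a b β = 𝒪 β × Stable f c r a b β

    module _ {a b} (a≤f : a ℕ.≤ f) (b≤c : b ℕ.≤ c) where
      private
        d : ℕ
        d = c ℕ.∸ b

        b+d≡c : b ℕ.+ d ≡ c
        b+d≡c = ℕ.m+[n∸m]≡n b≤c

        πᶜ≈ : π ^ c ≈ π ^ d * π ^ b
        πᶜ≈ = trans (reflexive (≡.cong (π ^_) (≡.trans (≡.sym b+d≡c) (ℕ.+-comm b d)))) (π^-+ d b)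

      module _ (a≤m : a ℕ.≤ m) where
        private
          h g : ℕ
          h = ℕ.⌊ a /2⌋
          g = ℕ.⌈ a /2⌉

          h+g≡a : h ℕ.+ g ≡ a
          h+g≡a = ℕ.⌊n/2⌋+⌈n/2⌉≡n a

          a≤g+g : a ℕ.≤ g ℕ.+ g
          a≤g+g = ℕ.≤-trans (ℕ.≤-reflexive (≡.sym h+g≡a)) (ℕ.+-monoˡ-≤ g (ℕ.⌊n/2⌋≤⌈n/2⌉ a))

          g≤1+h : g ℕ.≤ suc h
          g≤1+h = half a
            where
            half : ∀ a → ℕ.⌈ a /2⌉ ℕ.≤ suc ℕ.⌊ a /2⌋
            half zero          = z≤n
            half (suc zero)    = s≤s z≤n
            half (suc (suc a)) = s≤s (half a)

          a≤c : a ℕ.≤ b ℕ.+ d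
          a≤c = ℕ.≤-trans a≤m (ℕ.≤-trans m≤c (ℕ.≤-reflexive (≡.sym b+d≡c)))

          -- For `a ≤ m` the number `r` vanishes modulo πᵃ, so the congruence is the hypothesis. In
          -- `π ^ d * N b β` the terms with `β` contain `π ^ d * β` and the last one contains
          -- `π ^ c`, where `a ≤ m ≤ c`.
          stable-from : ∀ {β} → 𝒪 β → a ≼ π ^ d * β → StableSet a b β
          stable-from {β} β∈ p = β∈ , record
            { b≤c = b≤c ; a≤f = a≤f ; congruent = v≥-- p (≼-mono a≤m m≼r)
            ; norm-≼ = v≥-resp (trans (+-congˡ (*-congʳ πᶜ≈)) (solve 6 (λ d β t b n r → (d :* β) :* (β :- t :* b) :+ (d :* b) :* (n :* b)
                := d :* (β :* β :- t :* (β :* b) :+ n :* (b :* b))) refl (π ^ d) β t (π ^ b) n r))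
                (v≥-+ (≼-*ʳ p (v≥-- β∈ (≼-*ˡ t-𝒪 (𝒪-π^ {b})))) (≼-*ʳ (≼-mono (ℕ.≤-trans a≤m m≤c) (≼-π^ {c})) (≼-*ˡ n-𝒪 (𝒪-π^ {b})))) }

          stable-to : ∀ {β} → StableSet a b β → a ≼ π ^ d * β
          stable-to {β} (β∈ , st) = v≥-resp (solve 2 (λ x r → (x :- r) :+ r := x) refl (π ^ d * β) r) (v≥-+ (Stable.congruent st) (≼-mono a≤m m≼r))

          Piece : ℕ → Pred Carrier _
          Piece k β = StableSet a b β × v β ≡ [ + k ] × k ℕ.< b × k ℕ.< g

          Top : Pred Carrier _
          Top β = StableSet a b β × b ℕ.⊓ g ≼ β

          -- `N b β′` is divisible by `π ^ suc k`, so a homothety would make `β` and `β′` congruent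
          -- modulo `π ^ suc k`, although only one of them vanishes there.
          separated : ∀ {k β β′} → k ℕ.< b ℕ.⊓ g → v β ≡ [ + k ] → suc k ≼ β′ → ¬ Homothetic-β a b β β′
          separated {k} {β} {β′} k< vβ k≼ (β∈ , β′∈ , hom) = ≡⇒⋠ vβ (mod-≼ (homothetic⇒close {a} {b} β∈ β′∈ hom
              (ℕ.≤-trans k< (ℕ.≤-trans (ℕ.m⊓n≤n b g) (ℕ.⌈n/2⌉≤n a)))
              (≼-mono (ℕ.m≤m+n (suc k) (suc k)) (≼-N {suc k} {b} k≼ (ℕ.≤-trans k< (ℕ.m⊓n≤m b g))))) k≼)

          k+k≤a : ∀ {k} → k ℕ.< g → k ℕ.+ k ℕ.≤ a
          k+k≤a {k} k<g = ℕ.≤-trans (ℕ.+-mono-≤ (ℕ.s≤s⁻¹ (ℕ.≤-trans k<g g≤1+h)) (ℕ.<⇒≤ k<g)) (ℕ.≤-reflexive h+g≡a)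

          -- On the sphere `v β = k` stability means `a ≤ d + k`, that is `h + g + b ≤ k + c`, so a
          -- sphere counts as a whole or not at all. As `k + k ≤ a`, homothety on it is congruence
          -- modulo `π ^ (k + k)`.
          piece-enumeration : ∀ k → k ℕ.< g → Enumeration (Homothetic-β a b) (Piece k) ([ (k ℕ.<? b) ×-dec (h ℕ.+ g ℕ.+ b ℕ.≤? k ℕ.+ c) ]· level k)
          piece-enumeration k k<g with (k ℕ.<? b) ×-dec (h ℕ.+ g ℕ.+ b ℕ.≤? k ℕ.+ c)
          ... | yes (k<b , le) = Enumeration-resp (≡.sym ([]-yes ((k ℕ.<? b) ×-dec (h ℕ.+ g ℕ.+ b ℕ.≤? k ℕ.+ c)) (k<b , le)))
                  (λ vβ → stable-from (≼⇒𝒪 {k} (≡⇒v≥ vβ)) (≼-mono a≤d+k (≼-* (≼-π^ {d}) (≡⇒v≥ vβ))) , vβ , k<b , k<g)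
                  (λ (_ , vβ , _) → vβ)
                  (λ {β} {β′} vβ vβ′ → ≡.subst (λ e → (β ≡ β′ mod e → Homothetic-β a b β β′) × (Homothetic-β a b β β′ → β ≡ β′ mod e)) (ℕ.m≤n⇒m⊓n≡m (k+k≤a k<g))
                    (homothetic⇔congruent {a} {b} k (ℕ.<⇒≤ k<b) (≼⇒𝒪 {k} (≡⇒v≥ vβ)) (≼⇒𝒪 {k} (≡⇒v≥ vβ′)) (≡⇒v≥ vβ) (≡⇒v≥ vβ′) (inj₂ (inj₁ (vβ , vβ′)))))
                  (sphere-classes k)
            where
            a≤d+k : a ℕ.≤ d ℕ.+ k
            a≤d+k = ℕ.+-cancelʳ-≤ b a (d ℕ.+ k) (ℕ.≤-trans (ℕ.≤-reflexive (≡.cong (ℕ._+ b) (≡.sym h+g≡a))) (ℕ.≤-trans le (ℕ.≤-reflexive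
              (≡.trans (ℕ.+-comm k c) (≡.trans (≡.cong (ℕ._+ k) (≡.sym (≡.trans (ℕ.+-comm d b) b+d≡c))) (≡.trans (ℕ.+-assoc d b k) (≡.trans (≡.cong (d ℕ.+_) (ℕ.+-comm b k)) (≡.sym (ℕ.+-assoc d k b)))))))))
          ... | no ¬p = ≡.subst (Enumeration (Homothetic-β a b) (Piece k)) (≡.sym ([]-no ((k ℕ.<? b) ×-dec (h ℕ.+ g ℕ.+ b ℕ.≤? k ℕ.+ c)) ¬p)) (empty (λ β (st , vβ , k<b , _) → ¬p (k<b , (ℕ.≤-trans (ℕ.≤-reflexive (≡.cong (ℕ._+ b) h+g≡a))
                  (ℕ.≤-trans (ℕ.+-monoˡ-≤ b (≼-≡ (v-*-≡ (vπ^ d) vβ) (stable-to st)))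
                    (ℕ.≤-reflexive (≡.trans (≡.cong (ℕ._+ b) (ℕ.+-comm d k)) (≡.trans (ℕ.+-assoc k d b) (≡.cong (k ℕ.+_) (≡.trans (ℕ.+-comm d b) b+d≡c))))))))))

          -- `Top` is the residue class of 0 modulo the maximum on the left, and homothety on it is
          -- congruence to the modulus on the right; the second summand is the number of free
          -- digits. The cases decide which of `b`, `h` and `d` is least.
          size : (b ℕ.⊓ g ℕ.⊔ (a ℕ.∸ d)) ℕ.+ (b ℕ.⊓ h ℕ.⊓ d) ≡ ((b ℕ.⊓ g) ℕ.+ (b ℕ.⊓ g)) ℕ.⊓ a
          size with ℕ.≤-<-connex b h
          ... | inj₁ b≤h = ≡.trans (≡.cong₂ ℕ._+_
                    (≡.trans (≡.cong (ℕ._⊔ (a ℕ.∸ d)) b⊓g≡b) (ℕ.m≥n⇒m⊔n≡m (ℕ.m≤n+o⇒m∸n≤o a d (ℕ.≤-trans a≤c (ℕ.≤-reflexive (ℕ.+-comm b d))))))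
                    (≡.trans (≡.cong (ℕ._⊓ d) (ℕ.m≤n⇒m⊓n≡m b≤h)) (ℕ.m≤n⇒m⊓n≡m b≤d)))
                  (≡.sym (≡.trans (≡.cong (λ k → (k ℕ.+ k) ℕ.⊓ a) b⊓g≡b) (ℕ.m≤n⇒m⊓n≡m b+b≤a)))
            where
            b≤g = ℕ.≤-trans b≤h (ℕ.⌊n/2⌋≤⌈n/2⌉ a)
            b⊓g≡b = ℕ.m≤n⇒m⊓n≡m b≤g
            b+b≤a : b ℕ.+ b ℕ.≤ a
            b+b≤a = ℕ.≤-trans (ℕ.+-mono-≤ b≤h b≤g) (ℕ.≤-reflexive h+g≡a)
            b≤d : b ℕ.≤ d
            b≤d = ℕ.+-cancelˡ-≤ b b d (ℕ.≤-trans b+b≤a a≤c)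
          ... | inj₂ h<b with ℕ.≤-total h d
          ...   | inj₁ h≤d = ≡.trans (≡.cong₂ ℕ._+_
                    (≡.trans (≡.cong (ℕ._⊔ (a ℕ.∸ d)) b⊓g≡g) (ℕ.m≥n⇒m⊔n≡m (ℕ.m≤n+o⇒m∸n≤o a d (ℕ.≤-trans (ℕ.≤-reflexive (≡.sym h+g≡a)) (ℕ.+-monoˡ-≤ g h≤d)))))
                    (≡.trans (≡.cong (ℕ._⊓ d) (ℕ.m≥n⇒m⊓n≡n (ℕ.<⇒≤ h<b))) (ℕ.m≤n⇒m⊓n≡m h≤d)))
                  (≡.trans (≡.trans (ℕ.+-comm g h) h+g≡a) (≡.sym (≡.trans (≡.cong (λ k → (k ℕ.+ k) ℕ.⊓ a) b⊓g≡g) (ℕ.m≥n⇒m⊓n≡n a≤g+g))))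
            where b⊓g≡g = ℕ.m≥n⇒m⊓n≡n (ℕ.≤-trans g≤1+h h<b)
          ...   | inj₂ d≤h = ≡.trans (≡.cong₂ ℕ._+_
                    (≡.trans (≡.cong (ℕ._⊔ (a ℕ.∸ d)) b⊓g≡g) (ℕ.m≤n⇒m⊔n≡n (ℕ.m+n≤o⇒m≤o∸n g (ℕ.≤-trans (ℕ.+-monoʳ-≤ g d≤h) (ℕ.≤-reflexive (≡.trans (ℕ.+-comm g h) h+g≡a))))))
                    (≡.trans (≡.cong (ℕ._⊓ d) (ℕ.m≥n⇒m⊓n≡n (ℕ.<⇒≤ h<b))) (ℕ.m≥n⇒m⊓n≡n d≤h)))
                  (≡.trans (ℕ.m∸n+n≡m (ℕ.≤-trans d≤h (ℕ.⌊n/2⌋≤n a))) (≡.sym (≡.trans (≡.cong (λ k → (k ℕ.+ k) ℕ.⊓ a) b⊓g≡g) (ℕ.m≥n⇒m⊓n≡n a≤g+g))))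
            where b⊓g≡g = ℕ.m≥n⇒m⊓n≡n (ℕ.≤-trans g≤1+h h<b)

          top-enumeration : Enumeration (Homothetic-β a b) Top (q ℕ.^ (b ℕ.⊓ h ℕ.⊓ d))
          top-enumeration = Enumeration-resp ≡.refl to from
              (λ {β} {β′} p p′ → ≡.subst (λ e → (β ≡ β′ mod e → Homothetic-β a b β β′) × (Homothetic-β a b β β′ → β ≡ β′ mod e)) (≡.sym size)
                (homothetic⇔congruent {a} {b} (b ℕ.⊓ g) (ℕ.m⊓n≤m b g) (proj₁ (proj₁ (to p))) (proj₁ (proj₁ (to p′))) (proj₂ (to p)) (proj₂ (to p′))
                  ([ (λ b≤g → inj₂ (inj₂ (≡.sym (ℕ.m≤n⇒m⊓n≡m b≤g)))) , (λ g≤b → inj₁ (≡.subst (λ k → a ℕ.≤ k ℕ.+ k) (≡.sym (ℕ.m≥n⇒m⊓n≡n g≤b)) a≤g+g)) ]′ (ℕ.≤-total b g))))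
              (coset-enumeration (b ℕ.⊓ h ℕ.⊓ d) j 0#)
            where
            j = b ℕ.⊓ g ℕ.⊔ (a ℕ.∸ d)
            to : ∀ {β} → β ≡ 0# mod j → Top β
            to {β} p = stable-from (≼⇒𝒪 {j} j≼β) (≼-mono (ℕ.≤-trans (ℕ.m≤n+m∸n a d) (ℕ.+-monoʳ-≤ d (ℕ.m≤n⊔m (b ℕ.⊓ g) (a ℕ.∸ d)))) (≼-* (≼-π^ {d}) j≼β)) ,
                       ≼-mono (ℕ.m≤m⊔n (b ℕ.⊓ g) (a ℕ.∸ d)) j≼β
              where
              j≼β : j ≼ β
              j≼β = mod-≼ p v≥-0
            from : ∀ {β} → Top β → β ≡ 0# mod j
            from {β} (st , p) = v≥-- (⊔-≼ p a∸d≼β) v≥-0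
              where
              ⊔-≼ : ∀ {x y z} → x ≼ z → y ≼ z → x ℕ.⊔ y ≼ z
              ⊔-≼ {x} {y} {z} p q = [ (λ eq → ≡.subst (_≼ z) (≡.sym eq) p) , (λ eq → ≡.subst (_≼ z) (≡.sym eq) q) ]′ (ℕ.⊔-sel x y)
              a∸d≼β : a ℕ.∸ d ≼ β
              a∸d≼β = [ (λ d≤a → ≼-cancel-π d (≡.subst (_≼ π ^ d * β) (≡.sym (ℕ.m+[n∸m]≡n d≤a)) (stable-to st)))
                      , (λ a≤d → ≡.subst (_≼ β) (≡.sym (ℕ.m≤n⇒m∸n≡0 a≤d)) (proj₁ st)) ]′ (ℕ.≤-total d a)

        enumeration-≤ : Enumeration (Homothetic-β a b) (StableSet a b) (count≤ c h g b)
        enumeration-≤ = union (Hom-sym {a} {b}) (λ (_ , _ , st , _) → st) proj₁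
          (λ {β} st → [ (λ top → inj₂ (st , top))
                      , (λ (k , k< , vβ) → inj₁ (k , ℕ.≤-trans k< (ℕ.m⊓n≤n b g) , st , vβ , ℕ.≤-trans k< (ℕ.m⊓n≤m b g) , ℕ.≤-trans k< (ℕ.m⊓n≤n b g))) ]′
                      (≼-or-exact (b ℕ.⊓ g) (proj₁ st)))
          (λ (k , _ , _ , vβ , k<b , k<g) (_ , top) → separated (ℕ.⊓-glb k<b k<g) vβ (≼-mono (ℕ.⊓-glb k<b k<g) top))
          (⋃-below (Hom-sym {a} {b}) Piece (λ k → [ (k ℕ.<? b) ×-dec (h ℕ.+ g ℕ.+ b ℕ.≤? k ℕ.+ c) ]· level k) g piece-enumeration
            (λ i<j (_ , vβ , i<b , i<g) (_ , vβ′ , _) → separated (ℕ.⊓-glb i<b i<g) vβ (≼-mono i<j (≡⇒v≥ vβ′))))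
          top-enumeration

      module _ (m<a : m ℕ.< a) where
        private
          l j : ℕ
          l = m ℕ.∸ d
          j = a ℕ.∸ d

          -- `m < a ≤ f` excludes that the truncation happens at `f`.
          sharp : v r ≡ [ + m ] ⊎ m ≡ c
          sharp = [ inj₁ , [ inj₂ , (λ { ≡.refl → contradiction a≤f (ℕ.<⇒≱ m<a) }) ]′ ]′ m-sharp

          l≤b : l ℕ.≤ b
          l≤b = ℕ.m≤n+o⇒m∸n≤o m d (ℕ.≤-trans m≤c (ℕ.≤-reflexive (≡.trans (≡.sym b+d≡c) (ℕ.+-comm b d))))

          -- l is the common value of min(v β, b).
          congruent⇒l : ∀ {β} → 𝒪 β → a ≼ π ^ d * β - r → d ℕ.≤ m × l ≼ β × (v β ≡ [ + l ] ⊎ b ≡ l)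
          congruent⇒l {β} β∈ p = d≤m , ≼-cancel-π d (≡.subst (_≼ π ^ d * β) (≡.sym (ℕ.m+[n∸m]≡n d≤m)) m≼πβ) , exactness sharp
            where
            m≼πβ : m ≼ π ^ d * β
            m≼πβ = mod-≼ (≼-mono (ℕ.<⇒≤ m<a) p) m≼r
            vπβ : v r ≡ [ + m ] → v (π ^ d * β) ≡ [ + m ]
            vπβ vr = exact-resp (solve 2 (λ x r → r :+ (x :- r) := x) refl (π ^ d * β) r) (exact-+ vr (≼-mono m<a p))
            d≤m : d ℕ.≤ m
            d≤m = [ (λ vr → ≼-≡ (vπβ vr) (≼-*ʳ (≼-π^ {d}) β∈)) , (λ m≡c → ℕ.≤-trans (ℕ.m∸n≤m c b) (ℕ.≤-reflexive (≡.sym m≡c))) ]′ sharp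
            exactness : v r ≡ [ + m ] ⊎ m ≡ c → v β ≡ [ + l ] ⊎ b ≡ l
            exactness (inj₁ vr) = inj₁ (exact (≼-cancel-π d (≡.subst (_≼ π ^ d * β) (≡.sym (ℕ.m+[n∸m]≡n d≤m)) m≼πβ))
              (λ h → ≡⇒⋠ (vπβ vr) (≡.subst (_≼ π ^ d * β) (≡.trans (ℕ.+-suc d l) (≡.cong suc (ℕ.m+[n∸m]≡n d≤m))) (≼-* (≼-π^ {d}) h))))
            exactness (inj₂ m≡c) = inj₂ (≡.sym (≡.trans (≡.cong (ℕ._∸ d) m≡c) (ℕ.m∸[m∸n]≡n b≤c)))

          d+[l+l] : d ℕ.≤ m → d ℕ.+ (d ℕ.+ (l ℕ.+ l)) ≡ m ℕ.+ m
          d+[l+l] d≤m = ≡.trans (≡.trans (≡.sym (ℕ.+-assoc d d (l ℕ.+ l))) (+-interchange d d l l)) (≡.cong₂ ℕ._+_ (ℕ.m+[n∸m]≡n d≤m) (ℕ.m+[n∸m]≡n d≤m))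

          -- `N b β` has valuation exactly `l + l` with `l = m - d`, so the norm condition reads
          -- `a ≤ d + 2l = 2m - d`.
          stable⇒a+d≤m+m : ∀ {β} → StableSet a b β → a ℕ.+ d ℕ.≤ m ℕ.+ m
          stable⇒a+d≤m+m (β∈ , st) =
            let (d≤m , l≼β , h) = congruent⇒l β∈ (Stable.congruent st) in
            ℕ.≤-trans (ℕ.≤-reflexive (ℕ.+-comm a d)) (ℕ.≤-trans
              (ℕ.+-monoʳ-≤ d (≼-≡ (v-*-≡ (vπ^ d) (v-N {l} {b} l≼β l≤b h)) (Stable.norm-≼ st))) (ℕ.≤-reflexive (d+[l+l] d≤m)))

          module _ (a+d≤m+m : a ℕ.+ d ℕ.≤ m ℕ.+ m) where
            d≤m : d ℕ.≤ m
            d≤m = ℕ.+-cancelˡ-≤ m d m (ℕ.≤-trans (ℕ.+-monoˡ-≤ d (ℕ.<⇒≤ m<a)) a+d≤m+m)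

            d≤a : d ℕ.≤ a
            d≤a = ℕ.≤-trans d≤m (ℕ.<⇒≤ m<a)

            β₀ : Carrier
            β₀ = proj₁ (divide≼ d (≼-mono d≤m m≼r))

            r≈ : r ≈ π ^ d * β₀
            r≈ = proj₂ (proj₂ (divide≼ d (≼-mono d≤m m≼r)))

            size> : j ℕ.+ ((m ℕ.+ m ℕ.∸ a ℕ.∸ d) ℕ.⊓ d) ≡ (l ℕ.+ l) ℕ.⊓ a
            size> = ≡.trans (ℕ.+-distribˡ-⊓ j _ d) (≡.cong₂ ℕ._⊓_ (ℕ.+-cancelˡ-≡ (d ℕ.+ d) _ _ (≡.trans lhs (≡.sym (≡.trans (ℕ.+-assoc d d (l ℕ.+ l)) (d+[l+l] d≤m))))) (ℕ.m∸n+n≡m d≤a))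
              where
              k = m ℕ.+ m ℕ.∸ a ℕ.∸ d
              lhs : (d ℕ.+ d) ℕ.+ (j ℕ.+ k) ≡ m ℕ.+ m
              lhs = ≡.trans (+-interchange d d j k) (≡.trans (≡.cong₂ ℕ._+_ (ℕ.m+[n∸m]≡n d≤a) (ℕ.m+[n∸m]≡n (ℕ.m+n≤o⇒m≤o∸n d (ℕ.≤-trans (ℕ.≤-reflexive (ℕ.+-comm d a)) a+d≤m+m))))
                      (ℕ.m+[n∸m]≡n (ℕ.m+n≤o⇒m≤o a a+d≤m+m)))

            congruent⇔ : ∀ β → π ^ d * (β - β₀) ≈ π ^ d * β - r
            congruent⇔ β = trans (solve 3 (λ p β β₀ → p :* (β :- β₀) := p :* β :- p :* β₀) refl (π ^ d) β β₀) (+-congˡ (-‿cong (sym r≈)))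

            -- The coset of `β₀ = r / π ^ d` is the congruence condition. It forces `l ≼ β`, after
            -- which the norm condition follows from the numerical inequality `a + d ≤ 2m`.
            to> : ∀ {β} → β ≡ β₀ mod j → StableSet a b β
            to> {β} p = β∈ , record { b≤c = b≤c ; a≤f = a≤f ; congruent = cong ; norm-≼ = ≼-mono norm (≼-* (≼-π^ {d}) (≼-N {l} {b} l≼β l≤b)) }
              where
              β∈ : 𝒪 β
              β∈ = mod-≼ (≼⇒𝒪 {j} p) (proj₁ (proj₂ (divide≼ d (≼-mono d≤m m≼r))))
              cong : a ≼ π ^ d * β - r
              cong = v≥-resp (congruent⇔ β) (≡.subst (_≼ π ^ d * (β - β₀)) (ℕ.m+[n∸m]≡n d≤a) (≼-* (≼-π^ {d}) p))
              l≼β : l ≼ β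
              l≼β = proj₁ (proj₂ (congruent⇒l β∈ cong))
              norm : a ℕ.≤ d ℕ.+ (l ℕ.+ l)
              norm = ℕ.+-cancelˡ-≤ d a _ (ℕ.≤-trans (ℕ.≤-reflexive (ℕ.+-comm d a)) (ℕ.≤-trans a+d≤m+m (ℕ.≤-reflexive (≡.sym (d+[l+l] d≤m)))))

            from> : ∀ {β} → StableSet a b β → β ≡ β₀ mod j
            from> {β} (β∈ , st) = ≼-cancel-π d (≡.subst (_≼ π ^ d * (β - β₀)) (≡.sym (ℕ.m+[n∸m]≡n d≤a)) (v≥-resp (sym (congruent⇔ β)) (Stable.congruent st)))

            coset-classes : Enumeration (Homothetic-β a b) (StableSet a b) (q ℕ.^ ((m ℕ.+ m ℕ.∸ a ℕ.∸ d) ℕ.⊓ d))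
            coset-classes = Enumeration-resp ≡.refl to> from>
              (λ {β} {β′} p p′ → ≡.subst (λ e → (β ≡ β′ mod e → Homothetic-β a b β β′) × (Homothetic-β a b β β′ → β ≡ β′ mod e)) (≡.sym size>) (related (to> p) (to> p′)))
              (coset-enumeration _ j β₀)
              where
              related : ∀ {β β′} → StableSet a b β → StableSet a b β′ → (β ≡ β′ mod ((l ℕ.+ l) ℕ.⊓ a) → Homothetic-β a b β β′) × (Homothetic-β a b β β′ → β ≡ β′ mod ((l ℕ.+ l) ℕ.⊓ a))
              related (β∈ , st) (β′∈ , st′) =
                let (_ , l≼β , h) = congruent⇒l β∈ (Stable.congruent st) ; (_ , l≼β′ , h′) = congruent⇒l β′∈ (Stable.congruent st′)
                in homothetic⇔congruent {a} {b} l l≤b β∈ β′∈ l≼β l≼β′ (inj₂ (both h h′))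
                where
                both : ∀ {β β′} → v β ≡ [ + l ] ⊎ b ≡ l → v β′ ≡ [ + l ] ⊎ b ≡ l → (v β ≡ [ + l ] × v β′ ≡ [ + l ]) ⊎ b ≡ l
                both (inj₁ p) (inj₁ p′) = inj₁ (p , p′)
                both (inj₂ p) _         = inj₂ p
                both _        (inj₂ p)  = inj₂ p

        enumeration-> : Enumeration (Homothetic-β a b) (StableSet a b) (count> c m a b)
        enumeration-> with a ℕ.+ d ℕ.≤? m ℕ.+ m
        ... | yes le = ≡.subst (Enumeration (Homothetic-β a b) (StableSet a b)) (≡.sym ([]-yes (a ℕ.+ d ℕ.≤? m ℕ.+ m) le)) (coset-classes le)
        ... | no ¬le = ≡.subst (Enumeration (Homothetic-β a b) (StableSet a b)) (≡.sym ([]-no (a ℕ.+ d ℕ.≤? m ℕ.+ m) ¬le)) (empty (λ β st → ¬le (stable⇒a+d≤m+m st)))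

      classes : Enumeration (Homothetic-β a b) (StableSet a b) (count c m a b)
      classes = [ (λ a≤m → ≡.subst (Enumeration (Homothetic-β a b) (StableSet a b)) (≡.sym (count-≤ {c} {m} a≤m b)) (enumeration-≤ a≤m))
                , (λ m<a → ≡.subst (Enumeration (Homothetic-β a b) (StableSet a b)) (≡.sym (count-> {c} {m} m<a b)) (enumeration-> m<a)) ]′ (ℕ.≤-<-connex a m)

-- From parameters to ideal classes

-- `g` depends on the membership proof because an ideal is built from a parameter together with its
-- stability. Accordingly, surjectivity has to hold for every parameter related to `x` and every
-- such proof.
image : ∀ {a b r s p q n} {A : Set a} {B : Set b} {_~_ : Rel A r} {_≈_ : Rel B s} {P : Pred A p} {Q : Pred B q}
        (g : ∀ x → P x → B) → (∀ x p → Q (g x p)) → (∀ x y p q → g x p ≈ g y q → x ~ y) →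
        (∀ {y} → Q y → ∃[ x ] P x × (∀ x′ p′ → x ~ x′ → y ≈ g x′ p′)) → Enumeration _~_ P n → Enumeration _≈_ Q n
image g g∈ inj surj e = record
  { enum      = λ i → g (enum e i) (enum∈ e i)
  ; enum∈     = λ i → g∈ (enum e i) (enum∈ e i)
  ; injective = λ h → injective e (inj _ _ _ _ h)
  ; covers    = λ y∈ → let (x , x∈ , h) = surj y∈ ; (i , x~) = covers e x∈ in i , h (enum e i) (enum∈ e i) x~
  }

enumeration⇒cardinality : ∀ {a ℓ p n} (A : Setoid a ℓ) {P : Pred (Setoid.Carrier A) p} → (∀ x → P x) → Enumeration (Setoid._≈_ A) P n → HasCardinality A n
enumeration⇒cardinality A all e = record
  { to        = enum e
  ; cong      = λ { ≡.refl → Setoid.refl A }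
  ; bijective = injective e , λ y → let (i , y≈) = covers e (all y) in i , λ { ≡.refl → Setoid.sym A y≈ }
  }

-- Writing `f = m + p` and `c = m + w` turns `f ≤ 2m` into `p ≤ m` and determines `f₂` as
-- `m + p + w`.
∑-count≡formula : ∀ q (q≥1 : 1 ℕ.≤ q) {f c m f₁ f₂ S} → m ℕ.≤ f → m ℕ.≤ c → f ℕ.≤ m ℕ.+ m → f ≡ f₁ → f₂ ℕ.+ m ≡ f ℕ.+ c → S ≡ f ℕ.+ c →
  + ∑[ suc c ] (λ b → ∑[ suc f ] (λ a → Formula.count q q≥1 c m a b)) ≡ classNumberFormula q f₁ f₂ S
∑-count≡formula q q≥1 {f} {c} {m} {f₂ = f₂} m≤f m≤c f≤2m ≡.refl f₂+m ≡.refl = go (ℕ.m≤n⇒∃[o]m+o≡n m≤f) (ℕ.m≤n⇒∃[o]m+o≡n m≤c)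
  where
  go : ∃[ p ] m ℕ.+ p ≡ f → ∃[ w ] m ℕ.+ w ≡ c → _
  go (p , ≡.refl) (w , ≡.refl) = ≡.subst (λ k → + ∑[ suc c ] (λ b → ∑[ suc f ] (λ a → Formula.count q q≥1 c m a b)) ≡ classNumberFormula q f k (f ℕ.+ c))
    (ℕ.+-cancelʳ-≡ m (m ℕ.+ p ℕ.+ w) f₂ (≡.trans (≡.trans (ℕ.+-assoc (m ℕ.+ p) w m) (≡.cong (m ℕ.+ p ℕ.+_) (ℕ.+-comm w m))) (≡.sym f₂+m)))
    (Formula.count-formula q q≥1 m p w (ℕ.+-cancelˡ-≤ m p m f≤2m))

module ClassNumber {ℓ} (F : NonArchimedeanLocalField ℓ) (E′ : UnramifiedQuadraticExtension F)
    {π} (vπ : NonArchimedeanLocalField.IsUniformizer F π) (generator : IntegralGenerator F E′)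
    (q≥1 : 1 ℕ.≤ NonArchimedeanLocalField.q F)
    (O : Orders.Order F E′) {f₁ f₂} (conductor≐ : Orders.conductor F E′ O ≐ Orders.PowerIdeal F E′ π f₁ f₂)
    {f c r} (r∈𝒪 : NonArchimedeanLocalField.𝒪 F r) (R≐L : Orders.Order.R O ≐ Lattices.L F E′ vπ generator f c r) where
  open NonArchimedeanLocalField F hiding (zero; sym; trans; refl)
  open Valuation valuedField using (_≼_)
  open Lattices F E′ vπ generator
  open OrderInvariants F E′ vπ generator O {f₁} {f₂} conductor≐ {f} {c} {r} r∈𝒪 R≐L
  open Counting F E′ vπ generator q≥1
  open Formula q q≥1 using (count)
  open Orders F E′ using (Order; FractionalIdeal; Cl)
  open FractionalIdeal using (I; isSubmodule)
  private
    module Cl = Setoid (Cl O)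

  homothetic⇒≃ : ∀ J J′ → Homothetic (I J) (I J′) → J Cl.≈ J′
  homothetic⇒≃ J J′ h = factor , (factor⁻¹ , inverseʳ) ,
    (λ {w} w∈ → factor⁻¹ 𝔼.* w , from w∈ , 𝔼.sym (𝔼.trans (𝔼.sym (𝔼.*-assoc _ _ _)) (𝔼.trans (𝔼.*-congʳ inverseʳ) (𝔼.*-identityˡ w)))) ,
    (λ (y , y∈ , x≈) → IsSubmodule.resp (isSubmodule J′) (𝔼.sym x≈) (to y∈))
    where
    open Homothetic h
    open Submodules (Orders.E F E′) using (module IsSubmodule)

  ≃⇒homothetic : ∀ J J′ → J Cl.≈ J′ → Homothetic (I J) (I J′)
  ≃⇒homothetic J J′ (e , (e⁻¹ , ee⁻¹) , J′⊆ , ⊆J′) = record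
    { factor = e ; factor⁻¹ = e⁻¹ ; inverseʳ = ee⁻¹
    ; to   = λ {z} z∈ → ⊆J′ (z , z∈ , 𝔼.refl)
    ; from = λ {w} w∈ → let (y , y∈ , w≈) = J′⊆ w∈ in
        IsSubmodule.resp (isSubmodule J) (𝔼.sym (𝔼.trans (𝔼.*-congˡ w≈) (𝔼.trans (𝔼.sym (𝔼.*-assoc _ _ _)) (𝔼.trans (𝔼.*-congʳ (𝔼.trans (𝔼.*-comm e⁻¹ e) ee⁻¹)) (𝔼.*-identityˡ y))))) y∈
    }
    where open Submodules (Orders.E F E′) using (module IsSubmodule)

  Class : ℕ → ℕ → Pred (FractionalIdeal O) ℓ
  Class a b J = ∃[ β ] 𝒪 β × Stable f c r a b β × Homothetic (L a b β) (I J)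

  -- Passing through the model ideals `L a b β` and `L a′ b′ β′` reduces this to homotheties between
  -- lattices in normal form, and each of the two inequalities is used in both directions.
  Class-separated : ∀ {a b a′ b′ J J′} → Class a b J → Class a′ b′ J′ → J Cl.≈ J′ → a ≡ a′ × b ≡ b′
  Class-separated {a} {b} {a′} {b′} {J} {J′} (β , β∈ , st , h) (β′ , β′∈ , st′ , h′) J≃J′ =
    ℕ.≤-antisym (homothetic⇒a′≤a {a′} {b′} {a} {b} β′∈ β∈ (Homothetic-sym hom)) (homothetic⇒a′≤a {a} {b} {a′} {b′} β∈ β′∈ hom) ,
    ℕ.≤-antisym (homothetic⇒b′≤b {a′} {b′} {a} {b} β′∈ β∈ (Homothetic-sym hom)) (homothetic⇒b′≤b {a} {b} {a′} {b′} β∈ β′∈ hom)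
    where
    K  = ideal {a} {b} {β} β∈ st
    K′ = ideal {a′} {b′} {β′} β′∈ st′
    hom : Homothetic (L a b β) (L a′ b′ β′)
    hom = ≃⇒homothetic K K′ (Cl.trans {K} {J} {K′} (homothetic⇒≃ K J h) (Cl.trans {J} {J′} {K′} J≃J′ (Cl.sym {K′} {J′} (homothetic⇒≃ K′ J′ h′))))

  module _ {m} (m≤c : m ℕ.≤ c) (m≼r : m ≼ r) (m-sharp : v r ≡ [ + m ] ⊎ m ≡ c ⊎ m ≡ f) where

    Class-enumeration : ∀ a b → a ℕ.≤ f → b ℕ.≤ c → Enumeration Cl._≈_ (Class a b) (count c m a b)
    Class-enumeration a b a≤f b≤c = image K K∈ K-injective (λ {J} → K-surjective {J}) (classes {f} {c} {r} {m} m≤c r∈𝒪 m≼r m-sharp {a} {b} a≤f b≤c)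
      where
      StableParameter : Pred Carrier Level.0ℓ
      StableParameter β = 𝒪 β × Stable f c r a b β
      K : ∀ β → StableParameter β → FractionalIdeal O
      K β (β∈ , st) = ideal {a} {b} {β} β∈ st
      K∈ : ∀ β p → Class a b (K β p)
      K∈ β p@(β∈ , st) = β , β∈ , st , ≃⇒homothetic (K β p) (K β p) (Cl.refl {K β p})
      K-injective : ∀ β β′ p p′ → K β p Cl.≈ K β′ p′ → Homothetic-β a b β β′
      K-injective β β′ p p′ h = proj₁ p , proj₁ p′ , ≃⇒homothetic (K β p) (K β′ p′) h
      K-surjective : ∀ {J} → Class a b J → ∃[ β ] StableParameter β × (∀ β′ p′ → Homothetic-β a b β β′ → J Cl.≈ K β′ p′)
      K-surjective {J} (β , β∈ , st , h) = β , (β∈ , st) , λ β′ p′ (_ , _ , h′) →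
        Cl.trans {J} {K β (β∈ , st)} {K β′ p′} (Cl.sym {K β (β∈ , st)} {J} (homothetic⇒≃ (K β (β∈ , st)) J h)) (homothetic⇒≃ (K β (β∈ , st)) (K β′ p′) h′)

    private
      Row : ℕ → Pred (FractionalIdeal O) ℓ
      Row b J = ∃[ a ] a ℕ.< suc f × Class a b J

      row-size : ℕ → ℕ
      row-size b = ∑[ suc f ] (λ a → count c m a b)

      Row-enumeration : ∀ b → b ℕ.< suc c → Enumeration Cl._≈_ (Row b) (row-size b)
      Row-enumeration b b≤c = ⋃-below (λ {J} {J′} → Cl.sym {J} {J′}) (λ a → Class a b) (λ a → count c m a b) (suc f)
        (λ a a≤f → Class-enumeration a b (ℕ.s≤s⁻¹ a≤f) (ℕ.s≤s⁻¹ b≤c))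
        (λ {a} {a′} {J} {J′} a<a′ J∈ J′∈ h → ℕ.<⇒≢ a<a′ (proj₁ (Class-separated {a} {b} {a′} {b} {J} {J′} J∈ J′∈ h)))

    class-enumeration : Enumeration Cl._≈_ (λ J → ∃[ b ] b ℕ.< suc c × Row b J) (∑[ suc c ] row-size)
    class-enumeration = ⋃-below (λ {J} {J′} → Cl.sym {J} {J′}) Row row-size (suc c) Row-enumeration
      (λ {b} {b′} {J} {J′} b<b′ (a , _ , J∈) (a′ , _ , J′∈) h → ℕ.<⇒≢ b<b′ (proj₂ (Class-separated {a} {b} {a′} {b′} {J} {J′} J∈ J′∈ h)))

    class-number : HasCardinality (Cl O) (∑[ suc c ] row-size)
    class-number = enumeration⇒cardinality (Cl O) (λ J → classify J (normal-form-ideal J)) class-enumeration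
      where
      classify : ∀ J → ∃[ a ] ∃[ b ] ∃[ β ] 𝒪 β × Stable f c r a b β × Homothetic (L a b β) (I J) → ∃[ b ] b ℕ.< suc c × Row b J
      classify J (a , b , β , β∈ , st , h) = b , s≤s (Stable.b≤c st) , a , s≤s (Stable.a≤f st) , β , β∈ , st , h

  conclusion : ∀ {S} → Orders.HasColength F E′ O S → ∃[ N ] HasCardinality (Cl O) N × + N ≡ classNumberFormula q f₁ f₂ S
  conclusion {S} hasColength = from-valuation valuation-r
    where
    from-valuation : ∃[ m ] m ℕ.≤ c × m ℕ.≤ f × m ≼ r × (v r ≡ [ + m ] ⊎ m ≡ c ⊎ m ≡ f) → ∃[ N ] HasCardinality (Cl O) N × + N ≡ classNumberFormula q f₁ f₂ S
    from-valuation (m , m≤c , m≤f , m≼r , sharp) = _ , class-number m≤c m≼r sharp ,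
      ∑-count≡formula q q≥1 m≤f m≤c (f≤m+m m≤c m≤f m≼r sharp) f≡f₁ (f₂+m≡f+c m≤c m≤f m≼r sharp)
        (colength hasColength)

theorem5p2 : ∀ {ℓ} (F : NonArchimedeanLocalField ℓ) (E′ : UnramifiedQuadraticExtension F) →
    let open NonArchimedeanLocalField F
        open Orders F E′
    in
    (π : NonArchimedeanLocalField.Carrier F) → IsUniformizer π →
    (R : Order) (f₁ f₂ S : ℕ) →
    conductor R ≐ PowerIdeal π f₁ f₂ →
    HasColength R S →
    ∃[ N ] HasCardinality (Cl R) N × + N ≡ classNumberFormula q f₁ f₂ S
theorem5p2 F E′ π vπ R f₁ f₂ S conductor≐ colength = with-generator (integral-generator F E′)
  where
  open NonArchimedeanLocalField F using (q; 𝒪)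
  open Orders F E′ using (Cl; module Order)
  with-generator : IntegralGenerator F E′ → ∃[ N ] HasCardinality (Cl R) N × + N ≡ classNumberFormula q f₁ f₂ S
  with-generator generator = with-normal-form (OrderNormalForm.order-normal-form F E′ vπ generator R {f₁} {f₂} conductor≐)
    where
    with-normal-form : ∃[ f ] ∃[ c ] ∃[ r ] 𝒪 r × Order.R R ≐ Lattices.L F E′ vπ generator f c r → ∃[ N ] HasCardinality (Cl R) N × + N ≡ classNumberFormula q f₁ f₂ S
    with-normal-form (f , c , r , r∈𝒪 , R≐L) =
      ClassNumber.conclusion F E′ vπ generator (Residues.q≥1 F vπ) R {f₁} {f₂} conductor≐ {f} {c} {r} r∈𝒪 R≐L colength
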